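{- Let $\mu$ be a partition (possibly empty) and let $r$ and $m$ be positive integers. Then, in the ring of symmetric functions, $$s_{\mu}\,(p_r\circ h_m)=\sum_{\substack{\lambda\in\mathrm{Par}(|\mu|+rm)\\ \mu\subseteq\lambda}}\operatorname{sgn}_r(\lambda/\mu)\,s_{\lambda}.$$
   Context: Partitions. A partition $\lambda=(\lambda_1,\dots,\lambda_l)$ is a non-increasing sequence of positive integers, with size $|\lambda|=\sum_i\lambda_i$ and length $\ell(\lambda)=l$; set $\lambda_i=0$ for $i>\ell(\lambda)$. $\mathrm{Par}(n)$ is the set of partitions of size $n$. The Young diagram is $Y_\lambda=\{(i,j): 1\le i\leq \ell(\lambda),\ 1\le j\leq\lambda_i\}$; its elements are called boxes. Write $\mu\subseteq\lambda$ if $Y_\mu\subseteq Y_\lambda$. A skew partition $\lambda/\mu$ is a pair of partitions $\mu\subseteq\lambda$, with Young diagram $Y_{\lambda/\mu}=Y_\lambda\setminus Y_\mu$. The top $t(\lambda/\mu)$ is $0$ if $\lambda=\mu$ and otherwise the least $i$ with $\lambda_i\ne\mu_i$; the bottom $b(\lambda/\mu)$ is $0$ if $\lambda=\mu$ and otherwise the greatest $i$ with $\lambda_i\neq\mu_i$. Border strips and signs. An $r$-border strip is a skew partition $\lambda/\mu$ whose diagram consists of $r$ boxes, is connected via edge-adjacency, and satisfies: for all $(i,j)\in Y_{\lambda/\mu}$, $(i+1,j+1)\notin Y_{\lambda/\mu}$. Its sign is $\operatorname{sgn}(\lambda/\mu)=(-1)^{b(\lambda/\mu)-t(\lambda/\mu)}$.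 A skew partition $\lambda/\mu$ is $r$-decomposable if there are $d\ge 0$ and partitions $\mu=\gamma^{(0)}\subseteq\gamma^{(1)}\subseteq\dots\subseteq\gamma^{(d)}=\lambda$ such that each $\gamma^{(i+1)}/\gamma^{(i)}$ ($0\le i\le d-1$) is an $r$-border strip and $t(\gamma^{(1)}/\gamma^{(0)})\geq t(\gamma^{(2)}/\gamma^{(1)})\geq\dots\geq t(\gamma^{(d)}/\gamma^{(d-1)})$; such a chain is unique if it exists. Define $\operatorname{sgn}_r(\lambda/\mu)=\prod_{i=1}^{d}\operatorname{sgn}(\gamma^{(i)}/\gamma^{(i-1)})$ if $\lambda/\mu$ is $r$-decomposable, and $\operatorname{sgn}_r(\lambda/\mu)=0$ otherwise. Symmetric functions. $s_\lambda$ is the Schur function; its specialisation to $N\ge\ell(\lambda)$ variables is the Schur polynomial $s_\lambda(x_1,\dots,x_N)=a_{\lambda+\delta(N)}/a_{\delta(N)}$, where $a_\beta=\det(x_i^{\beta_j})_{1\le i,j\le N}$ and $\delta(N)=(N-1,N-2,\dots,0)$. $h_m$ is the complete homogeneous symmetric function (the sum of all monomials of degree $m$), $p_r=\sum_i x_i^r$ is the power sum, and the plethysm $p_r\circ h_m$ is obtained from $h_m$ by replacing each variable $x_i$ by $x_i^r$. Since both sides are homogeneous of degree $|\mu|+rm$, the identity is equivalent to the corresponding identity of symmetric polynomials in $N$ variables for any $N\ge|\mu|+rm$. -}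

module Defs where

open import Data.Bool using (true; false; if_then_else_)
open import Data.Fin as Fin using (Fin; toℕ; punchIn)
open import Data.Fin.Permutation using (Permutation′; _⟨$⟩ʳ_; flip; inverseˡ)
open import Data.Integer as ℤ using (ℤ; 0ℤ; 1ℤ; -1ℤ)
import Data.Integer.Properties as ℤₚ
open import Data.List as List
  using (List; []; _∷_; _++_; allFin; cartesianProductWith; concatMap; filter; foldr; head; last;
         length; map; mapMaybe; upTo)
open import Data.List.Membership.Propositional as Membership using (find; lose)
open import Data.List.Membership.Propositional.Properties using (∈-concatMap⁺; ∈-map⁺; ∈-upTo⁺)
open import Data.List.Properties
  using (++-identityʳ; filter-accept; filter-reject; length-filter; map-++; map-cong; map-∘)
  renaming (≡-dec to List-≡-dec)
open import Data.List.Relation.Unary.All as All using (All; []; _∷_)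
open import Data.List.Relation.Unary.All.Properties using (all-filter; ++⁺; map⁺)
open import Data.List.Relation.Unary.Any as Any using (Any; here; there)
open import Data.List.Relation.Unary.Linked as Linked using (Linked; []; linked?)
open import Data.Maybe using (Maybe; just; nothing; fromMaybe)
open import Data.Maybe.Relation.Binary.Connected as Connected using (connected?)
open import Data.Nat as ℕ
  using (ℕ; zero; suc; _+_; _*_; _∸_; _≤_; _<_; _≥_; z≤n; s≤s; ∣_-_∣; NonZero)
open import Data.Nat.ListAction using (sum)
import Data.Nat.Properties as ℕₚ
open import Data.Product using (Σ; ∃; _×_; _,_; proj₁; proj₂; map₁; map₂)
open import Data.Sum using (_⊎_; inj₁; inj₂)
open import Data.Vec as Vec using (Vec; []; _∷_; lookup; replicate; tabulate; zipWith; _[_]≔_)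
import Data.Vec.Properties as Vecₚ
import Algebra.Properties.CommutativeMonoid.Sum ℕₚ.+-0-commutativeMonoid as Sum
open import Function using (_∘_)
open import Level using (0ℓ)
open import Relation.Binary using (Rel)
open import Relation.Binary.Construct.Closure.ReflexiveTransitive using (Star; ε; _◅_; _◅◅_)
open import Relation.Binary.PropositionalEquality
open import Relation.Nullary using (¬_; Dec; does; yes; no; contradiction)
open import Relation.Nullary.Decidable
  using (¬?; _×-dec_; _⊎-dec_; _→-dec_; dec-true; dec-false; map′)
import Relation.Unary as U

record Partition : Set where
  constructor mkPartition
  field
    parts         : List ℕ
    positive      : All (0 <_) parts
    nonIncreasing : Linked _≥_ parts

open Partition public

size : Partition → ℕ
size = sum ∘ parts

ℓ : Partition → ℕ
ℓ = length ∘ parts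

entry : List ℕ → ℕ → ℕ
entry []       _       = 0
entry (x ∷ xs) zero    = x
entry (x ∷ xs) (suc i) = entry xs i

-- part lam i is the i-th part, counted from 1, and is 0 for i > ℓ lam.
-- (The index 0 is never used.)
part : Partition → ℕ → ℕ
part lam zero    = 0
part lam (suc i) = entry (parts lam) i

parts-injective : ∀ {lam μ} → parts lam ≡ parts μ → lam ≡ μ
parts-injective {mkPartition xs p q} {mkPartition .xs p′ q′} refl =
  cong₂ (mkPartition xs) (All.irrelevant ℕₚ.≤-irrelevant p p′)
                       (Linked.irrelevant ℕₚ.≤-irrelevant q q′)

_≟ₚ_ : (lam μ : Partition) → Dec (lam ≡ μ)
lam ≟ₚ μ = map′ parts-injective (cong parts) (List-≡-dec ℕ._≟_ (parts lam) (parts μ))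

-- Every composition of suc n arises exactly once from a composition of n,
-- by prepending a part 1 or by raising the first part by one.
compositions : ℕ → List (List ℕ)
compositions zero    = [] ∷ []
compositions (suc n) = concatMap extend (compositions n)
  where
  extend : List ℕ → List (List ℕ)
  extend []       = (1 ∷ []) ∷ []
  extend (k ∷ ks) = (1 ∷ k ∷ ks) ∷ (suc k ∷ ks) ∷ []

asPartition : List ℕ → Maybe Partition
asPartition xs with All.all? (0 ℕ.<?_) xs | linked? ℕ._≥?_ xs
... | yes p | yes q = just (mkPartition xs p q)
... | _     | _     = nothing

-- The weakly decreasing compositions of n.
Par : ℕ → List Partition
Par n = mapMaybe asPartition (compositions n)

Box : Set
Box = ℕ × ℕ

Y : Partition → U.Pred Box 0ℓ
Y lam (i , j) = (1 ≤ i × i ≤ ℓ lam) × (1 ≤ j × j ≤ part lam i)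

infix 4 _⊆_ _⊆?_

_⊆_ : Rel Partition 0ℓ
μ ⊆ lam = Y μ U.⊆ Y lam

-- The diagram of the skew partition lam / μ; the relation μ ⊆ lam is
-- imposed separately wherever skew partitions occur.
Y[_/_] : Partition → Partition → U.Pred Box 0ℓ
Y[ lam / μ ] = Y lam U.∖ Y μ

differingRows : Partition → Partition → List ℕ
differingRows lam μ = filter (λ i → ¬? (part lam i ℕ.≟ part μ i)) (map suc (upTo (ℓ lam)))

-- For μ ⊆ lam the rows where lam and μ differ all have index at most ℓ lam.
top : Partition → Partition → ℕ
top lam μ = fromMaybe 0 (head (differingRows lam μ))

bottom : Partition → Partition → ℕ
bottom lam μ = fromMaybe 0 (last (differingRows lam μ))

Adjacent : Rel Box 0ℓ
Adjacent (i , j) (i′ , j′) = ∣ i - i′ ∣ + ∣ j - j′ ∣ ≡ 1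

Step : U.Pred Box 0ℓ → Rel Box 0ℓ
Step P x y = (P x × P y) × Adjacent x y

Connected : U.Pred Box 0ℓ → Set
Connected P = ∀ {x y} → P x → P y → Star (Step P) x y

-- For μ ⊆ lam the diagram of lam / μ has size lam ∸ size μ boxes, so boxes
-- says that there are r of them.
record BorderStrip (r : ℕ) (lam μ : Partition) : Set where
  field
    contained : μ ⊆ lam
    boxes     : size lam ≡ r + size μ
    connected : Connected Y[ lam / μ ]
    noSquare  : ∀ {i j} → Y[ lam / μ ] (i , j) → ¬ Y[ lam / μ ] (suc i , suc j)

sgn : Partition → Partition → ℤ
sgn lam μ = -1ℤ ℤ.^ (bottom lam μ ∸ top lam μ)

-- Chains μ = γ⁽⁰⁾ , γ⁽¹⁾ , … , γ⁽ᵈ⁾ = lam in which every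
-- γ⁽ⁱ⁺¹⁾ / γ⁽ⁱ⁾ is an r-border strip.
Chain : ℕ → Partition → Partition → Set
Chain r μ lam = Star (λ γ γ′ → BorderStrip r γ′ γ) μ lam

tops : ∀ {r μ lam} → Chain r μ lam → List ℕ
tops ε                      = []
tops (_◅_ {γ} {γ′} strip c) = top γ′ γ ∷ tops c

chainSign : ∀ {r μ lam} → Chain r μ lam → ℤ
chainSign ε                      = 1ℤ
chainSign (_◅_ {γ} {γ′} strip c) = sgn γ′ γ ℤ.* chainSign c

Decomposition : ℕ → Partition → Partition → Set
Decomposition r lam μ = Σ (Chain r μ lam) λ c → Linked _≥_ (tops c)

∈-compositions : ∀ {xs} → All (0 <_) xs → xs Membership.∈ compositions (sum xs)
∈-compositions []                            = here refl
∈-compositions (_∷_ {suc zero} {[]}     _ p) = here refl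
∈-compositions (_∷_ {suc zero} {y ∷ ys} _ p) =
  ∈-concatMap⁺ _ (Any.map (λ { refl → here refl }) (∈-compositions p))
∈-compositions (_∷_ {suc (suc x)} {xs} _ p)  =
  ∈-concatMap⁺ _ (Any.map (λ { refl → there (here refl) })
    (∈-compositions (s≤s (z≤n {x}) ∷ p)))

asPartition-parts : ∀ lam → asPartition (parts lam) ≡ just lam
asPartition-parts lam with All.all? (0 ℕ.<?_) (parts lam) | linked? ℕ._≥?_ (parts lam)
... | yes p | yes q = cong just (parts-injective refl)
... | yes _ | no ¬q = contradiction (nonIncreasing lam) ¬q
... | no ¬p | _     = contradiction (positive lam) ¬p

∈-mapMaybe : ∀ {A B : Set} (f : A → Maybe B) {x y xs} → x Membership.∈ xs → f x ≡ just y →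
             y Membership.∈ mapMaybe f xs
∈-mapMaybe f {x} (here refl) eq with f x
∈-mapMaybe f {x} (here refl) refl | just _ = here refl
∈-mapMaybe f {xs = z ∷ _} (there x∈xs) eq with f z
... | just _  = there (∈-mapMaybe f x∈xs eq)
... | nothing = ∈-mapMaybe f x∈xs eq

∈-Par : ∀ lam → lam Membership.∈ Par (size lam)
∈-Par lam = ∈-mapMaybe asPartition (∈-compositions (positive lam)) (asPartition-parts lam)

Y? : ∀ lam → U.Decidable (Y lam)
Y? lam (i , j) = (1 ℕ.≤? i ×-dec i ℕ.≤? ℓ lam) ×-dec (1 ℕ.≤? j ×-dec j ℕ.≤? part lam i)

Y[_/_]? : ∀ lam μ → U.Decidable Y[ lam / μ ]
Y[ lam / μ ]? x = Y? lam x ×-dec ¬? (Y? μ x)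

gridRow : Partition → ℕ → List Box
gridRow lam i = map (i ,_) (upTo (suc (part lam i)))

grid : Partition → List Box
grid lam = concatMap (gridRow lam) (upTo (suc (ℓ lam)))

∈-grid : ∀ {lam x} → Y lam x → x Membership.∈ grid lam
∈-grid {lam} {i , j} ((_ , i≤) , (_ , j≤)) =
  ∈-concatMap⁺ (gridRow lam) (Any.map (λ { refl → ∈-map⁺ (i ,_) (∈-upTo⁺ (s≤s j≤)) }) (∈-upTo⁺ (s≤s i≤)))

∀-grid? : ∀ lam {P Q : U.Pred Box 0ℓ} → (∀ x → P x → Y lam x) →
          U.Decidable P → U.Decidable Q → Dec (∀ x → P x → Q x)
∀-grid? lam P⊆Y P? Q? =
  map′ (λ all x px → All.lookup all (∈-grid {lam} (P⊆Y x px)) px)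
       (λ f → All.tabulate (λ {x} _ → f x))
       (All.all? (λ x → P? x →-dec Q? x) (grid lam))

_⊆?_ : ∀ μ lam → Dec (μ ⊆ lam)
μ ⊆? lam = map′ (λ f {x} → f x) (λ f x → f {x})
  (∀-grid? μ (λ _ y → y) (Y? μ) (Y? lam))

-- Reachability in a graph, with all intermediate vertices in a given list.
Reach : ∀ {A : Set} → Rel A 0ℓ → List A → Rel A 0ℓ
Reach E []       x y = x ≡ y ⊎ E x y
Reach E (v ∷ vs) x y = Reach E vs x y ⊎ (Reach E vs x v × Reach E vs v y)

Reach? : ∀ {A : Set} {E : Rel A 0ℓ} → (∀ x y → Dec (x ≡ y)) → (∀ x y → Dec (E x y)) →
         ∀ vs x y → Dec (Reach E vs x y)
Reach? _≟_ E? []       x y = (x ≟ y) ⊎-dec E? x y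
Reach? _≟_ E? (v ∷ vs) x y =
  Reach? _≟_ E? vs x y ⊎-dec (Reach? _≟_ E? vs x v ×-dec Reach? _≟_ E? vs v y)

Reach⇒Star : ∀ {A : Set} {E : Rel A 0ℓ} vs {x y} → Reach E vs x y → Star E x y
Reach⇒Star []       (inj₁ refl)    = ε
Reach⇒Star []       (inj₂ e)       = e ◅ ε
Reach⇒Star (v ∷ vs) (inj₁ p)       = Reach⇒Star vs p
Reach⇒Star (v ∷ vs) (inj₂ (p , q)) = Reach⇒Star vs p ◅◅ Reach⇒Star vs q

Reach-base : ∀ {A : Set} {E : Rel A 0ℓ} vs {x y} → x ≡ y ⊎ E x y → Reach E vs x y
Reach-base []       e = e
Reach-base (v ∷ vs) e = inj₁ (Reach-base vs e)

Reach-trans : ∀ {A : Set} {E : Rel A 0ℓ} {vs x z y} → z Membership.∈ vs →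
              Reach E vs x z → Reach E vs z y → Reach E vs x y
Reach-trans (here refl) (inj₁ p)       (inj₁ q)       = inj₂ (p , q)
Reach-trans (here refl) (inj₁ p)       (inj₂ (_ , q)) = inj₂ (p , q)
Reach-trans (here refl) (inj₂ (p , _)) (inj₁ q)       = inj₂ (p , q)
Reach-trans (here refl) (inj₂ (p , _)) (inj₂ (_ , q)) = inj₂ (p , q)
Reach-trans (there z∈)  (inj₁ p)       (inj₁ q)       = inj₁ (Reach-trans z∈ p q)
Reach-trans (there z∈)  (inj₁ p)       (inj₂ (q , s)) = inj₂ (Reach-trans z∈ p q , s)
Reach-trans (there z∈)  (inj₂ (p , q)) (inj₁ s)       = inj₂ (p , Reach-trans z∈ q s)
Reach-trans (there z∈)  (inj₂ (p , _)) (inj₂ (_ , s)) = inj₂ (p , s)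

Star⇒Reach : ∀ {A : Set} {E : Rel A 0ℓ} vs → (∀ {x y} → E x y → y Membership.∈ vs) →
             ∀ {x y} → Star E x y → Reach E vs x y
Star⇒Reach vs E⊆vs ε       = Reach-base vs (inj₁ refl)
Star⇒Reach vs E⊆vs (e ◅ p) =
  Reach-trans (E⊆vs e) (Reach-base vs (inj₂ e)) (Star⇒Reach vs E⊆vs p)

_≟ᵇ_ : (x y : Box) → Dec (x ≡ y)
(i , j) ≟ᵇ (i′ , j′) =
  map′ (λ { (refl , refl) → refl }) (λ { refl → refl , refl }) (i ℕ.≟ i′ ×-dec j ℕ.≟ j′)

connectedSkew? : ∀ lam μ → Dec (Connected Y[ lam / μ ])
connectedSkew? lam μ =
  map′ (λ f {x} {y} px py → f x px y py) (λ f x px y py → f px py)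
    (∀-grid? lam (λ _ → proj₁) Y[ lam / μ ]? λ x →
     ∀-grid? lam (λ _ → proj₁) Y[ lam / μ ]? λ y →
      map′ (Reach⇒Star (grid lam))
           (Star⇒Reach (grid lam) (λ e → ∈-grid {lam} (proj₁ (proj₂ (proj₁ e)))))
           (Reach? _≟ᵇ_ step? (grid lam) x y))
  where
  step? : ∀ x y → Dec (Step Y[ lam / μ ] x y)
  step? x y = (Y[ lam / μ ]? x ×-dec Y[ lam / μ ]? y)
              ×-dec (∣ proj₁ x - proj₁ y ∣ + ∣ proj₂ x - proj₂ y ∣ ℕ.≟ 1)

borderStrip? : ∀ r lam μ → Dec (BorderStrip r lam μ)
borderStrip? r lam μ =
  map′ (λ { (c , b , k , s) → record
             { contained = λ {x} → c {x} ; boxes = b ; connected = λ {x} {y} → k {x} {y} ; noSquare = λ {i} {j} → s (i , j) } })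
       (λ S → (λ {x} → BorderStrip.contained S {x}) , BorderStrip.boxes S ,
              (λ {x} {y} → BorderStrip.connected S {x} {y}) , λ _ → BorderStrip.noSquare S)
       (μ ⊆? lam ×-dec size lam ℕ.≟ r + size μ ×-dec connectedSkew? lam μ ×-dec
        ∀-grid? lam (λ _ → proj₁) Y[ lam / μ ]?
          λ { (i , j) → ¬? (Y[ lam / μ ]? (suc i , suc j)) })

chain-size : ∀ {r μ lam} → Chain r μ lam → size μ ≤ size lam
chain-size ε               = ℕₚ.≤-refl
chain-size {r} (strip ◅ c) = ℕₚ.≤-trans
  (ℕₚ.≤-trans (ℕₚ.m≤n+m _ r) (ℕₚ.≤-reflexive (sym (BorderStrip.boxes strip)))) (chain-size c)

-- Decompositions of lam / γ whose first top is at most a given bound, if any.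
BoundedDecomposition : ℕ → Maybe ℕ → Partition → Partition → Set
BoundedDecomposition r t lam γ =
  Σ (Chain r γ lam) λ c → Connected.Connected _≥_ t (head (tops c)) × Linked _≥_ (tops c)

boundedDecomposition? : ∀ r .{{_ : NonZero r}} fuel t lam γ → size lam ≤ fuel + size γ →
                        Dec (BoundedDecomposition r t lam γ)
boundedDecomposition? r@(suc _) fuel t lam γ le with γ ≟ₚ lam
... | yes refl = yes (ε , bound t , [])
  where
  bound : ∀ t → Connected.Connected _≥_ t nothing
  bound nothing  = Connected.nothing
  bound (just _) = Connected.just-nothing
boundedDecomposition? r@(suc r-1) zero t lam γ le | no γ≢lam = no λ
  { (ε , _)         → γ≢lam refl
  ; (strip ◅ c , _) → ℕₚ.<-irrefl refl (ℕₚ.≤-trans (ℕₚ.≤-trans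
      (s≤s (ℕₚ.m≤n+m (size γ) r-1)) (ℕₚ.≤-reflexive (sym (BorderStrip.boxes strip))))
      (ℕₚ.≤-trans (chain-size c) le)) }
boundedDecomposition? r@(suc r-1) (suc fuel) t lam γ le | no γ≢lam =
  map′ found search (Any.any? next? (Par (r + size γ)))
  where
  Next : Partition → Set
  Next γ′ = Σ (BorderStrip r γ′ γ) λ _ →
    Connected.Connected _≥_ t (just (top γ′ γ)) × BoundedDecomposition r (just (top γ′ γ)) lam γ′

  next? : ∀ γ′ → Dec (Next γ′)
  next? γ′ with borderStrip? r γ′ γ
  ... | no ¬strip = no (¬strip ∘ proj₁)
  ... | yes strip = map′ (strip ,_) proj₂
    (connected? ℕ._≥?_ t (just (top γ′ γ)) ×-dec
     boundedDecomposition? r fuel (just (top γ′ γ)) lam γ′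
       (ℕₚ.≤-trans le (ℕₚ.≤-trans (ℕₚ.≤-trans (s≤s (ℕₚ.+-monoʳ-≤ fuel (ℕₚ.m≤n+m (size γ) r-1)))
         (ℕₚ.≤-reflexive (sym (ℕₚ.+-suc fuel _))))
         (ℕₚ.≤-reflexive (cong (fuel +_) (sym (BorderStrip.boxes strip)))))))

  found : Any Next (Par (r + size γ)) → BoundedDecomposition r t lam γ
  found a with find a
  ... | γ′ , _ , strip , b , c , b′ , l = strip ◅ c , b , b′ Linked.∷′ l

  search : BoundedDecomposition r t lam γ → Any Next (Par (r + size γ))
  search (ε , _) = contradiction refl γ≢lam
  search (_◅_ {j = γ′} strip c , b , l) =
    lose (subst (λ n → γ′ Membership.∈ Par n) (BorderStrip.boxes strip) (∈-Par γ′))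
         (strip , b , c , Linked.head′ l , Linked.tail l)

decomposition? : ∀ r .{{_ : NonZero r}} lam μ → Dec (Decomposition r lam μ)
decomposition? r lam μ =
  map′ (λ { (c , _ , l) → c , l }) (λ { (c , l) → c , unbounded c , l })
    (boundedDecomposition? r (size lam) nothing lam μ (ℕₚ.m≤m+n (size lam) (size μ)))
  where
  unbounded : ∀ {r μ lam} (c : Chain r μ lam) → Connected.Connected _≥_ nothing (head (tops c))
  unbounded ε       = Connected.nothing
  unbounded (_ ◅ _) = Connected.nothing-just

-- A decomposition is unique if it exists, so it is immaterial which one
-- decomposition? finds.
sgnᵣ : (r : ℕ) .{{_ : NonZero r}} → Partition → Partition → ℤ
sgnᵣ r lam μ with decomposition? r lam μ
... | yes (c , _) = chainSign c
... | no _        = 0ℤ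

-- A list of terms (c , α) stands for the sum of the c x₁^α₁ ⋯ x_N^α_N.
-- Terms may repeat or vanish, so equality of polynomials is _≈ₚ_.
Polynomial : ℕ → Set
Polynomial N = List (ℤ × Vec ℕ N)

_≟ᵉ_ : ∀ {N} (α β : Vec ℕ N) → Dec (α ≡ β)
_≟ᵉ_ = Vecₚ.≡-dec ℕ._≟_

coeff : ∀ {N} → Polynomial N → Vec ℕ N → ℤ
coeff []            α = 0ℤ
coeff ((c , β) ∷ p) α = (if does (β ≟ᵉ α) then c else 0ℤ) ℤ.+ coeff p α

infix  4 _≈ₚ_
infixl 6 _+ₚ_
infixl 7 _*ₚ_
infixr 8 _•ₚ_

record _≈ₚ_ {N : ℕ} (p q : Polynomial N) : Set where
  constructor coeffs
  field
    coeff-≡ : ∀ α → coeff p α ≡ coeff q α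

open _≈ₚ_ public

0ₚ 1ₚ : ∀ {N} → Polynomial N
0ₚ = []
1ₚ = (1ℤ , replicate _ 0) ∷ []

_+ₚ_ _*ₚ_ : ∀ {N} → Polynomial N → Polynomial N → Polynomial N
_+ₚ_ = _++_
_*ₚ_ = cartesianProductWith λ { (c , α) (d , β) → c ℤ.* d , zipWith _+_ α β }

_•ₚ_ : ∀ {N} → ℤ → Polynomial N → Polynomial N
c •ₚ p = map (map₁ (c ℤ.*_)) p

-- The substitution replacing each monomial x^α by x^(g α).
mapExponents : ∀ {M N} → (Vec ℕ M → Vec ℕ N) → Polynomial M → Polynomial N
mapExponents g = map (map₂ g)

permute : ∀ {N} → Permutation′ N → Vec ℕ N → Vec ℕ N
permute π α = tabulate λ i → lookup α (π ⟨$⟩ʳ i)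

-- The substitution x₁ ↦ 0, with the remaining variables renumbered.
restrict : ∀ {N} → Polynomial (suc N) → Polynomial N
restrict []                      = []
restrict ((c , zero  ∷ α) ∷ p) = (c , α) ∷ restrict p
restrict ((c , suc _ ∷ α) ∷ p) = restrict p

x[_]^_ : ∀ {N} → Fin N → ℕ → Polynomial N
x[ i ]^ k = (1ℤ , replicate _ 0 [ i ]≔ k) ∷ []

∑Fin : ∀ {N} n → (Fin n → Polynomial N) → Polynomial N
∑Fin n f = foldr _+ₚ_ 0ₚ (map f (allFin n))

det : ∀ {N} n → (Fin n → Fin n → Polynomial N) → Polynomial N
det zero    A = 1ₚ
det (suc n) A = ∑Fin (suc n) λ j →
  (-1ℤ ℤ.^ toℕ j) •ₚ A Fin.zero j *ₚ det n (λ i k → A (Fin.suc i) (punchIn j k))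

-- a_β, the determinant of the matrix (x_i ^ β_j).
alternant : ∀ {N} → (Fin N → ℕ) → Polynomial N
alternant {N} β = det N λ i j → x[ i ]^ β j

-- (N - 1, N - 2, …, 0); indices in Fin N count from 0.
δ : ∀ N → Fin N → ℕ
δ N j = N ∸ suc (toℕ j)

raise : ∀ {N} → Vec ℕ (suc N) → Vec ℕ (suc N)
raise (k ∷ α) = suc k ∷ α

-- The exponents α ∈ ℕ^N with α₁ + ⋯ + α_N = m: either α₁ = 0, or
-- lowering α₁ by one leaves such an exponent for m ∸ 1.
exponents : ∀ N → ℕ → List (Vec ℕ N)
exponents zero    zero    = [] ∷ []
exponents zero    (suc m) = []
exponents (suc N) zero    = map (0 ∷_) (exponents N zero)
exponents (suc N) (suc m) =
  map (0 ∷_) (exponents N (suc m)) ++ map raise (exponents (suc N) m)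

complete : ∀ N → ℕ → Polynomial N
complete N m = map (1ℤ ,_) (exponents N m)

≈ₚ-trans : ∀ {N} {p q s : Polynomial N} → p ≈ₚ q → q ≈ₚ s → p ≈ₚ s
≈ₚ-trans e f = coeffs λ α → trans (coeff-≡ e α) (coeff-≡ f α)

≡⇒≈ₚ : ∀ {N} {p q : Polynomial N} → p ≡ q → p ≈ₚ q
≡⇒≈ₚ refl = coeffs λ α → refl

coeff-++ : ∀ {N} (p q : Polynomial N) α → coeff (p ++ q) α ≡ coeff p α ℤ.+ coeff q α
coeff-++ []            q α = sym (ℤₚ.+-identityˡ _)
coeff-++ ((c , β) ∷ p) q α =
  trans (cong (λ z → d ℤ.+ z) (coeff-++ p q α)) (sym (ℤₚ.+-assoc d (coeff p α) (coeff q α)))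
  where d = if does (β ≟ᵉ α) then c else 0ℤ

+ₚ-cong : ∀ {N} {p p′ q q′ : Polynomial N} → p ≈ₚ p′ → q ≈ₚ q′ → p +ₚ q ≈ₚ p′ +ₚ q′
+ₚ-cong {p = p} {p′} {q} {q′} e f = coeffs λ α →
  trans (coeff-++ p q α) (trans (cong₂ ℤ._+_ (coeff-≡ e α) (coeff-≡ f α)) (sym (coeff-++ p′ q′ α)))

coeff-• : ∀ {N} c (p : Polynomial N) α → coeff (c •ₚ p) α ≡ c ℤ.* coeff p α
coeff-• c []            α = sym (ℤₚ.*-zeroʳ c)
coeff-• c ((d , β) ∷ p) α with does (β ≟ᵉ α)
... | true  =
  trans (cong (λ z → c ℤ.* d ℤ.+ z) (coeff-• c p α)) (sym (ℤₚ.*-distribˡ-+ c d (coeff p α)))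
... | false =
  trans (ℤₚ.+-identityˡ _) (trans (coeff-• c p α) (cong (c ℤ.*_) (sym (ℤₚ.+-identityˡ _))))

•ₚ-cong : ∀ {N} c {p q : Polynomial N} → p ≈ₚ q → c •ₚ p ≈ₚ c •ₚ q
•ₚ-cong c {p} {q} e = coeffs λ α →
  trans (coeff-• c p α) (trans (cong (c ℤ.*_) (coeff-≡ e α)) (sym (coeff-• c q α)))

-- The linear functional with value F α on x^α.
eval : ∀ {N} → (Vec ℕ N → ℤ) → Polynomial N → ℤ
eval F []            = 0ℤ
eval F ((c , β) ∷ p) = c ℤ.* F β ℤ.+ eval F p

eval-++ : ∀ {N} F (p q : Polynomial N) → eval F (p ++ q) ≡ eval F p ℤ.+ eval F q
eval-++ F []            q = sym (ℤₚ.+-identityˡ _)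
eval-++ F ((c , β) ∷ p) q =
  trans (cong (λ z → c ℤ.* F β ℤ.+ z) (eval-++ F p q))
        (sym (ℤₚ.+-assoc (c ℤ.* F β) (eval F p) (eval F q)))

eval-• : ∀ {N} F c (p : Polynomial N) → eval F (c •ₚ p) ≡ c ℤ.* eval F p
eval-• F c []            = sym (ℤₚ.*-zeroʳ c)
eval-• F c ((d , β) ∷ p) = begin
  c ℤ.* d ℤ.* F β ℤ.+ eval F (c •ₚ p)       ≡⟨ cong₂ ℤ._+_ (ℤₚ.*-assoc c d (F β)) (eval-• F c p) ⟩
  c ℤ.* (d ℤ.* F β) ℤ.+ c ℤ.* eval F p      ≡⟨ ℤₚ.*-distribˡ-+ c _ _ ⟨
  c ℤ.* (d ℤ.* F β ℤ.+ eval F p)            ∎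
  where open ≡-Reasoning

eval-ext : ∀ {N} {F G : Vec ℕ N → ℤ} → (∀ α → F α ≡ G α) → ∀ p → eval F p ≡ eval G p
eval-ext e []            = refl
eval-ext e ((c , β) ∷ p) = cong₂ ℤ._+_ (cong (c ℤ.*_) (e β)) (eval-ext e p)

remove : ∀ {N} → Vec ℕ N → Polynomial N → Polynomial N
remove β = filter (λ t → ¬? (proj₂ t ≟ᵉ β))

eval-remove : ∀ {N} F β (p : Polynomial N) →
              eval F p ≡ coeff p β ℤ.* F β ℤ.+ eval F (remove β p)
eval-remove F β []            = sym (ℤₚ.+-identityʳ _)
eval-remove F β ((c , γ) ∷ p) with γ ≟ᵉ β
... | yes refl = begin
  c ℤ.* F β ℤ.+ eval F p
    ≡⟨ cong (λ z → c ℤ.* F β ℤ.+ z) (eval-remove F β p) ⟩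
  c ℤ.* F β ℤ.+ (coeff p β ℤ.* F β ℤ.+ eval F (remove β p))
    ≡⟨ ℤₚ.+-assoc (c ℤ.* F β) _ _ ⟨
  c ℤ.* F β ℤ.+ coeff p β ℤ.* F β ℤ.+ eval F (remove β p)
    ≡⟨ cong (ℤ._+ eval F (remove β p)) (ℤₚ.*-distribʳ-+ (F β) c (coeff p β)) ⟨
  (c ℤ.+ coeff p β) ℤ.* F β ℤ.+ eval F (remove β p) ∎
  where open ≡-Reasoning
... | no _ = begin
  c ℤ.* F γ ℤ.+ eval F p
    ≡⟨ cong (λ z → c ℤ.* F γ ℤ.+ z) (eval-remove F β p) ⟩
  c ℤ.* F γ ℤ.+ (coeff p β ℤ.* F β ℤ.+ eval F (remove β p))
    ≡⟨ ℤₚ.+-assoc (c ℤ.* F γ) _ _ ⟨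
  c ℤ.* F γ ℤ.+ coeff p β ℤ.* F β ℤ.+ eval F (remove β p)
    ≡⟨ cong (ℤ._+ eval F (remove β p)) (ℤₚ.+-comm (c ℤ.* F γ) _) ⟩
  coeff p β ℤ.* F β ℤ.+ c ℤ.* F γ ℤ.+ eval F (remove β p)
    ≡⟨ ℤₚ.+-assoc (coeff p β ℤ.* F β) _ _ ⟩
  coeff p β ℤ.* F β ℤ.+ (c ℤ.* F γ ℤ.+ eval F (remove β p))
    ≡⟨ cong (λ z → z ℤ.* F β ℤ.+ (c ℤ.* F γ ℤ.+ eval F (remove β p))) (ℤₚ.+-identityˡ (coeff p β)) ⟨
  (0ℤ ℤ.+ coeff p β) ℤ.* F β ℤ.+ (c ℤ.* F γ ℤ.+ eval F (remove β p)) ∎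
  where open ≡-Reasoning

coeff-remove-≡ : ∀ {N} β (p : Polynomial N) → coeff (remove β p) β ≡ 0ℤ
coeff-remove-≡ β []            = refl
coeff-remove-≡ β ((c , γ) ∷ p) with γ ≟ᵉ β
... | yes _  = coeff-remove-≡ β p
... | no γ≢β rewrite dec-false (γ ≟ᵉ β) γ≢β = trans (ℤₚ.+-identityˡ _) (coeff-remove-≡ β p)

coeff-remove-≢ : ∀ {N} β (p : Polynomial N) {α} → ¬ β ≡ α → coeff (remove β p) α ≡ coeff p α
coeff-remove-≢ β []            β≢α = refl
coeff-remove-≢ β ((c , γ) ∷ p) {α} β≢α with γ ≟ᵉ β
... | yes refl rewrite dec-false (β ≟ᵉ α) β≢α =
  trans (coeff-remove-≢ β p β≢α) (sym (ℤₚ.+-identityˡ _))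
... | no _     = cong (λ z → (if does (γ ≟ᵉ α) then c else 0ℤ) ℤ.+ z) (coeff-remove-≢ β p β≢α)

remove-≈0 : ∀ {N} β {p : Polynomial N} → p ≈ₚ 0ₚ → remove β p ≈ₚ 0ₚ
remove-≈0 β {p} e = coeffs λ α → vanish α (β ≟ᵉ α)
  where
  vanish : ∀ α → Dec (β ≡ α) → coeff (remove β p) α ≡ 0ℤ
  vanish α (yes refl) = coeff-remove-≡ β p
  vanish α (no β≢α)   = trans (coeff-remove-≢ β p β≢α) (coeff-≡ e α)

length-remove : ∀ {N} c β (p : Polynomial N) → length (remove β ((c , β) ∷ p)) ≤ length p
length-remove c β p with β ≟ᵉ β
... | yes _  = length-filter _ p
... | no β≢β = contradiction refl β≢β

eval-≈0 : ∀ {N} F n (p : Polynomial N) → length p ≤ n → p ≈ₚ 0ₚ → eval F p ≡ 0ℤ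
eval-≈0 F n       []                _        e = refl
eval-≈0 F (suc n) p@((c , β) ∷ p′) (s≤s le) e = begin
  eval F p                                       ≡⟨ eval-remove F β p ⟩
  coeff p β ℤ.* F β ℤ.+ eval F (remove β p)      ≡⟨ cong₂ (λ a b → a ℤ.* F β ℤ.+ b) (coeff-≡ e β)
    (eval-≈0 F n (remove β p) (ℕₚ.≤-trans (length-remove c β p′) le) (remove-≈0 β e)) ⟩
  0ℤ                                             ∎
  where open ≡-Reasoning

eval-cong : ∀ {N} F {p q : Polynomial N} → p ≈ₚ q → eval F p ≡ eval F q
eval-cong F {p} {q} e = ℤₚ.i-j≡0⇒i≡j _ _ (begin
  eval F p ℤ.- eval F q                      ≡⟨ cong (λ z → eval F p ℤ.+ z) (ℤₚ.-1*i≡-i (eval F q)) ⟨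
  eval F p ℤ.+ -1ℤ ℤ.* eval F q              ≡⟨ cong (λ z → eval F p ℤ.+ z) (eval-• F -1ℤ q) ⟨
  eval F p ℤ.+ eval F (-1ℤ •ₚ q)             ≡⟨ eval-++ F p _ ⟨
  eval F (p +ₚ -1ℤ •ₚ q)                     ≡⟨ eval-≈0 F _ (p +ₚ -1ℤ •ₚ q) ℕₚ.≤-refl diff ⟩
  0ℤ                                         ∎)
  where
  open ≡-Reasoning
  diff : p +ₚ -1ℤ •ₚ q ≈ₚ 0ₚ
  diff = coeffs λ α → begin
    coeff (p +ₚ -1ℤ •ₚ q) α             ≡⟨ coeff-++ p _ α ⟩
    coeff p α ℤ.+ coeff (-1ℤ •ₚ q) α    ≡⟨ cong₂ ℤ._+_ (coeff-≡ e α) (trans (coeff-• -1ℤ q α) (ℤₚ.-1*i≡-i _)) ⟩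
    coeff q α ℤ.- coeff q α             ≡⟨ ℤₚ.+-inverseʳ (coeff q α) ⟩
    0ℤ                                  ∎

indicator : ∀ {N} → Vec ℕ N → Vec ℕ N → ℤ
indicator β α = if does (β ≟ᵉ α) then 1ℤ else 0ℤ

term-δ : ∀ {N} c (β α : Vec ℕ N) → (if does (β ≟ᵉ α) then c else 0ℤ) ≡ c ℤ.* indicator β α
term-δ c β α with does (β ≟ᵉ α)
... | true  = sym (ℤₚ.*-identityʳ c)
... | false = sym (ℤₚ.*-zeroʳ c)

coeff-mapExponents : ∀ {M N} (g : Vec ℕ M → Vec ℕ N) p α →
                     coeff (mapExponents g p) α ≡ eval (λ β → indicator (g β) α) p
coeff-mapExponents g []            α = refl
coeff-mapExponents g ((c , β) ∷ p) α =
  cong₂ ℤ._+_ (term-δ c (g β) α) (coeff-mapExponents g p α)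

mapExponents-cong : ∀ {M N} (g : Vec ℕ M → Vec ℕ N) {p q} →
                    p ≈ₚ q → mapExponents g p ≈ₚ mapExponents g q
mapExponents-cong g {p} {q} e = coeffs λ α →
  trans (coeff-mapExponents g p α)
        (trans (eval-cong _ e) (sym (coeff-mapExponents g q α)))

coeff-*ₚ : ∀ {N} (p q : Polynomial N) α →
           coeff (p *ₚ q) α ≡ eval (λ β → coeff (mapExponents (zipWith _+_ β) q) α) p
coeff-*ₚ []            q α = refl
coeff-*ₚ ((c , β) ∷ p) q α = begin
  coeff (map _ q ++ p *ₚ q) α                                 ≡⟨ coeff-++ (map _ q) (p *ₚ q) α ⟩
  coeff (map _ q) α ℤ.+ coeff (p *ₚ q) α                      ≡⟨ cong₂ ℤ._+_ shift (coeff-*ₚ p q α) ⟩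
  c ℤ.* coeff (mapExponents (zipWith _+_ β) q) α ℤ.+ _        ∎
  where
  open ≡-Reasoning
  shift : coeff (map (λ { (d , γ) → c ℤ.* d , zipWith _+_ β γ }) q) α ≡
          c ℤ.* coeff (mapExponents (zipWith _+_ β) q) α
  shift = trans (cong (λ l → coeff l α) (map-∘ q)) (coeff-• c (mapExponents (zipWith _+_ β) q) α)

*ₚ-cong : ∀ {N} {p p′ q q′ : Polynomial N} → p ≈ₚ p′ → q ≈ₚ q′ → p *ₚ q ≈ₚ p′ *ₚ q′
*ₚ-cong {p = p} {p′} {q} {q′} e f = coeffs λ α → begin
  coeff (p *ₚ q) α    ≡⟨ coeff-*ₚ p q α ⟩
  eval _ p            ≡⟨ eval-cong _ e ⟩
  eval _ p′           ≡⟨ eval-ext (λ β → coeff-≡ (mapExponents-cong (zipWith _+_ β) f) α) p′ ⟩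
  eval _ p′           ≡⟨ coeff-*ₚ p′ q′ α ⟨
  coeff (p′ *ₚ q′) α  ∎
  where open ≡-Reasoning

mapExponents-* :
  ∀ {M N} (g : Vec ℕ M → Vec ℕ N) →
  (∀ α β → g (zipWith _+_ α β) ≡ zipWith _+_ (g α) (g β)) →
  ∀ p q → mapExponents g (p *ₚ q) ≡ mapExponents g p *ₚ mapExponents g q
mapExponents-* g hom []            q = refl
mapExponents-* g hom ((c , α) ∷ p) q =
  trans (map-++ (map₂ g) (map _ q) (p *ₚ q))
        (cong₂ _++_ (trans (sym (map-∘ q)) (trans (map-cong shift q) (map-∘ q)))
                    (mapExponents-* g hom p q))
  where
  shift : ∀ t → (c ℤ.* proj₁ t , g (zipWith _+_ α (proj₂ t))) ≡
                (c ℤ.* proj₁ t , zipWith _+_ (g α) (g (proj₂ t)))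
  shift (d , β) = cong (c ℤ.* d ,_) (hom α β)

mapExponents-• : ∀ {M N} (g : Vec ℕ M → Vec ℕ N) c p →
                 mapExponents g (c •ₚ p) ≡ c •ₚ mapExponents g p
mapExponents-• g c p = trans (sym (map-∘ p)) (map-∘ p)

mapExponents-∘ : ∀ {L M N} (g : Vec ℕ M → Vec ℕ N) (h : Vec ℕ L → Vec ℕ M) p →
                 mapExponents g (mapExponents h p) ≡ mapExponents (g ∘ h) p
mapExponents-∘ g h p = sym (map-∘ p)

vec-ext : ∀ {N} {α β : Vec ℕ N} → (∀ i → lookup α i ≡ lookup β i) → α ≡ β
vec-ext {α = α} {β} e =
  trans (sym (Vecₚ.tabulate∘lookup α)) (trans (Vecₚ.tabulate-cong e) (Vecₚ.tabulate∘lookup β))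

permute-+ : ∀ {N} (π : Permutation′ N) α β →
            permute π (zipWith _+_ α β) ≡ zipWith _+_ (permute π α) (permute π β)
permute-+ π α β = vec-ext λ i → begin
  lookup (permute π (zipWith _+_ α β)) i             ≡⟨ Vecₚ.lookup∘tabulate _ i ⟩
  lookup (zipWith _+_ α β) (π ⟨$⟩ʳ i)                ≡⟨ Vecₚ.lookup-zipWith _+_ (π ⟨$⟩ʳ i) α β ⟩
  lookup α (π ⟨$⟩ʳ i) + lookup β (π ⟨$⟩ʳ i)          ≡⟨ cong₂ _+_ (Vecₚ.lookup∘tabulate _ i) (Vecₚ.lookup∘tabulate _ i) ⟨
  lookup (permute π α) i + lookup (permute π β) i    ≡⟨ Vecₚ.lookup-zipWith _+_ i (permute π α) (permute π β) ⟨
  lookup (zipWith _+_ (permute π α) (permute π β)) i ∎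
  where open ≡-Reasoning

permute-map : ∀ {N} (π : Permutation′ N) (f : ℕ → ℕ) α →
              permute π (Vec.map f α) ≡ Vec.map f (permute π α)
permute-map π f α = trans (Vecₚ.tabulate-cong (λ i → Vecₚ.lookup-map (π ⟨$⟩ʳ i) f α))
                          (Vecₚ.tabulate-∘ f _)

permute-inverse : ∀ {N} (π : Permutation′ N) α → permute π (permute (flip π) α) ≡ α
permute-inverse π α = trans
  (Vecₚ.tabulate-cong (λ i → trans (Vecₚ.lookup∘tabulate _ (π ⟨$⟩ʳ i)) (cong (lookup α) (inverseˡ π))))
  (Vecₚ.tabulate∘lookup α)

permute-sum : ∀ {N} (π : Permutation′ N) α → Vec.sum (permute π α) ≡ Vec.sum α
permute-sum π α = begin
  Vec.sum (permute π α)                     ≡⟨ vec-sum (permute π α) ⟩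
  Sum.sum (lookup (permute π α))            ≡⟨ Sum.sum-cong-≗ (Vecₚ.lookup∘tabulate (λ i → lookup α (π ⟨$⟩ʳ i))) ⟩
  Sum.sum (λ i → lookup α (π ⟨$⟩ʳ i))       ≡⟨ Sum.sum-permute (lookup α) π ⟨
  Sum.sum (lookup α)                        ≡⟨ vec-sum α ⟨
  Vec.sum α                                 ∎
  where
  open ≡-Reasoning
  vec-sum : ∀ {N} (α : Vec ℕ N) → Vec.sum α ≡ Sum.sum (lookup α)
  vec-sum []      = refl
  vec-sum (a ∷ α) = cong (a +_) (vec-sum α)

restrict-++ : ∀ {N} (p q : Polynomial (suc N)) → restrict (p ++ q) ≡ restrict p ++ restrict q
restrict-++ []                    q = refl
restrict-++ ((c , zero  ∷ α) ∷ p) q = cong ((c , α) ∷_) (restrict-++ p q)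
restrict-++ ((c , suc _ ∷ α) ∷ p) q = restrict-++ p q

restrict-• : ∀ {N} c (p : Polynomial (suc N)) → restrict (c •ₚ p) ≡ c •ₚ restrict p
restrict-• c []                    = refl
restrict-• c ((d , zero  ∷ α) ∷ p) = cong ((c ℤ.* d , α) ∷_) (restrict-• c p)
restrict-• c ((d , suc _ ∷ α) ∷ p) = restrict-• c p

restrict-term : ∀ {N} c k (α : Vec ℕ N) q →
  restrict (((c , k ∷ α) ∷ []) *ₚ q) ≡ restrict ((c , k ∷ α) ∷ []) *ₚ restrict q
restrict-term c zero    α []                    = refl
restrict-term c (suc k) α []                    = refl
restrict-term c zero    α ((d , zero  ∷ β) ∷ q) = cong (_ ∷_) (restrict-term c zero α q)
restrict-term c zero    α ((d , suc _ ∷ β) ∷ q) = restrict-term c zero α q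
restrict-term c (suc k) α ((d , _     ∷ β) ∷ q) = restrict-term c (suc k) α q

*ₚ-∷ : ∀ {N} t (p q : Polynomial N) → (t ∷ p) *ₚ q ≡ (t ∷ []) *ₚ q ++ p *ₚ q
*ₚ-∷ t p q = cong (_++ p *ₚ q) (sym (++-identityʳ _))

restrict-* : ∀ {N} (p q : Polynomial (suc N)) → restrict (p *ₚ q) ≡ restrict p *ₚ restrict q
restrict-* []                      q = refl
restrict-* (t@(c , k ∷ α) ∷ p) q = begin
  restrict ((t ∷ p) *ₚ q)                                     ≡⟨ cong restrict (*ₚ-∷ t p q) ⟩
  restrict ((t ∷ []) *ₚ q ++ p *ₚ q)                          ≡⟨ restrict-++ ((t ∷ []) *ₚ q) (p *ₚ q) ⟩
  restrict ((t ∷ []) *ₚ q) ++ restrict (p *ₚ q)               ≡⟨ cong₂ _++_ (restrict-term c k α q) (restrict-* p q) ⟩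
  restrict (t ∷ []) *ₚ restrict q ++ restrict p *ₚ restrict q ≡⟨ split k ⟩
  restrict (t ∷ p) *ₚ restrict q                              ∎
  where
  open ≡-Reasoning
  split : ∀ k → restrict ((c , k ∷ α) ∷ []) *ₚ restrict q ++ restrict p *ₚ restrict q ≡
                restrict ((c , k ∷ α) ∷ p) *ₚ restrict q
  split zero    = sym (*ₚ-∷ (c , α) (restrict p) (restrict q))
  split (suc _) = refl

coeff-restrict : ∀ {N} (p : Polynomial (suc N)) α → coeff (restrict p) α ≡ coeff p (0 ∷ α)
coeff-restrict []                    α = refl
coeff-restrict ((c , zero  ∷ β) ∷ p) α = cong (λ z → (if does (β ≟ᵉ α) then c else 0ℤ) ℤ.+ z) (coeff-restrict p α)
coeff-restrict ((c , suc _ ∷ β) ∷ p) α = trans (coeff-restrict p α) (sym (ℤₚ.+-identityˡ _))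

restrict-powers : ∀ r .{{_ : NonZero r}} {N} (p : Polynomial (suc N)) →
  restrict (mapExponents (Vec.map (r *_)) p) ≡ mapExponents (Vec.map (r *_)) (restrict p)
restrict-powers r             []                    = refl
restrict-powers r@(suc _) ((c , zero  ∷ α) ∷ p) rewrite ℕₚ.*-zeroʳ r =
  cong (_ ∷_) (restrict-powers r p)
restrict-powers r@(suc _) ((c , suc _ ∷ α) ∷ p) = restrict-powers r p

Degree≤ : ∀ {N} → ℕ → Polynomial N → Set
Degree≤ d p = ∀ α → d < Vec.sum α → coeff p α ≡ 0ℤ

TermDegrees≤ : ∀ {N} → ℕ → Polynomial N → Set
TermDegrees≤ d = All (λ t → Vec.sum (proj₂ t) ≤ d)

termDegrees : ∀ {N d} {p : Polynomial N} → TermDegrees≤ d p → Degree≤ d p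
termDegrees []                       α d<α = refl
termDegrees {p = (c , β) ∷ p} (β≤d ∷ ts) α d<α
  rewrite dec-false (β ≟ᵉ α) (λ { refl → ℕₚ.<⇒≱ d<α β≤d }) =
  trans (ℤₚ.+-identityˡ _) (termDegrees ts α d<α)

truncate : ∀ {N} → ℕ → Polynomial N → Polynomial N
truncate d = filter (λ t → Vec.sum (proj₂ t) ℕ.≤? d)

coeff-truncate : ∀ {N} d (p : Polynomial N) {α} → Vec.sum α ≤ d → coeff (truncate d p) α ≡ coeff p α
coeff-truncate d []            α≤d = refl
coeff-truncate d ((c , β) ∷ p) {α} α≤d with Vec.sum β ℕ.≤? d
... | yes β≤d rewrite filter-accept (λ t → Vec.sum (proj₂ t) ℕ.≤? d) {c , β} {p} β≤d =
  cong (λ z → (if does (β ≟ᵉ α) then c else 0ℤ) ℤ.+ z) (coeff-truncate d p α≤d)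
... | no β≰d rewrite filter-reject (λ t → Vec.sum (proj₂ t) ℕ.≤? d) {c , β} {p} β≰d
                   | dec-false (β ≟ᵉ α) (λ { refl → β≰d α≤d }) =
  trans (coeff-truncate d p α≤d) (sym (ℤₚ.+-identityˡ _))

truncate-degrees : ∀ {N} d (p : Polynomial N) → TermDegrees≤ d (truncate d p)
truncate-degrees d p = all-filter (λ t → Vec.sum (proj₂ t) ℕ.≤? d) p

truncate-≈ : ∀ {N d} {p : Polynomial N} → Degree≤ d p → p ≈ₚ truncate d p
truncate-≈ {d = d} {p} bound = coeffs λ α → compare α (Vec.sum α ℕ.≤? d)
  where
  compare : ∀ α → Dec (Vec.sum α ≤ d) → coeff p α ≡ coeff (truncate d p) α
  compare α (yes α≤d) = sym (coeff-truncate d p α≤d)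
  compare α (no α≰d)  = trans (bound α (ℕₚ.≰⇒> α≰d))
                              (sym (termDegrees (truncate-degrees d p) α (ℕₚ.≰⇒> α≰d)))

Degree≤-resp : ∀ {N d} {p q : Polynomial N} → p ≈ₚ q → Degree≤ d q → Degree≤ d p
Degree≤-resp e bound α d<α = trans (coeff-≡ e α) (bound α d<α)

Degree≤-+ : ∀ {N d e} {p q : Polynomial N} → Degree≤ d p → Degree≤ e q → Degree≤ (d ℕ.⊔ e) (p +ₚ q)
Degree≤-+ {d = d} {e} {p} {q} dp dq α lt = trans (coeff-++ p q α)
  (cong₂ ℤ._+_ (dp α (ℕₚ.≤-trans (s≤s (ℕₚ.m≤m⊔n d e)) lt))
               (dq α (ℕₚ.≤-trans (s≤s (ℕₚ.m≤n⊔m d e)) lt)))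

Degree≤-• : ∀ {N d} c {p : Polynomial N} → Degree≤ d p → Degree≤ d (c •ₚ p)
Degree≤-• c {p} dp α lt =
  trans (coeff-• c p α) (trans (cong (c ℤ.*_) (dp α lt)) (ℤₚ.*-zeroʳ c))

sum-zipWith : ∀ {N} (α β : Vec ℕ N) → Vec.sum (zipWith _+_ α β) ≡ Vec.sum α + Vec.sum β
sum-zipWith []      []      = refl
sum-zipWith (a ∷ α) (b ∷ β) = begin
  a + b + Vec.sum (zipWith _+_ α β)      ≡⟨ cong (a + b +_) (sum-zipWith α β) ⟩
  a + b + (Vec.sum α + Vec.sum β)        ≡⟨ ℕₚ.+-assoc a b _ ⟩
  a + (b + (Vec.sum α + Vec.sum β))      ≡⟨ cong (a +_) (ℕₚ.+-assoc b (Vec.sum α) _) ⟨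
  a + (b + Vec.sum α + Vec.sum β)        ≡⟨ cong (λ z → a + (z + Vec.sum β)) (ℕₚ.+-comm b (Vec.sum α)) ⟩
  a + (Vec.sum α + b + Vec.sum β)        ≡⟨ cong (a +_) (ℕₚ.+-assoc (Vec.sum α) b _) ⟩
  a + (Vec.sum α + (b + Vec.sum β))      ≡⟨ ℕₚ.+-assoc a (Vec.sum α) _ ⟨
  a + Vec.sum α + (b + Vec.sum β)        ∎
  where open ≡-Reasoning

sum-map-* : ∀ r {N} (α : Vec ℕ N) → Vec.sum (Vec.map (r *_) α) ≡ r * Vec.sum α
sum-map-* r []      = sym (ℕₚ.*-zeroʳ r)
sum-map-* r (a ∷ α) = trans (cong (r * a +_) (sum-map-* r α)) (sym (ℕₚ.*-distribˡ-+ r a _))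

TermDegrees≤-* : ∀ {N d e} {p q : Polynomial N} →
                 TermDegrees≤ d p → TermDegrees≤ e q → TermDegrees≤ (d + e) (p *ₚ q)
TermDegrees≤-* []                     qs = []
TermDegrees≤-* {p = (c , α) ∷ p} (α≤d ∷ ps) qs =
  ++⁺ (map⁺ (All.map (λ {t} β≤e → ℕₚ.≤-trans (ℕₚ.≤-reflexive (sum-zipWith α (proj₂ t)))
                                              (ℕₚ.+-mono-≤ α≤d β≤e)) qs))
      (TermDegrees≤-* ps qs)

Degree≤-* : ∀ {N d e} {p q : Polynomial N} → Degree≤ d p → Degree≤ e q → Degree≤ (d + e) (p *ₚ q)
Degree≤-* {d = d} {e} {p} {q} dp dq =
  Degree≤-resp (*ₚ-cong (truncate-≈ {p = p} dp) (truncate-≈ {p = q} dq))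
    (termDegrees (TermDegrees≤-* (truncate-degrees d p) (truncate-degrees e q)))

Degree≤-powers : ∀ r {N d} {p : Polynomial N} → Degree≤ d p →
                 Degree≤ (r * d) (mapExponents (Vec.map (r *_)) p)
Degree≤-powers r {d = d} {p} dp =
  Degree≤-resp (mapExponents-cong (Vec.map (r *_)) (truncate-≈ {p = p} dp))
    (termDegrees (map⁺ (All.map (λ {t} α≤d → ℕₚ.≤-trans
      (ℕₚ.≤-reflexive (sum-map-* r (proj₂ t))) (ℕₚ.*-monoʳ-≤ r α≤d)) (truncate-degrees d p))))

coeff-map-0∷ : ∀ {N} (L : List (Vec ℕ N)) k α →
  coeff (map (1ℤ ,_) (map (0 ∷_) L)) (k ∷ α) ≡
  (if does (0 ℕ.≟ k) then coeff (map (1ℤ ,_) L) α else 0ℤ)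
coeff-map-0∷ []      zero    α = refl
coeff-map-0∷ []      (suc k) α = refl
coeff-map-0∷ (β ∷ L) zero    α = cong (λ z → (if does (β ≟ᵉ α) then 1ℤ else 0ℤ) ℤ.+ z) (coeff-map-0∷ L zero α)
coeff-map-0∷ (β ∷ L) (suc k) α = trans (ℤₚ.+-identityˡ _) (coeff-map-0∷ L (suc k) α)

coeff-map-raise-zero : ∀ {N} (L : List (Vec ℕ (suc N))) α →
  coeff (map (1ℤ ,_) (map raise L)) (0 ∷ α) ≡ 0ℤ
coeff-map-raise-zero []            α = refl
coeff-map-raise-zero ((k ∷ β) ∷ L) α = trans (ℤₚ.+-identityˡ _) (coeff-map-raise-zero L α)

coeff-map-raise-suc : ∀ {N} (L : List (Vec ℕ (suc N))) k α →
  coeff (map (1ℤ ,_) (map raise L)) (suc k ∷ α) ≡ coeff (map (1ℤ ,_) L) (k ∷ α)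
coeff-map-raise-suc []            k α = refl
coeff-map-raise-suc ((l ∷ β) ∷ L) k α =
  cong (λ z → (if does ((l ∷ β) ≟ᵉ (k ∷ α)) then 1ℤ else 0ℤ) ℤ.+ z) (coeff-map-raise-suc L k α)

coeff-complete : ∀ N m (α : Vec ℕ N) →
  coeff (complete N m) α ≡ (if does (Vec.sum α ℕ.≟ m) then 1ℤ else 0ℤ)
coeff-complete zero    zero    []            = refl
coeff-complete zero    (suc m) []            = refl
coeff-complete (suc N) zero    (zero  ∷ α) = trans (coeff-map-0∷ (exponents N 0) 0 α) (coeff-complete N 0 α)
coeff-complete (suc N) zero    (suc k ∷ α) = coeff-map-0∷ (exponents N 0) (suc k) α
coeff-complete (suc N) (suc m) (k ∷ α) = begin
  coeff (map (1ℤ ,_) (low ++ high)) (k ∷ α)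
    ≡⟨ cong (λ p → coeff p (k ∷ α)) (map-++ (1ℤ ,_) low high) ⟩
  coeff (map (1ℤ ,_) low ++ map (1ℤ ,_) high) (k ∷ α)
    ≡⟨ coeff-++ (map (1ℤ ,_) low) (map (1ℤ ,_) high) (k ∷ α) ⟩
  coeff (map (1ℤ ,_) low) (k ∷ α) ℤ.+ coeff (map (1ℤ ,_) high) (k ∷ α)
    ≡⟨ split k ⟩
  (if does (k + Vec.sum α ℕ.≟ suc m) then 1ℤ else 0ℤ) ∎
  where
  open ≡-Reasoning
  low  = map (0 ∷_) (exponents N (suc m))
  high = map raise (exponents (suc N) m)
  split : ∀ k → coeff (map (1ℤ ,_) low) (k ∷ α) ℤ.+ coeff (map (1ℤ ,_) high) (k ∷ α) ≡
                (if does (k + Vec.sum α ℕ.≟ suc m) then 1ℤ else 0ℤ)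
  split zero = trans
    (cong₂ ℤ._+_ (trans (coeff-map-0∷ (exponents N (suc m)) 0 α) (coeff-complete N (suc m) α))
                 (coeff-map-raise-zero (exponents (suc N) m) α))
    (ℤₚ.+-identityʳ _)
  split (suc k) = trans
    (cong₂ ℤ._+_ (coeff-map-0∷ (exponents N (suc m)) (suc k) α)
                 (trans (coeff-map-raise-suc (exponents (suc N) m) k α)
                        (coeff-complete (suc N) m (k ∷ α))))
    (ℤₚ.+-identityˡ _)

coeff-permute : ∀ {N} (π : Permutation′ N) p α →
                coeff (mapExponents (permute π) p) α ≡ coeff p (permute (flip π) α)
coeff-permute π []            α = refl
coeff-permute π ((c , β) ∷ p) α = cong₂ ℤ._+_ head-term (coeff-permute π p α)
  where
  head-term : (if does (permute π β ≟ᵉ α) then c else 0ℤ) ≡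
              (if does (β ≟ᵉ permute (flip π) α) then c else 0ℤ)
  head-term with permute π β ≟ᵉ α
  ... | yes refl rewrite dec-true (β ≟ᵉ permute (flip π) (permute π β))
                                  (sym (permute-inverse (flip π) β)) = refl
  ... | no πβ≢α  rewrite dec-false (β ≟ᵉ permute (flip π) α)
                                   (λ β≡ → πβ≢α (trans (cong (permute π) β≡) (permute-inverse π α))) = refl

-- The ring of symmetric functions over ℤ, as the inverse limit (with bounded
-- degree) of the rings of symmetric polynomials in N variables; at f N is the
-- specialisation of f to N variables. By symmetry it does not matter that the
-- transition maps set the first variable, rather than the last, to zero.
record Λ : Set where
  field
    at        : ∀ N → Polynomial N
    symmetric : ∀ N (π : Permutation′ N) → mapExponents (permute π) (at N) ≈ₚ at N
    stable    : ∀ N → restrict (at (suc N)) ≈ₚ at N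
    bounded   : ∃ λ d → ∀ N → Degree≤ d (at N)

open Λ public

infix  4 _≈_
infixl 6 _⊕_
infixl 7 _⊛_
infixr 8 _•_

_≈_ : Λ → Λ → Set
f ≈ g = ∀ N → at f N ≈ₚ at g N

0Λ : Λ
0Λ = record
  { at        = λ N → 0ₚ
  ; symmetric = λ N π → ≡⇒≈ₚ refl
  ; stable    = λ N → ≡⇒≈ₚ refl
  ; bounded   = 0 , λ N α lt → refl
  }

_⊕_ : Λ → Λ → Λ
f ⊕ g = record
  { at        = λ N → at f N +ₚ at g N
  ; symmetric = λ N π → ≈ₚ-trans (≡⇒≈ₚ (map-++ _ (at f N) (at g N)))
                                 (+ₚ-cong (symmetric f N π) (symmetric g N π))
  ; stable    = λ N → ≈ₚ-trans (≡⇒≈ₚ (restrict-++ (at f (suc N)) (at g (suc N))))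
                               (+ₚ-cong (stable f N) (stable g N))
  ; bounded   = _ , λ N → Degree≤-+ {p = at f N} (proj₂ (bounded f) N) (proj₂ (bounded g) N)
  }

_⊛_ : Λ → Λ → Λ
f ⊛ g = record
  { at        = λ N → at f N *ₚ at g N
  ; symmetric = λ N π → ≈ₚ-trans
      (≡⇒≈ₚ (mapExponents-* (permute π) (permute-+ π) (at f N) (at g N)))
      (*ₚ-cong (symmetric f N π) (symmetric g N π))
  ; stable    = λ N → ≈ₚ-trans (≡⇒≈ₚ (restrict-* (at f (suc N)) (at g (suc N))))
                               (*ₚ-cong (stable f N) (stable g N))
  ; bounded   = _ , λ N → Degree≤-* {p = at f N} (proj₂ (bounded f) N) (proj₂ (bounded g) N)
  }

_•_ : ℤ → Λ → Λ
c • f = record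
  { at        = λ N → c •ₚ at f N
  ; symmetric = λ N π → ≈ₚ-trans (≡⇒≈ₚ (mapExponents-• (permute π) c (at f N)))
                                 (•ₚ-cong c (symmetric f N π))
  ; stable    = λ N → ≈ₚ-trans (≡⇒≈ₚ (restrict-• c (at f (suc N)))) (•ₚ-cong c (stable f N))
  ; bounded   = _ , λ N → Degree≤-• c {at f N} (proj₂ (bounded f) N)
  }

∑ : ∀ {A : Set} → List A → (A → Λ) → Λ
∑ xs f = foldr _⊕_ 0Λ (map f xs)

h : ℕ → Λ
h m = record
  { at        = λ N → complete N m
  ; symmetric = λ N π → coeffs λ α → trans (coeff-permute π (complete N m) α)
      (trans (coeff-complete N m _)
      (trans (cong (λ k → if does (k ℕ.≟ m) then 1ℤ else 0ℤ) (permute-sum (flip π) α))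
      (sym (coeff-complete N m α))))
  ; stable    = λ N → coeffs λ α → trans (coeff-restrict (complete (suc N) m) α)
      (trans (coeff-complete (suc N) m (0 ∷ α)) (sym (coeff-complete N m α)))
  ; bounded   = m , λ N α lt → trans (coeff-complete N m α)
      (cong (if_then 1ℤ else 0ℤ) (dec-false (Vec.sum α ℕ.≟ m) (λ eq → ℕₚ.<⇒≢ lt (sym eq))))
  }

-- The plethysm p_r ∘ f: each variable x_i is replaced by x_i ^ r.
p[_]∘_ : (r : ℕ) .{{_ : NonZero r}} → Λ → Λ
p[ r ]∘ f = record
  { at        = λ N → powers (at f N)
  ; symmetric = λ N π → ≈ₚ-trans
      (≡⇒≈ₚ (trans (mapExponents-∘ (permute π) (Vec.map (r *_)) (at f N))
            (trans (map-cong (λ t → cong (proj₁ t ,_) (permute-map π (r *_) (proj₂ t))) (at f N))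
                   (sym (mapExponents-∘ (Vec.map (r *_)) (permute π) (at f N))))))
      (mapExponents-cong (Vec.map (r *_)) (symmetric f N π))
  ; stable    = λ N → ≈ₚ-trans (≡⇒≈ₚ (restrict-powers r (at f (suc N))))
                               (mapExponents-cong (Vec.map (r *_)) (stable f N))
  ; bounded   = _ , λ N → Degree≤-powers r {p = at f N} (proj₂ (bounded f) N)
  }
  where
  powers : ∀ {N} → Polynomial N → Polynomial N
  powers = mapExponents (Vec.map (r *_))

-- f is the Schur function of lam: for N ≥ ℓ lam its specialisation to N
-- variables is the quotient of alternants a_{lam + δ} / a_δ. Quotients in the
-- integral domain ℤ[x₁,…,x_N] are unique, and stability fixes the
-- specialisations with N < ℓ lam, so this determines f.
IsSchur : Partition → Λ → Set
IsSchur lam f = ∀ N → ℓ lam ≤ N →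
  at f N *ₚ alternant (δ N) ≈ₚ alternant (λ j → part lam (suc (toℕ j)) + δ N j)

{-# OPTIONS --safe #-}
-- After multiplication by a_δ, and since h_m(x₁^r, x₂^r, …) is symmetric, the left side becomes
-- the sum of the alternants a_{μ+δ+rγ} over all γ with |γ| = m. Read the entries of μ + δ as
-- positions of beads on a line. The lowest bead either keeps its position for good or moves up
-- by r; in the second case it is sorted back among the other beads, with a sign for each bead it
-- passes, and the terms cancel if its new position is occupied. So the surviving terms are the
-- sequences of m moves in which the indices of the moved beads weakly increase. A move adds an
-- r-border strip whose bottom and top are the old and the new row of the bead, and the indices
-- weakly increase exactly when the tops weakly decrease: these sequences are the decompositions
-- of λ/μ. Finally a_δ cancels because it has a unique lexicographically least term, and the
-- identity in few variables follows from that in many by stability.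
module Submission where

open import Defs
open import Data.Bool using (if_then_else_)
open import Data.Fin as Fin using (Fin; toℕ; punchIn; inject₁; fromℕ)
import Data.Fin.Properties as Finₚ
open import Data.Integer as ℤ using (ℤ; 0ℤ; 1ℤ; -1ℤ)
import Data.Integer.Properties as ℤₚ
import Data.Integer.Tactic.RingSolver as ℤ-Solver
open import Data.List as List
  using (List; []; _∷_; _++_; allFin; applyUpTo; concatMap; filter; foldr; head; last; length; map; mapMaybe)
open import Data.List.Membership.Propositional using (_∈_; find)
open import Data.List.Membership.Propositional.Properties using (∈-concatMap⁻; ∈-filter⁺)
import Data.List.Properties as Listₚ
open import Data.List.Relation.Unary.All as All using (All; []; _∷_)
import Data.List.Relation.Unary.All.Properties as Allₚ
open import Data.List.Relation.Unary.AllPairs using ([]; _∷_)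
open import Data.List.Relation.Unary.Any using (here; there)
open import Data.List.Relation.Unary.Linked as Linked using (Linked; []; [-]; _∷_)
open import Data.List.Relation.Unary.Unique.Propositional using (Unique)
import Data.List.Relation.Unary.Unique.Propositional.Properties as Uniqueₚ
open import Data.Maybe using (Maybe; just; nothing; fromMaybe)
import Data.Maybe.Relation.Binary.Connected as Connected
open import Data.Nat as ℕ
  using (ℕ; zero; suc; _+_; _*_; _∸_; _≤_; _<_; _≥_; z≤n; s≤s; z<s; ∣_-_∣; NonZero)
open import Data.Nat.Induction using (<-wellFounded)
open import Data.Nat.ListAction using (sum)
import Data.Nat.Properties as ℕₚ
import Data.Nat.Tactic.RingSolver as ℕ-Solver
open import Data.Product using (Σ; ∃; _×_; _,_; proj₁; proj₂; map₁; map₂)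
open import Data.Sum using (_⊎_; inj₁; inj₂)
open import Data.Unit using (⊤; tt)
open import Data.Vec as Vec using (Vec; []; _∷_; _∷ʳ_; replicate; tabulate; zipWith)
import Data.Vec.Properties as Vecₚ
import Data.Vec.Relation.Binary.Lex.Strict as Lex
open import Function using (_∘_)
open import Function.Bundles using (mk⇔)
open import Induction.WellFounded using (Acc; acc; WellFounded)
open import Level using (0ℓ)
open import Relation.Binary using (tri<; tri≈; tri>)
open import Relation.Binary.Construct.Closure.ReflexiveTransitive
  using (Star; ε; _◅_; _◅◅_; reverse)
open import Relation.Binary.PropositionalEquality
open import Relation.Nullary using (¬_; Dec; does; yes; no; contradiction)
open import Relation.Nullary.Decidable using (dec-true; dec-false; does-⇔; ¬?)
import Relation.Unary as U

-- Polynomials are lists of terms up to equality of coefficients, so identities are tested by an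
-- arbitrary linear functional `F`: its value on an alternant is `asym F`, and the sorting of beads
-- uses only that `asym F` changes sign under adjacent swaps. The delicate point is that a raised
-- bead is sorted back while the remaining shifts are still to be summed; this is sound because the
-- sum over those shifts is again alternating in the current positions (`shiftSum-alternating`).
-- Vectors are taken apart from the head, so beads are listed upwards from the lowest row, opposite
-- to the decreasing exponents of an alternant; the reversal multiplies both sides by the same sign.
-- Coefficients are read off without counting: a target either has coefficient zero or is reached by
-- a walk, and every walk to it has the coefficient as its sign. This is also why `sgnᵣ` does not
-- depend on which decomposition the search returns.

Functional : ℕ → Set
Functional n = Vec ℕ n → ℤ

infixl 6 _+ᵛ_
_+ᵛ_ : ∀ {n} → Vec ℕ n → Vec ℕ n → Vec ℕ n
_+ᵛ_ = zipWith _+_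

+ᵛ-comm : ∀ {n} (α β : Vec ℕ n) → α +ᵛ β ≡ β +ᵛ α
+ᵛ-comm = Vecₚ.zipWith-comm ℕₚ.+-comm

+ᵛ-assoc : ∀ {n} (α β γ : Vec ℕ n) → (α +ᵛ β) +ᵛ γ ≡ α +ᵛ (β +ᵛ γ)
+ᵛ-assoc = Vecₚ.zipWith-assoc ℕₚ.+-assoc

-- Linear functionals and products of polynomials.

eval-0 : ∀ {n} (p : Polynomial n) → eval (λ _ → 0ℤ) p ≡ 0ℤ
eval-0 []            = refl
eval-0 ((c , _) ∷ p) = cong₂ ℤ._+_ (ℤₚ.*-zeroʳ c) (eval-0 p)

eval-linear : ∀ {n} c (F G : Functional n) p →
  eval (λ α → c ℤ.* F α ℤ.+ G α) p ≡ c ℤ.* eval F p ℤ.+ eval G p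
eval-linear c F G []            = sym (trans (ℤₚ.+-identityʳ _) (ℤₚ.*-zeroʳ c))
eval-linear c F G ((d , β) ∷ p) =
  trans (cong (λ z → d ℤ.* (c ℤ.* F β ℤ.+ G β) ℤ.+ z) (eval-linear c F G p))
        (rearrange c d (F β) (G β) (eval F p) (eval G p))
  where
  rearrange : ∀ c d f g x y → d ℤ.* (c ℤ.* f ℤ.+ g) ℤ.+ (c ℤ.* x ℤ.+ y) ≡
                              c ℤ.* (d ℤ.* f ℤ.+ x) ℤ.+ (d ℤ.* g ℤ.+ y)
  rearrange = ℤ-Solver.solve-∀

eval-mapExponents : ∀ {k n} (F : Functional n) (g : Vec ℕ k → Vec ℕ n) p →
                    eval F (mapExponents g p) ≡ eval (F ∘ g) p
eval-mapExponents F g []            = refl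
eval-mapExponents F g ((c , β) ∷ p) = cong (λ z → c ℤ.* F (g β) ℤ.+ z) (eval-mapExponents F g p)

eval-term-* : ∀ {n} (F : Functional n) c α q →
              eval F (((c , α) ∷ []) *ₚ q) ≡ c ℤ.* eval (λ β → F (α +ᵛ β)) q
eval-term-* F c α []            = sym (ℤₚ.*-zeroʳ c)
eval-term-* F c α ((d , β) ∷ q) =
  trans (cong (λ z → c ℤ.* d ℤ.* F (α +ᵛ β) ℤ.+ z) (eval-term-* F c α q))
        (rearrange c d (F (α +ᵛ β)) _)
  where
  rearrange : ∀ c d f x → c ℤ.* d ℤ.* f ℤ.+ c ℤ.* x ≡ c ℤ.* (d ℤ.* f ℤ.+ x)
  rearrange = ℤ-Solver.solve-∀

eval-* : ∀ {n} (F : Functional n) p q →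
         eval F (p *ₚ q) ≡ eval (λ α → eval (λ β → F (α +ᵛ β)) q) p
eval-* F []            q = refl
eval-* F ((c , α) ∷ p) q = begin
  eval F (((c , α) ∷ p) *ₚ q)                                ≡⟨ cong (eval F) (*ₚ-∷ (c , α) p q) ⟩
  eval F (((c , α) ∷ []) *ₚ q +ₚ p *ₚ q)                     ≡⟨ eval-++ F (((c , α) ∷ []) *ₚ q) (p *ₚ q) ⟩
  eval F (((c , α) ∷ []) *ₚ q) ℤ.+ eval F (p *ₚ q)           ≡⟨ cong₂ ℤ._+_ (eval-term-* F c α q) (eval-* F p q) ⟩
  eval (λ α → eval (λ β → F (α +ᵛ β)) q) ((c , α) ∷ p)       ∎
  where open ≡-Reasoning

eval-swap : ∀ {k n} (G : Vec ℕ k → Vec ℕ n → ℤ) p q →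
            eval (λ α → eval (G α) q) p ≡ eval (λ β → eval (λ α → G α β) p) q
eval-swap G []            q = sym (eval-0 q)
eval-swap G ((c , α) ∷ p) q =
  trans (cong (λ z → c ℤ.* eval (G α) q ℤ.+ z) (eval-swap G p q))
        (sym (eval-linear c (G α) (λ β → eval (λ α → G α β) p) q))

coeff-eval : ∀ {n} (p : Polynomial n) α → coeff p α ≡ eval (λ β → indicator β α) p
coeff-eval []            α = refl
coeff-eval ((c , β) ∷ p) α = cong₂ ℤ._+_ (term-δ c β α) (coeff-eval p α)

-- Alternants as antisymmetrised functionals.

-- The Laplace expansion of an alternant along its first row, with the exponents as columns.
expand : ∀ {n} → Functional (suc n) → Functional (suc n)
expand {zero}  G v       = G v
expand {suc n} G (x ∷ v) = G (x ∷ v) ℤ.- expand (λ w → G (Vec.head w ∷ x ∷ Vec.tail w)) v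

-- asym F β = Σ_σ sgn(σ) F(σβ), the value of F on the alternant a_β.
asym : ∀ {n} → Functional n → Functional n
asym {zero}  F = F
asym {suc n} F = expand (λ v → asym (F ∘ (Vec.head v ∷_)) (Vec.tail v))

expand-cong : ∀ {n} {F G : Functional (suc n)} → (∀ v → F v ≡ G v) → ∀ v → expand F v ≡ expand G v
expand-cong {zero}  e v       = e v
expand-cong {suc n} e (x ∷ v) = cong₂ ℤ._-_ (e (x ∷ v)) (expand-cong (λ w → e _) v)

asym-cong : ∀ {n} {F G : Functional n} → (∀ v → F v ≡ G v) → ∀ v → asym F v ≡ asym G v
asym-cong {zero}  e v = e v
asym-cong {suc n} e v = expand-cong (λ w → asym-cong (λ u → e _) (Vec.tail w)) v

expand-linear : ∀ {n} c (F G : Functional (suc n)) v →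
  expand (λ w → c ℤ.* F w ℤ.+ G w) v ≡ c ℤ.* expand F v ℤ.+ expand G v
expand-linear {zero}  c F G v       = refl
expand-linear {suc n} c F G (x ∷ v) =
  trans (cong (λ z → c ℤ.* F (x ∷ v) ℤ.+ G (x ∷ v) ℤ.- z)
          (expand-linear c (λ w → F (Vec.head w ∷ x ∷ Vec.tail w)) (λ w → G (Vec.head w ∷ x ∷ Vec.tail w)) v))
        (rearrange c (F (x ∷ v)) (G (x ∷ v)) _ _)
  where
  rearrange : ∀ c f g x y → c ℤ.* f ℤ.+ g ℤ.- (c ℤ.* x ℤ.+ y) ≡ c ℤ.* (f ℤ.- x) ℤ.+ (g ℤ.- y)
  rearrange = ℤ-Solver.solve-∀

expand-+ : ∀ {n} (F G : Functional (suc n)) v →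
  expand (λ w → F w ℤ.+ G w) v ≡ expand F v ℤ.+ expand G v
expand-+ F G v =
  trans (expand-cong (λ w → cong (ℤ._+ G w) (sym (ℤₚ.*-identityˡ (F w)))) v)
  (trans (expand-linear 1ℤ F G v) (cong (ℤ._+ expand G v) (ℤₚ.*-identityˡ (expand F v))))

expand-0 : ∀ {n} (v : Vec ℕ (suc n)) → expand (λ _ → 0ℤ) v ≡ 0ℤ
expand-0 {zero}  v       = refl
expand-0 {suc n} (x ∷ v) = cong (λ z → 0ℤ ℤ.- z) (expand-0 v)

asym-linear : ∀ {n} c (F G : Functional n) v →
  asym (λ w → c ℤ.* F w ℤ.+ G w) v ≡ c ℤ.* asym F v ℤ.+ asym G v
asym-linear {zero}  c F G v = refl
asym-linear {suc n} c F G v =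
  trans (expand-cong (λ w → asym-linear c _ _ (Vec.tail w)) v) (expand-linear c _ _ v)

asym-+ : ∀ {n} (F G : Functional n) v →
  asym (λ w → F w ℤ.+ G w) v ≡ asym F v ℤ.+ asym G v
asym-+ F G v =
  trans (asym-cong (λ w → cong (ℤ._+ G w) (sym (ℤₚ.*-identityˡ (F w)))) v)
  (trans (asym-linear 1ℤ F G v) (cong (ℤ._+ asym G v) (ℤₚ.*-identityˡ (asym F v))))

asym-0 : ∀ {n} (v : Vec ℕ n) → asym (λ _ → 0ℤ) v ≡ 0ℤ
asym-0 {zero}  v = refl
asym-0 {suc n} v = trans (expand-cong (λ w → asym-0 (Vec.tail w)) v) (expand-0 v)

asym-eval : ∀ {k n} (G : Vec ℕ k → Functional n) p v →
            eval (λ γ → asym (G γ) v) p ≡ asym (λ α → eval (λ γ → G γ α) p) v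
asym-eval G []            v = sym (asym-0 v)
asym-eval G ((c , γ) ∷ p) v =
  trans (cong (λ z → c ℤ.* asym (G γ) v ℤ.+ z) (asym-eval G p v)) (sym (asym-linear c (G γ) (λ α → eval (λ γ → G γ α) p) v))

sumFin : ∀ n → (Fin n → ℤ) → ℤ
sumFin zero    f = 0ℤ
sumFin (suc n) f = f Fin.zero ℤ.+ sumFin n (f ∘ Fin.suc)

sumFin-cong : ∀ n {f g : Fin n → ℤ} → (∀ j → f j ≡ g j) → sumFin n f ≡ sumFin n g
sumFin-cong zero    e = refl
sumFin-cong (suc n) e = cong₂ ℤ._+_ (e Fin.zero) (sumFin-cong n (e ∘ Fin.suc))

sumFin-neg : ∀ n (f : Fin n → ℤ) → sumFin n (λ j → -1ℤ ℤ.* f j) ≡ ℤ.- sumFin n f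
sumFin-neg zero    f = refl
sumFin-neg (suc n) f = trans (cong (λ z → -1ℤ ℤ.* f Fin.zero ℤ.+ z) (sumFin-neg n (f ∘ Fin.suc)))
                             (rearrange (f Fin.zero) (sumFin n (f ∘ Fin.suc)))
  where
  rearrange : ∀ x y → -1ℤ ℤ.* x ℤ.- y ≡ ℤ.- (x ℤ.+ y)
  rearrange = ℤ-Solver.solve-∀

eval-foldr : ∀ {n} (F : Functional n) k {A : Set} (f : A → Polynomial n) (g : Fin k → A) →
  eval F (foldr _+ₚ_ 0ₚ (map f (List.tabulate g))) ≡ sumFin k (λ j → eval F (f (g j)))
eval-foldr F zero    f g = refl
eval-foldr F (suc k) f g = trans (eval-++ F (f (g Fin.zero)) _)
  (cong (λ z → eval F (f (g Fin.zero)) ℤ.+ z) (eval-foldr F k f (g ∘ Fin.suc)))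

-- Choosing column j + 1 leaves column 0 in front of the remaining columns and costs one more sign,
-- which is exactly the recursive step of `expand`.
expand-sum : ∀ {n} (G : Functional (suc n)) β →
  sumFin (suc n) (λ j → -1ℤ ℤ.^ toℕ j ℤ.* G (β j ∷ tabulate (β ∘ punchIn j))) ≡
  expand G (tabulate β)
expand-sum {zero}  G β = trans (ℤₚ.+-identityʳ _) (ℤₚ.*-identityˡ _)
expand-sum {suc n} G β = cong₂ ℤ._+_ (ℤₚ.*-identityˡ (G (tabulate β)))
  (trans (sumFin-cong (suc n) (λ j → ℤₚ.*-assoc -1ℤ (-1ℤ ℤ.^ toℕ j) (G′ (β (Fin.suc j) ∷ tabulate (β ∘ Fin.suc ∘ punchIn j)))))
  (trans (sumFin-neg (suc n) (λ j → -1ℤ ℤ.^ toℕ j ℤ.* G′ (β (Fin.suc j) ∷ tabulate (β ∘ Fin.suc ∘ punchIn j))))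
         (cong ℤ.-_ (expand-sum G′ (β ∘ Fin.suc)))))
  where
  G′ : Functional (suc n)
  G′ w = G (Vec.head w ∷ β Fin.zero ∷ Vec.tail w)

mapExponents-foldr : ∀ {k n} (g : Vec ℕ k → Vec ℕ n) {A : Set} (f : A → Polynomial k) xs →
  mapExponents g (foldr _+ₚ_ 0ₚ (map f xs)) ≡ foldr _+ₚ_ 0ₚ (map (mapExponents g ∘ f) xs)
mapExponents-foldr g f []       = refl
mapExponents-foldr g f (x ∷ xs) =
  trans (Listₚ.map-++ (map₂ g) (f x) _) (cong (mapExponents g (f x) ++_) (mapExponents-foldr g f xs))

-- Makes the recursion on alternants possible: a minor of the first row involves only the later
-- variables, so it is an alternant in one variable fewer with a zero exponent put in front.
det-0∷ : ∀ {N} n (A : Fin n → Fin n → Polynomial N) →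
         mapExponents (0 ∷_) (det n A) ≡ det n (λ i j → mapExponents (0 ∷_) (A i j))
det-0∷ zero    A = refl
det-0∷ (suc n) A = trans (mapExponents-foldr (0 ∷_) _ (allFin (suc n)))
  (cong (foldr _+ₚ_ 0ₚ) (Listₚ.map-cong minor (allFin (suc n))))
  where
  minor : ∀ j → mapExponents (0 ∷_) ((-1ℤ ℤ.^ toℕ j) •ₚ A Fin.zero j *ₚ det n (λ i k → A (Fin.suc i) (punchIn j k)))
              ≡ (-1ℤ ℤ.^ toℕ j) •ₚ mapExponents (0 ∷_) (A Fin.zero j) *ₚ
                det n (λ i k → mapExponents (0 ∷_) (A (Fin.suc i) (punchIn j k)))
  minor j = trans (mapExponents-* (0 ∷_) (λ _ _ → refl) ((-1ℤ ℤ.^ toℕ j) •ₚ A Fin.zero j) (det n λ i k → A (Fin.suc i) (punchIn j k)))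
    (cong₂ _*ₚ_ (mapExponents-• (0 ∷_) (-1ℤ ℤ.^ toℕ j) (A Fin.zero j)) (det-0∷ n _))

eval-alternant : ∀ {n} (F : Functional n) β → eval F (alternant β) ≡ asym F (tabulate β)
eval-alternant {zero}  F β = trans (ℤₚ.+-identityʳ _) (ℤₚ.*-identityˡ (F []))
eval-alternant {suc n} F β = begin
  eval F (alternant β)
    ≡⟨ eval-foldr F (suc n) (λ j → (-1ℤ ℤ.^ toℕ j) •ₚ x[ Fin.zero ]^ β j *ₚ rest j) (λ j → j) ⟩
  sumFin (suc n) (λ j → eval F ((-1ℤ ℤ.^ toℕ j) •ₚ x[ Fin.zero ]^ β j *ₚ rest j))
    ≡⟨ sumFin-cong (suc n) minor ⟩
  sumFin (suc n) (λ j → -1ℤ ℤ.^ toℕ j ℤ.* asym (F ∘ (β j ∷_)) (tabulate (β ∘ punchIn j)))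
    ≡⟨ expand-sum (λ v → asym (F ∘ (Vec.head v ∷_)) (Vec.tail v)) β ⟩
  asym F (tabulate β) ∎
  where
  open ≡-Reasoning
  rest : Fin (suc n) → Polynomial (suc n)
  rest j = det n λ i k → x[ Fin.suc i ]^ β (punchIn j k)
  minor : ∀ j → eval F ((-1ℤ ℤ.^ toℕ j) •ₚ x[ Fin.zero ]^ β j *ₚ rest j)
              ≡ -1ℤ ℤ.^ toℕ j ℤ.* asym (F ∘ (β j ∷_)) (tabulate (β ∘ punchIn j))
  minor j = begin
    eval F ((-1ℤ ℤ.^ toℕ j) •ₚ x[ Fin.zero ]^ β j *ₚ rest j)
      ≡⟨ eval-term-* F (-1ℤ ℤ.^ toℕ j ℤ.* 1ℤ) (β j ∷ replicate n 0) (rest j) ⟩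
    -1ℤ ℤ.^ toℕ j ℤ.* 1ℤ ℤ.* eval (λ α → F ((β j ∷ replicate n 0) +ᵛ α)) (rest j)
      ≡⟨ cong₂ ℤ._*_ (ℤₚ.*-identityʳ (-1ℤ ℤ.^ toℕ j))
           (cong (eval λ α → F ((β j ∷ replicate n 0) +ᵛ α)) (sym (det-0∷ n λ i k → x[ i ]^ β (punchIn j k)))) ⟩
    -1ℤ ℤ.^ toℕ j ℤ.* eval (λ α → F ((β j ∷ replicate n 0) +ᵛ α)) (mapExponents (0 ∷_) (alternant (β ∘ punchIn j)))
      ≡⟨ cong ((-1ℤ ℤ.^ toℕ j) ℤ.*_) (begin
        eval (λ α → F ((β j ∷ replicate n 0) +ᵛ α)) (mapExponents (0 ∷_) (alternant (β ∘ punchIn j)))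
          ≡⟨ eval-mapExponents _ (0 ∷_) (alternant (β ∘ punchIn j)) ⟩
        eval (λ α → F (β j + 0 ∷ replicate n 0 +ᵛ α)) (alternant (β ∘ punchIn j))
          ≡⟨ eval-ext (λ α → cong₂ (λ b γ → F (b ∷ γ)) (ℕₚ.+-identityʳ (β j))
               (Vecₚ.zipWith-identityˡ {f = _+_} (λ _ → refl) α)) (alternant (β ∘ punchIn j)) ⟩
        eval (F ∘ (β j ∷_)) (alternant (β ∘ punchIn j))
          ≡⟨ eval-alternant (F ∘ (β j ∷_)) (β ∘ punchIn j) ⟩
        asym (F ∘ (β j ∷_)) (tabulate (β ∘ punchIn j)) ∎) ⟩
    -1ℤ ℤ.^ toℕ j ℤ.* asym (F ∘ (β j ∷_)) (tabulate (β ∘ punchIn j)) ∎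

-- Multiplication by h_m(x^r) as a sum over shifts.

-- shiftSum r m A v is the sum of A (v + r γ) over all γ with γ₁ + ⋯ + γₙ = m.
shiftSum : ℕ → ∀ {n} → ℕ → Functional n → Functional n
shiftSum r zero    A v       = A v
shiftSum r (suc m) A []      = 0ℤ
shiftSum r (suc m) A (x ∷ v) = shiftSum r (suc m) (A ∘ (x ∷_)) v ℤ.+ shiftSum r m A (x + r ∷ v)

monomials-map : ∀ {k n} (g : Vec ℕ k → Vec ℕ n) αs →
                map (1ℤ ,_) (map g αs) ≡ mapExponents g (map (1ℤ ,_) αs)
monomials-map g αs = trans (sym (Listₚ.map-∘ αs)) (Listₚ.map-∘ αs)

eval-complete : ∀ r {n} m (A : Functional n) v →
  eval (λ γ → A (v +ᵛ Vec.map (r *_) γ)) (complete n m) ≡ shiftSum r m A v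
eval-complete r zero A [] = trans (ℤₚ.+-identityʳ _) (ℤₚ.*-identityˡ (A []))
eval-complete r {suc n} zero A (x ∷ v) = begin
  eval F (map (1ℤ ,_) (map (0 ∷_) (exponents n 0)))
    ≡⟨ cong (eval F) (monomials-map (0 ∷_) (exponents n 0)) ⟩
  eval F (mapExponents (0 ∷_) (complete n 0))
    ≡⟨ eval-mapExponents F (0 ∷_) (complete n 0) ⟩
  eval (λ γ → A (x + r * 0 ∷ v +ᵛ Vec.map (r *_) γ)) (complete n 0)
    ≡⟨ eval-ext (λ γ → cong (λ z → A (x + z ∷ v +ᵛ Vec.map (r *_) γ)) (ℕₚ.*-zeroʳ r)) (complete n 0) ⟩
  eval (λ γ → A (x + 0 ∷ v +ᵛ Vec.map (r *_) γ)) (complete n 0)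
    ≡⟨ eval-complete r zero (λ u → A (x + 0 ∷ u)) v ⟩
  A (x + 0 ∷ v)
    ≡⟨ cong (λ z → A (z ∷ v)) (ℕₚ.+-identityʳ x) ⟩
  A (x ∷ v) ∎
  where
  open ≡-Reasoning
  F : Functional (suc n)
  F γ = A ((x ∷ v) +ᵛ Vec.map (r *_) γ)
eval-complete r (suc m) A [] = refl
eval-complete r {suc n} (suc m) A (x ∷ v) = begin
  eval F (map (1ℤ ,_) (map (0 ∷_) (exponents n (suc m)) ++ map raise (exponents (suc n) m)))
    ≡⟨ cong (eval F) (Listₚ.map-++ (1ℤ ,_) (map (0 ∷_) (exponents n (suc m))) _) ⟩
  eval F (map (1ℤ ,_) (map (0 ∷_) (exponents n (suc m))) ++ map (1ℤ ,_) (map raise (exponents (suc n) m)))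
    ≡⟨ eval-++ F (map (1ℤ ,_) (map (0 ∷_) (exponents n (suc m)))) _ ⟩
  eval F (map (1ℤ ,_) (map (0 ∷_) (exponents n (suc m)))) ℤ.+
  eval F (map (1ℤ ,_) (map raise (exponents (suc n) m)))
    ≡⟨ cong₂ (λ p q → eval F p ℤ.+ eval F q)
         (monomials-map (0 ∷_) (exponents n (suc m)))
         (monomials-map raise (exponents (suc n) m)) ⟩
  eval F (mapExponents (0 ∷_) (complete n (suc m))) ℤ.+ eval F (mapExponents raise (complete (suc n) m))
    ≡⟨ cong₂ ℤ._+_ (eval-mapExponents F (0 ∷_) (complete n (suc m)))
                   (eval-mapExponents F raise (complete (suc n) m)) ⟩
  eval (F ∘ (0 ∷_)) (complete n (suc m)) ℤ.+ eval (F ∘ raise) (complete (suc n) m)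
    ≡⟨ cong₂ ℤ._+_
         (eval-ext (λ γ → cong (λ z → A (z ∷ v +ᵛ Vec.map (r *_) γ))
                               (trans (cong (x +_) (ℕₚ.*-zeroʳ r)) (ℕₚ.+-identityʳ x))) (complete n (suc m)))
         (eval-ext raised (complete (suc n) m)) ⟩
  eval (λ γ → A (x ∷ v +ᵛ Vec.map (r *_) γ)) (complete n (suc m)) ℤ.+
  eval (λ γ → A ((x + r ∷ v) +ᵛ Vec.map (r *_) γ)) (complete (suc n) m)
    ≡⟨ cong₂ ℤ._+_ (eval-complete r (suc m) (A ∘ (x ∷_)) v) (eval-complete r m A (x + r ∷ v)) ⟩
  shiftSum r (suc m) A (x ∷ v) ∎
  where
  open ≡-Reasoning
  F : Functional (suc n)
  F γ = A ((x ∷ v) +ᵛ Vec.map (r *_) γ)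
  raised : ∀ γ → F (raise γ) ≡ A ((x + r ∷ v) +ᵛ Vec.map (r *_) γ)
  raised (k ∷ γ) = cong (λ z → A (z ∷ v +ᵛ Vec.map (r *_) γ))
    (trans (cong (x +_) (ℕₚ.*-suc r k)) (sym (ℕₚ.+-assoc x r (r * k))))

shiftSum-cong : ∀ r {n} m {A B : Functional n} → (∀ v → A v ≡ B v) →
                ∀ v → shiftSum r m A v ≡ shiftSum r m B v
shiftSum-cong r zero    e v       = e v
shiftSum-cong r (suc m) e []      = refl
shiftSum-cong r (suc m) e (x ∷ v) =
  cong₂ ℤ._+_ (shiftSum-cong r (suc m) (e ∘ (x ∷_)) v) (shiftSum-cong r m e (x + r ∷ v))

shiftSum-minus : ∀ r {n} m (A B : Functional n) v →
  shiftSum r m (λ w → A w ℤ.- B w) v ≡ shiftSum r m A v ℤ.- shiftSum r m B v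
shiftSum-minus r zero    A B v       = refl
shiftSum-minus r (suc m) A B []      = refl
shiftSum-minus r (suc m) A B (x ∷ v) =
  trans (cong₂ ℤ._+_ (shiftSum-minus r (suc m) (A ∘ (x ∷_)) (B ∘ (x ∷_)) v) (shiftSum-minus r m A B (x + r ∷ v)))
        (rearrange (shiftSum r (suc m) (A ∘ (x ∷_)) v) (shiftSum r (suc m) (B ∘ (x ∷_)) v)
                   (shiftSum r m A (x + r ∷ v)) (shiftSum r m B (x + r ∷ v)))
  where
  rearrange : ∀ a b c d → (a ℤ.- b) ℤ.+ (c ℤ.- d) ≡ (a ℤ.+ c) ℤ.- (b ℤ.+ d)
  rearrange = ℤ-Solver.solve-∀

shiftSum-neg : ∀ r {n} m (A : Functional n) v →
  shiftSum r m (λ w → ℤ.- A w) v ≡ ℤ.- shiftSum r m A v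
shiftSum-neg r zero    A v       = refl
shiftSum-neg r (suc m) A []      = refl
shiftSum-neg r (suc m) A (x ∷ v) =
  trans (cong₂ ℤ._+_ (shiftSum-neg r (suc m) (A ∘ (x ∷_)) v) (shiftSum-neg r m A (x + r ∷ v)))
        (sym (ℤₚ.neg-distrib-+ (shiftSum r (suc m) (A ∘ (x ∷_)) v) (shiftSum r m A (x + r ∷ v))))

-- The recursion of `shiftSum` may split on the second entry instead of the first. In this form the
-- symmetry of h_m enters the proof.
shiftSum-second : ∀ r {n} m (F : Functional (suc (suc n))) z x v →
  shiftSum r (suc m) F (z ∷ x ∷ v) ≡
  shiftSum r (suc m) (λ w → F (Vec.head w ∷ x ∷ Vec.tail w)) (z ∷ v) ℤ.+ shiftSum r m F (z ∷ x + r ∷ v)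
shiftSum-second r zero    F z x v = exchange
  (shiftSum r 1 (λ w → F (z ∷ x ∷ w)) v) (F (z ∷ x + r ∷ v)) (F (z + r ∷ x ∷ v))
  where
  exchange : ∀ a b c → a ℤ.+ b ℤ.+ c ≡ a ℤ.+ c ℤ.+ b
  exchange = ℤ-Solver.solve-∀
shiftSum-second r (suc m) F z x v =
  trans (cong (λ s → shiftSum r (2 + m) (F ∘ (z ∷_)) (x ∷ v) ℤ.+ s) (shiftSum-second r m F (z + r) x v))
        (exchange (shiftSum r (2 + m) (λ w → F (z ∷ x ∷ w)) v)
                  (shiftSum r (suc m) (F ∘ (z ∷_)) (x + r ∷ v))
                  (shiftSum r (suc m) (λ w → F (Vec.head w ∷ x ∷ Vec.tail w)) (z + r ∷ v))
                  (shiftSum r m F (z + r ∷ x + r ∷ v)))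
  where
  exchange : ∀ a b c d → a ℤ.+ b ℤ.+ (c ℤ.+ d) ≡ a ℤ.+ c ℤ.+ (b ℤ.+ d)
  exchange = ℤ-Solver.solve-∀

-- The sum over all γ treats the entries alike, so it commutes with selecting one of them. In the
-- step, `x` stands in second place behind the selected entry, where `shiftSum-second` splits on it.
shiftSum-expand : ∀ r {n} m (F : Functional (suc n)) v →
  shiftSum r m (expand F) v ≡ expand (shiftSum r m F) v
shiftSum-expand r zero F v = expand-cong (λ _ → refl) v
shiftSum-expand r {zero}  (suc m) F (x ∷ []) = cong (λ z → 0ℤ ℤ.+ z) (shiftSum-expand r m F (x + r ∷ []))
shiftSum-expand r {suc n} (suc m) F (x ∷ v)  = begin
  shiftSum r (suc m) (λ w → F (x ∷ w) ℤ.- expand (F under x) w) v ℤ.+ shiftSum r m (expand F) (x + r ∷ v)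
    ≡⟨ cong₂ ℤ._+_ (shiftSum-minus r (suc m) (F ∘ (x ∷_)) (expand (F under x)) v) (shiftSum-expand r m F (x + r ∷ v)) ⟩
  (a ℤ.- shiftSum r (suc m) (expand (F under x)) v) ℤ.+ (b ℤ.- expand (shiftSum r m F under (x + r)) v)
    ≡⟨ cong (λ z → (a ℤ.- z) ℤ.+ (b ℤ.- expand (shiftSum r m F under (x + r)) v))
            (shiftSum-expand r (suc m) (F under x) v) ⟩
  (a ℤ.- expand (shiftSum r (suc m) (F under x)) v) ℤ.+ (b ℤ.- expand (shiftSum r m F under (x + r)) v)
    ≡⟨ rearrange a _ b _ ⟩
  (a ℤ.+ b) ℤ.- (expand (shiftSum r (suc m) (F under x)) v ℤ.+ expand (shiftSum r m F under (x + r)) v)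
    ≡⟨ cong (λ z → (a ℤ.+ b) ℤ.- z)
         (trans (sym (expand-+ (shiftSum r (suc m) (F under x)) (shiftSum r m F under (x + r)) v))
                (expand-cong (λ { (z ∷ w) → sym (shiftSum-second r m F z x w) }) v)) ⟩
  (a ℤ.+ b) ℤ.- expand (shiftSum r (suc m) F under x) v ∎
  where
  open ≡-Reasoning
  _under_ : Functional (suc (suc n)) → ℕ → Functional (suc n)
  (G under y) w = G (Vec.head w ∷ y ∷ Vec.tail w)
  a b : ℤ
  a = shiftSum r (suc m) (F ∘ (x ∷_)) v
  b = shiftSum r m F (x + r ∷ v)
  rearrange : ∀ a b c d → (a ℤ.- b) ℤ.+ (c ℤ.- d) ≡ (a ℤ.+ c) ℤ.- (b ℤ.+ d)
  rearrange = ℤ-Solver.solve-∀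

shiftSum-asym : ∀ r {n} m (F : Functional n) v → shiftSum r m (asym F) v ≡ asym (shiftSum r m F) v
shiftSum-asym r {zero}  zero    F v  = refl
shiftSum-asym r {zero}  (suc m) F [] = refl
shiftSum-asym r {suc n} m       F v  =
  trans (shiftSum-expand r m (λ w → asym (F ∘ (Vec.head w ∷_)) (Vec.tail w)) v)
        (expand-cong (λ { (z ∷ w) → first m z w }) v)
  where
  first : ∀ m z w → shiftSum r m (λ u → asym (F ∘ (Vec.head u ∷_)) (Vec.tail u)) (z ∷ w) ≡
                    asym (shiftSum r m F ∘ (z ∷_)) w
  first zero    z w = refl
  first (suc m) z w =
    trans (cong₂ ℤ._+_ (shiftSum-asym r (suc m) (F ∘ (z ∷_)) w) (first m (z + r) w))
          (sym (asym-+ (shiftSum r (suc m) (F ∘ (z ∷_))) (shiftSum r m F ∘ (z + r ∷_)) w))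

-- Alternating functionals.

-- Only swaps of neighbours are required, at every depth: they generate all permutations, and the
-- recursion follows that of vectors.
data Alternating : ∀ {n} → Functional n → Set where
  nil  : ∀ {A : Functional 0} → Alternating A
  one  : ∀ {A : Functional 1} → Alternating A
  more : ∀ {n} {A : Functional (suc (suc n))} →
         (∀ x y v → A (x ∷ y ∷ v) ≡ ℤ.- A (y ∷ x ∷ v)) → (∀ x → Alternating (A ∘ (x ∷_))) →
         Alternating A

alternating-swap : ∀ {n} {A : Functional (suc (suc n))} → Alternating A →
                   ∀ x y v → A (x ∷ y ∷ v) ≡ ℤ.- A (y ∷ x ∷ v)
alternating-swap (more s _) = s

alternating-tail : ∀ {n} {A : Functional (suc n)} → Alternating A → ∀ x → Alternating (A ∘ (x ∷_))
alternating-tail one         x = nil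
alternating-tail (more _ as) x = as x

alternating-+ : ∀ {n} {A B : Functional n} → Alternating A → Alternating B →
                Alternating (λ v → A v ℤ.+ B v)
alternating-+ nil nil = nil
alternating-+ one one = one
alternating-+ {A = A} {B} (more s as) (more t bs) = more
  (λ x y v → trans (cong₂ ℤ._+_ (s x y v) (t x y v))
                   (sym (ℤₚ.neg-distrib-+ (A (y ∷ x ∷ v)) (B (y ∷ x ∷ v)))))
  (λ x → alternating-+ (as x) (bs x))

alternating-minus : ∀ {n} {A B : Functional n} → Alternating A → Alternating B →
                Alternating (λ v → A v ℤ.- B v)
alternating-minus nil nil = nil
alternating-minus one one = one
alternating-minus {A = A} {B} (more s as) (more t bs) = more
  (λ x y v → trans (cong₂ ℤ._-_ (s x y v) (t x y v))
                   (sym (ℤₚ.neg-distrib-+ (A (y ∷ x ∷ v)) (ℤ.- B (y ∷ x ∷ v)))))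
  (λ x → alternating-minus (as x) (bs x))

expand-neg : ∀ {n} (F : Functional (suc n)) v → expand (λ w → ℤ.- F w) v ≡ ℤ.- expand F v
expand-neg {zero}  F v       = refl
expand-neg {suc n} F (x ∷ v) =
  trans (cong (λ z → ℤ.- F (x ∷ v) ℤ.- z) (expand-neg (λ w → F (Vec.head w ∷ x ∷ Vec.tail w)) v))
        (sym (ℤₚ.neg-distrib-+ (F (x ∷ v)) (ℤ.- expand (λ w → F (Vec.head w ∷ x ∷ Vec.tail w)) v)))

-- The two terms that select `x` or `y` are exchanged with opposite signs. In every other term both
-- entries stay among the rest, where `alt` applies.
expand-alternating : ∀ {n} {G : Functional (suc n)} → (∀ z → Alternating (G ∘ (z ∷_))) →
                     Alternating (expand G)
expand-alternating {zero}            alt = one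
expand-alternating {suc zero} {G}    alt =
  more (λ { x y [] → flip- (G (x ∷ y ∷ [])) (G (y ∷ x ∷ [])) }) (λ x → one)
  where
  flip- : ∀ a b → a ℤ.- b ≡ ℤ.- (b ℤ.- a)
  flip- = ℤ-Solver.solve-∀
expand-alternating {suc (suc n)} {G} alt = more swap
  (λ x → alternating-minus (alt x) (expand-alternating (λ z → alternating-tail (alt z) x)))
  where
  swap : ∀ x y v → expand G (x ∷ y ∷ v) ≡ ℤ.- expand G (y ∷ x ∷ v)
  swap x y v = trans (cong (λ z → G (x ∷ y ∷ v) ℤ.- (G (y ∷ x ∷ v) ℤ.- z)) exchanged)
                     (rearrange (G (x ∷ y ∷ v)) (G (y ∷ x ∷ v)) _)
    where
    exchanged : expand (λ w → G (Vec.head w ∷ x ∷ y ∷ Vec.tail w)) v ≡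
                ℤ.- expand (λ w → G (Vec.head w ∷ y ∷ x ∷ Vec.tail w)) v
    exchanged = trans (expand-cong (λ w → alternating-swap (alt (Vec.head w)) x y (Vec.tail w)) v)
                      (expand-neg (λ w → G (Vec.head w ∷ y ∷ x ∷ Vec.tail w)) v)
    rearrange : ∀ a b c → a ℤ.- (b ℤ.- ℤ.- c) ≡ ℤ.- (b ℤ.- (a ℤ.- c))
    rearrange = ℤ-Solver.solve-∀

asym-alternating : ∀ {n} (F : Functional n) → Alternating (asym F)
asym-alternating {zero}  F = nil
asym-alternating {suc n} F = expand-alternating (λ z → asym-alternating (F ∘ (z ∷_)))

-- Justifies sorting a raised bead while later shifts are pending. For the swap, the left side is
-- split on its second entry and the right side on its first, so that both are split on the same
-- number `y`.
shiftSum-alternating : ∀ r {n} m {A : Functional n} → Alternating A → Alternating (shiftSum r m A)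
shiftSum-alternating r zero            alt = alt
shiftSum-alternating r {zero}  (suc m) alt = nil
shiftSum-alternating r {suc zero} (suc m) alt = one
shiftSum-alternating r {suc (suc n)} (suc m) {A} alt@(more s as) = more swap
  (λ x → alternating-+ (shiftSum-alternating r (suc m) (as x))
                       (alternating-tail (shiftSum-alternating r m alt) (x + r)))
  where
  swap : ∀ x y v → shiftSum r (suc m) A (x ∷ y ∷ v) ≡ ℤ.- shiftSum r (suc m) A (y ∷ x ∷ v)
  swap x y v = begin
    shiftSum r (suc m) A (x ∷ y ∷ v)
      ≡⟨ shiftSum-second r m A x y v ⟩
    shiftSum r (suc m) (λ w → A (Vec.head w ∷ y ∷ Vec.tail w)) (x ∷ v) ℤ.+ shiftSum r m A (x ∷ y + r ∷ v)
      ≡⟨ cong₂ ℤ._+_ (trans (shiftSum-cong r (suc m) (λ { (z ∷ w) → s z y w }) (x ∷ v))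
                            (shiftSum-neg r (suc m) (A ∘ (y ∷_)) (x ∷ v)))
                     (alternating-swap (shiftSum-alternating r m alt) x (y + r) v) ⟩
    ℤ.- shiftSum r (suc m) (A ∘ (y ∷_)) (x ∷ v) ℤ.- shiftSum r m A (y + r ∷ x ∷ v)
      ≡⟨ ℤₚ.neg-distrib-+ (shiftSum r (suc m) (A ∘ (y ∷_)) (x ∷ v)) (shiftSum r m A (y + r ∷ x ∷ v)) ⟨
    ℤ.- shiftSum r (suc m) A (y ∷ x ∷ v) ∎
    where open ≡-Reasoning

-- Cancelling the alternant of an increasing exponent vector.

data IncreasingFrom (lo : ℕ) : ∀ {n} → Vec ℕ n → Set where
  []  : IncreasingFrom lo []
  _∷_ : ∀ {n x} {v : Vec ℕ n} → lo ≤ x → IncreasingFrom (suc x) v → IncreasingFrom lo (x ∷ v)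

increasing-≤ : ∀ {lo lo′ n} {v : Vec ℕ n} → lo′ ≤ lo → IncreasingFrom lo v → IncreasingFrom lo′ v
increasing-≤ le []       = []
increasing-≤ le (l ∷ is) = ℕₚ.≤-trans le l ∷ is

infix 4 _<ₗ_
_<ₗ_ : ∀ {n} → Vec ℕ n → Vec ℕ n → Set
_<ₗ_ = Lex.Lex-< _≡_ _<_

<ₗ-wellFounded : ∀ {n} → WellFounded (_<ₗ_ {n})
<ₗ-wellFounded = Lex.<-wellFounded trans (λ { refl x<y → x<y }) <-wellFounded

-- An exponent `v` beyond `ρ` can contribute to `α + ρ` only through some `γ` below `α`, where
-- induction already gives coefficient zero.
<ₗ-balance : ∀ {n} (α γ ρ v : Vec ℕ n) → γ +ᵛ v ≡ α +ᵛ ρ → ρ <ₗ v → γ <ₗ α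
<ₗ-balance [] [] [] [] e (Lex.base ())
<ₗ-balance (a ∷ α) (c ∷ γ) (p ∷ ρ) (x ∷ v) e (Lex.this p<x _) =
  Lex.this (ℕₚ.+-cancelʳ-< x c a (ℕₚ.≤-<-trans (ℕₚ.≤-reflexive (Vecₚ.∷-injectiveˡ e)) (ℕₚ.+-monoʳ-< a p<x))) refl
<ₗ-balance (a ∷ α) (c ∷ γ) (p ∷ ρ) (.p ∷ v) e (Lex.next refl ρ<v) =
  Lex.next (ℕₚ.+-cancelʳ-≡ p c a (Vecₚ.∷-injectiveˡ e)) (<ₗ-balance α γ ρ v (Vecₚ.∷-injectiveʳ e) ρ<v)

+ᵛ-cancelʳ : ∀ {n} (α γ ρ : Vec ℕ n) → γ +ᵛ ρ ≡ α +ᵛ ρ → γ ≡ α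
+ᵛ-cancelʳ []      []      []      e = refl
+ᵛ-cancelʳ (a ∷ α) (c ∷ γ) (p ∷ ρ) e =
  cong₂ _∷_ (ℕₚ.+-cancelʳ-≡ p c a (Vecₚ.∷-injectiveˡ e)) (+ᵛ-cancelʳ α γ ρ (Vecₚ.∷-injectiveʳ e))

expand-vanish : ∀ {n x} {v : Vec ℕ (suc n)} (G : Functional (suc n)) →
  (∀ z w → x < z → G (z ∷ w) ≡ 0ℤ) → IncreasingFrom (suc x) v → expand G v ≡ 0ℤ
expand-vanish {zero}  {v = y ∷ []} G van (x<y ∷ is) = van y [] x<y
expand-vanish {suc n} {v = y ∷ v}  G van (x<y ∷ is) = cong₂ ℤ._-_ (van y v x<y)
  (expand-vanish (λ w → G (Vec.head w ∷ y ∷ Vec.tail w)) (λ z w → van z (y ∷ w))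
                 (increasing-≤ (ℕₚ.m≤n⇒m≤1+n x<y) is))

-- Every other rearrangement of an increasing ρ is lexicographically larger.
asym-least : ∀ {n lo} {ρ : Vec ℕ n} (F : Functional n) → IncreasingFrom lo ρ →
             (∀ v → ρ <ₗ v → F v ≡ 0ℤ) → asym F ρ ≡ F ρ
asym-least F [] van = refl
asym-least {ρ = x ∷ ρ} F (_ ∷ is) van =
  trans (leading ρ is) (asym-least (F ∘ (x ∷_)) is (λ v ρ<v → van (x ∷ v) (Lex.next refl ρ<v)))
  where
  G : Functional _
  G v = asym (F ∘ (Vec.head v ∷_)) (Vec.tail v)
  above : ∀ z w → x < z → G (z ∷ w) ≡ 0ℤ
  above z w x<z = trans (asym-cong (λ v → van (z ∷ v) (Lex.this x<z refl)) w) (asym-0 w)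
  leading : ∀ ρ → IncreasingFrom (suc x) ρ → expand G (x ∷ ρ) ≡ G (x ∷ ρ)
  leading []      is = refl
  leading (y ∷ ρ) is = trans
    (cong (λ z → G (x ∷ y ∷ ρ) ℤ.- z)
          (expand-vanish (λ w → G (Vec.head w ∷ x ∷ Vec.tail w)) (λ z w → above z (x ∷ w)) is))
    (ℤₚ.+-identityʳ _)

weight : ∀ {n} → Functional n → Polynomial n → Polynomial n
weight K = map λ (c , γ) → c ℤ.* K γ , γ

coeff-weight : ∀ {n} (K : Functional n) p γ → coeff (weight K p) γ ≡ coeff p γ ℤ.* K γ
coeff-weight K []            γ = refl
coeff-weight K ((c , β) ∷ p) γ with β ≟ᵉ γ
... | yes refl = trans (cong (λ z → c ℤ.* K β ℤ.+ z) (coeff-weight K p β))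
                       (sym (ℤₚ.*-distribʳ-+ (K β) c (coeff p β)))
... | no _     = trans (ℤₚ.+-identityˡ _) (trans (coeff-weight K p γ)
                       (cong (ℤ._* K γ) (sym (ℤₚ.+-identityˡ (coeff p γ)))))

eval-weight : ∀ {n} (K : Functional n) p → eval (λ _ → 1ℤ) (weight K p) ≡ eval K p
eval-weight K []            = refl
eval-weight K ((c , β) ∷ p) = cong₂ ℤ._+_ (ℤₚ.*-identityʳ (c ℤ.* K β)) (eval-weight K p)

-- The list `p` may repeat or cancel terms, so agreement on its support has to be expressed through
-- coefficients. Moving the values of `K` and `G` into the coefficients turns it into an equality of
-- polynomials, to which `eval-cong` applies.
eval-support : ∀ {n} {K G : Functional n} p →
  (∀ γ → coeff p γ ℤ.* K γ ≡ coeff p γ ℤ.* G γ) → eval K p ≡ eval G p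
eval-support {K = K} {G} p e =
  trans (sym (eval-weight K p)) (trans (eval-cong (λ _ → 1ℤ) weights) (eval-weight G p))
  where
  weights : weight K p ≈ₚ weight G p
  weights = coeffs λ γ → trans (coeff-weight K p γ) (trans (e γ) (sym (coeff-weight G p γ)))

-- A polynomial annihilated by the alternant of ρ vanishes: its lexicographically least
-- exponent α would contribute the only term with exponent α + ρ.
asym-nonZeroDivisor : ∀ {n lo} {ρ : Vec ℕ n} → IncreasingFrom lo ρ → (p : Polynomial n) →
  (∀ F → eval (λ γ → asym (λ α → F (γ +ᵛ α)) ρ) p ≡ 0ℤ) → p ≈ₚ 0ₚ
asym-nonZeroDivisor {n} {ρ = ρ} inc p zero-product = coeffs λ α → vanish α (<ₗ-wellFounded α)
  where
  open ≡-Reasoning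
  vanish : ∀ α → Acc _<ₗ_ α → coeff p α ≡ 0ℤ
  vanish α (acc below) = begin
    coeff p α                      ≡⟨ coeff-eval p α ⟩
    eval (λ γ → indicator γ α) p   ≡⟨ eval-support p (λ γ → compare γ (Lex.<-decidable ℕ._≟_ ℕ._<?_ γ α)) ⟨
    eval K p                       ≡⟨ zero-product (λ ξ → indicator ξ (α +ᵛ ρ)) ⟩
    0ℤ                             ∎
    where
    -- `K γ` is the coefficient of `α + ρ` in the product of x^γ with the alternant of `ρ`.
    K : Functional n
    K γ = asym (λ v → indicator (γ +ᵛ v) (α +ᵛ ρ)) ρ
    compare : ∀ γ → Dec (γ <ₗ α) → coeff p γ ℤ.* K γ ≡ coeff p γ ℤ.* indicator γ α
    compare γ (yes γ<α) rewrite vanish γ (below γ<α) = refl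
    compare γ (no γ≮α)  = cong (coeff p γ ℤ.*_) (trans
      (asym-least _ inc λ v ρ<v → cong (if_then 1ℤ else 0ℤ)
        (dec-false ((γ +ᵛ v) ≟ᵉ (α +ᵛ ρ)) (λ e → γ≮α (<ₗ-balance α γ ρ v e ρ<v))))
      (cong (if_then 1ℤ else 0ℤ) leading))
      where
      leading : does ((γ +ᵛ ρ) ≟ᵉ (α +ᵛ ρ)) ≡ does (γ ≟ᵉ α)
      leading = does-⇔ (mk⇔ (+ᵛ-cancelʳ α γ ρ) (cong (_+ᵛ ρ))) ((γ +ᵛ ρ) ≟ᵉ (α +ᵛ ρ)) (γ ≟ᵉ α)

-- Reversing the order of the entries.

alternating-∷ʳ : ∀ {n} {A : Functional (suc n)} → Alternating A → ∀ x v →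
                 A (v ∷ʳ x) ≡ -1ℤ ℤ.^ n ℤ.* A (x ∷ v)
alternating-∷ʳ {A = A} alt x []      = sym (ℤₚ.*-identityˡ (A (x ∷ [])))
alternating-∷ʳ {suc n} {A = A} alt@(more s _) x (y ∷ v) = begin
  A (y ∷ (v ∷ʳ x))                        ≡⟨ alternating-∷ʳ (alternating-tail alt y) x v ⟩
  -1ℤ ℤ.^ n ℤ.* A (y ∷ x ∷ v)             ≡⟨ cong ((-1ℤ ℤ.^ n) ℤ.*_) (s y x v) ⟩
  -1ℤ ℤ.^ n ℤ.* ℤ.- A (x ∷ y ∷ v)         ≡⟨ rearrange (-1ℤ ℤ.^ n) (A (x ∷ y ∷ v)) ⟩
  -1ℤ ℤ.* -1ℤ ℤ.^ n ℤ.* A (x ∷ y ∷ v)     ∎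
  where
  open ≡-Reasoning
  rearrange : ∀ a b → a ℤ.* ℤ.- b ≡ -1ℤ ℤ.* a ℤ.* b
  rearrange = ℤ-Solver.solve-∀

-- Equals (-1)^(n(n-1)/2), the sign of the permutation that reverses n entries.
reversalSign : ℕ → ℤ
reversalSign zero    = 1ℤ
reversalSign (suc n) = -1ℤ ℤ.^ n ℤ.* reversalSign n

alternating-reverse : ∀ {n} {A : Functional n} → Alternating A → ∀ v →
                      A (Vec.reverse v) ≡ reversalSign n ℤ.* A v
alternating-reverse {A = A} alt [] = sym (ℤₚ.*-identityˡ (A []))
alternating-reverse {suc n} {A = A} alt (x ∷ v) = begin
  A (Vec.reverse (x ∷ v))                        ≡⟨ cong A (Vecₚ.reverse-∷ x v) ⟩
  A (Vec.reverse v ∷ʳ x)                         ≡⟨ alternating-∷ʳ alt x (Vec.reverse v) ⟩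
  -1ℤ ℤ.^ n ℤ.* A (x ∷ Vec.reverse v)            ≡⟨ cong ((-1ℤ ℤ.^ n) ℤ.*_) (alternating-reverse (alternating-tail alt x) v) ⟩
  -1ℤ ℤ.^ n ℤ.* (reversalSign n ℤ.* A (x ∷ v))   ≡⟨ ℤₚ.*-assoc (-1ℤ ℤ.^ n) (reversalSign n) (A (x ∷ v)) ⟨
  reversalSign (suc n) ℤ.* A (x ∷ v)             ∎
  where open ≡-Reasoning

-1^n*-1^n : ∀ n → (-1ℤ ℤ.^ n) ℤ.* (-1ℤ ℤ.^ n) ≡ 1ℤ
-1^n*-1^n zero    = refl
-1^n*-1^n (suc n) = trans (rearrange (-1ℤ ℤ.^ n)) (-1^n*-1^n n)
  where
  rearrange : ∀ a → -1ℤ ℤ.* a ℤ.* (-1ℤ ℤ.* a) ≡ a ℤ.* a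
  rearrange = ℤ-Solver.solve-∀

reversalSign² : ∀ n → reversalSign n ℤ.* reversalSign n ≡ 1ℤ
reversalSign² zero    = refl
reversalSign² (suc n) = trans (rearrange (-1ℤ ℤ.^ n) (reversalSign n)) (cong₂ ℤ._*_ (-1^n*-1^n n) (reversalSign² n))
  where
  rearrange : ∀ a b → a ℤ.* b ℤ.* (a ℤ.* b) ≡ (a ℤ.* a) ℤ.* (b ℤ.* b)
  rearrange = ℤ-Solver.solve-∀

-- Sorting and moving beads.

bind : ∀ {k n} → Polynomial k → (Vec ℕ k → Polynomial n) → Polynomial n
bind p f = concatMap (λ (c , α) → c •ₚ f α) p

eval-bind : ∀ {k n} (F : Functional n) p (f : Vec ℕ k → Polynomial n) →
            eval F (bind p f) ≡ eval (λ α → eval F (f α)) p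
eval-bind F []            f = refl
eval-bind F ((c , α) ∷ p) f =
  trans (eval-++ F (c •ₚ f α) (bind p f)) (cong₂ ℤ._+_ (eval-• F c (f α)) (eval-bind F p f))

-- x^(y ∷ v) sorted as in an alternant, for increasing v; zero if y occurs in v.
sortHead : ∀ {n} → ℕ → Vec ℕ n → Polynomial (suc n)
sortHead y []      = (1ℤ , y ∷ []) ∷ []
sortHead y (z ∷ v) with ℕₚ.<-cmp y z
... | tri< _ _ _ = (1ℤ , y ∷ z ∷ v) ∷ []
... | tri≈ _ _ _ = []
... | tri> _ _ _ = -1ℤ •ₚ mapExponents (z ∷_) (sortHead y v)

eval-sortHead : ∀ {n} {A : Functional (suc n)} → Alternating A → ∀ y v →
                eval A (sortHead y v) ≡ A (y ∷ v)
eval-sortHead {A = A} alt y [] = trans (ℤₚ.+-identityʳ _) (ℤₚ.*-identityˡ (A (y ∷ [])))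
eval-sortHead {A = A} alt@(more s _) y (z ∷ v) with ℕₚ.<-cmp y z
... | tri< _ _ _    = trans (ℤₚ.+-identityʳ _) (ℤₚ.*-identityˡ (A (y ∷ z ∷ v)))
... | tri≈ _ refl _ = sym (self-negative (A (y ∷ y ∷ v)) (s y y v))
  where
  self-negative : ∀ i → i ≡ ℤ.- i → i ≡ 0ℤ
  self-negative (ℤ.+ zero)  e = refl
  self-negative (ℤ.+ suc n) ()
  self-negative (ℤ.-[1+ n ]) ()
... | tri> _ _ _    = begin
  eval A (-1ℤ •ₚ mapExponents (z ∷_) (sortHead y v))   ≡⟨ eval-• A -1ℤ (mapExponents (z ∷_) (sortHead y v)) ⟩
  -1ℤ ℤ.* eval A (mapExponents (z ∷_) (sortHead y v))  ≡⟨ cong (-1ℤ ℤ.*_) (eval-mapExponents A (z ∷_) (sortHead y v)) ⟩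
  -1ℤ ℤ.* eval (A ∘ (z ∷_)) (sortHead y v)             ≡⟨ cong (-1ℤ ℤ.*_) (eval-sortHead (alternating-tail alt z) y v) ⟩
  -1ℤ ℤ.* A (z ∷ y ∷ v)                                ≡⟨ ℤₚ.-1*i≡-i (A (z ∷ y ∷ v)) ⟩
  ℤ.- A (z ∷ y ∷ v)                                    ≡⟨ s y z v ⟨
  A (y ∷ z ∷ v)                                        ∎
  where open ≡-Reasoning

-- Σ_γ x^(v + rγ), sorted as in an alternant. Reading increasing entries as the positions of
-- beads, the lowest bead either stays for good or is moved up by r, past the beads in between.
beadMoves : ℕ → ∀ {n} → Vec ℕ n → ℕ → Polynomial n
beadMoves r []      zero    = (1ℤ , []) ∷ []
beadMoves r []      (suc m) = []
beadMoves r (x ∷ v) zero    = mapExponents (x ∷_) (beadMoves r v zero)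
beadMoves r (x ∷ v) (suc m) =
  mapExponents (x ∷_) (beadMoves r v (suc m)) +ₚ bind (sortHead (x + r) v) (λ w → beadMoves r w m)

eval-beadMoves : ∀ r {n} {A : Functional n} → Alternating A → ∀ v m →
                 eval A (beadMoves r v m) ≡ shiftSum r m A v
eval-beadMoves r {A = A} alt []      zero    = trans (ℤₚ.+-identityʳ _) (ℤₚ.*-identityˡ (A []))
eval-beadMoves r alt []      (suc m) = refl
eval-beadMoves r {A = A} alt (x ∷ v) zero    =
  trans (eval-mapExponents A (x ∷_) (beadMoves r v 0)) (eval-beadMoves r (alternating-tail alt x) v zero)
eval-beadMoves r {A = A} alt (x ∷ v) (suc m) = begin
  eval A (mapExponents (x ∷_) (beadMoves r v (suc m)) +ₚ moved)
    ≡⟨ eval-++ A (mapExponents (x ∷_) (beadMoves r v (suc m))) moved ⟩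
  eval A (mapExponents (x ∷_) (beadMoves r v (suc m))) ℤ.+ eval A moved
    ≡⟨ cong₂ ℤ._+_ (eval-mapExponents A (x ∷_) (beadMoves r v (suc m)))
                   (eval-bind A (sortHead (x + r) v) (λ w → beadMoves r w m)) ⟩
  eval (A ∘ (x ∷_)) (beadMoves r v (suc m)) ℤ.+ eval (λ w → eval A (beadMoves r w m)) (sortHead (x + r) v)
    ≡⟨ cong₂ ℤ._+_ (eval-beadMoves r (alternating-tail alt x) v (suc m))
                   (eval-ext (λ w → eval-beadMoves r alt w m) (sortHead (x + r) v)) ⟩
  shiftSum r (suc m) (A ∘ (x ∷_)) v ℤ.+ eval (shiftSum r m A) (sortHead (x + r) v)
    ≡⟨ cong (λ z → shiftSum r (suc m) (A ∘ (x ∷_)) v ℤ.+ z)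
            (eval-sortHead (shiftSum-alternating r m alt) (x + r) v) ⟩
  shiftSum r (suc m) A (x ∷ v) ∎
  where
  open ≡-Reasoning
  moved = bind (sortHead (x + r) v) (λ w → beadMoves r w m)

-- Walks as the surviving terms.

-- The last index counts the entries that `y` passes. The constructors carry equations instead of
-- sharing indices, so that they can be matched when the vectors are computed, as with `beads`.
data Insert (y : ℕ) : ∀ {n} → Vec ℕ n → Vec ℕ (suc n) → ℕ → Set where
  here  : ∀ {n y′} {v w : Vec ℕ n} → y′ ≡ y → w ≡ v → Insert y v (y′ ∷ w) 0
  there : ∀ {n z z′ q} {v : Vec ℕ n} {w} → z′ ≡ z → Insert y v w q → Insert y (z ∷ v) (z′ ∷ w) (suc q)

-- Move r v w p q: w is v with the entry at index p raised by r, and thereby moved to index q.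
data Move (r : ℕ) : ∀ {n} → Vec ℕ n → Vec ℕ n → ℕ → ℕ → Set where
  here  : ∀ {n x q} {v : Vec ℕ n} {w} → Insert (x + r) v w q → IncreasingFrom (suc x) w → Move r (x ∷ v) w 0 q
  there : ∀ {n x x′ p q} {v w : Vec ℕ n} → x′ ≡ x → Move r v w p q → Move r (x ∷ v) (x′ ∷ w) (suc p) (suc q)

-- Walk r p v m u: m moves lead from v to u, and the indices at which they start weakly increase
-- and are at least p.
data Walk (r : ℕ) : ℕ → ∀ {n} → Vec ℕ n → ℕ → Vec ℕ n → Set where
  done : ∀ {p} → Walk r p [] 0 []
  keep : ∀ {n p x m} {v u : Vec ℕ n} → Walk r p v m u → Walk r (suc p) (x ∷ v) m (x ∷ u)
  stay : ∀ {n x m} {v u : Vec ℕ n} → Walk r 0 v m u → Walk r 0 (x ∷ v) m (x ∷ u)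
  move : ∀ {n x m q} {v : Vec ℕ n} {w u} → Insert (x + r) v w q → IncreasingFrom (suc x) w →
         Walk r 0 w m u → Walk r 0 (x ∷ v) (suc m) u

walkSign : ∀ {r p n m} {v u : Vec ℕ n} → Walk r p v m u → ℤ
walkSign done                   = 1ℤ
walkSign (keep ω)               = walkSign ω
walkSign (stay ω)               = walkSign ω
walkSign (move {q = q} _ _ ω) = -1ℤ ℤ.^ q ℤ.* walkSign ω

insert-≥ : ∀ {y n lo q} {v : Vec ℕ n} {w} → Insert y v w q → IncreasingFrom lo w → lo ≤ y
insert-≥ (here refl refl) (l ∷ _)  = l
insert-≥ (there refl i)   (l ∷ is) = ℕₚ.≤-trans l (ℕₚ.<⇒≤ (insert-≥ i is))

insert-increasing : ∀ {y n lo} {v : Vec ℕ n} → lo ≤ y → IncreasingFrom lo v →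
  sortHead y v ≡ [] ⊎ ∃ λ q → ∃ λ w → Insert y v w q × IncreasingFrom lo w × sortHead y v ≡ (-1ℤ ℤ.^ q , w) ∷ []
insert-increasing {y} {v = []}    lo≤y [] = inj₂ (0 , y ∷ [] , here refl refl , lo≤y ∷ [] , refl)
insert-increasing {y} {v = z ∷ v} lo≤y (lo≤z ∷ is) with ℕₚ.<-cmp y z
... | tri< y<z _ _ = inj₂ (0 , y ∷ z ∷ v , here refl refl , lo≤y ∷ y<z ∷ is , refl)
... | tri≈ _ _ _   = inj₁ refl
... | tri> _ _ z<y with insert-increasing z<y is
...   | inj₁ e                    = inj₁ (cong (λ p → -1ℤ •ₚ mapExponents (z ∷_) p) e)
...   | inj₂ (q , w , i , is′ , e) =
  inj₂ (suc q , z ∷ w , there refl i , lo≤z ∷ is′ , cong (λ p → -1ℤ •ₚ mapExponents (z ∷_) p) e)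

sortHead-insert : ∀ {y n lo q} {v : Vec ℕ n} {w} → Insert y v w q → IncreasingFrom lo w →
                  sortHead y v ≡ (-1ℤ ℤ.^ q , w) ∷ []
sortHead-insert {v = []}    (here refl refl) is = refl
sortHead-insert {y} {v = z ∷ v} (here refl refl) (_ ∷ y<z ∷ is) with ℕₚ.<-cmp y z
... | tri< _ _ _    = refl
... | tri≈ y≮z _ _  = contradiction y<z y≮z
... | tri> y≮z _ _  = contradiction y<z y≮z
sortHead-insert {y} {v = z ∷ v} (there refl i) (_ ∷ is) with ℕₚ.<-cmp y z
... | tri< _ _ y≯z  = contradiction (insert-≥ i is) y≯z
... | tri≈ _ _ y≯z  = contradiction (insert-≥ i is) y≯z
... | tri> _ _ _    = cong (λ p → -1ℤ •ₚ mapExponents (z ∷_) p) (sortHead-insert i is)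

coeff-∷-≡ : ∀ {n} x (p : Polynomial n) u → coeff (mapExponents (x ∷_) p) (x ∷ u) ≡ coeff p u
coeff-∷-≡ x []            u = refl
coeff-∷-≡ x ((c , β) ∷ p) u = cong₂ ℤ._+_ (cong (if_then c else 0ℤ) same) (coeff-∷-≡ x p u)
  where
  same : does ((x ∷ β) ≟ᵉ (x ∷ u)) ≡ does (β ≟ᵉ u)
  same = does-⇔ (mk⇔ Vecₚ.∷-injectiveʳ (cong (x ∷_))) ((x ∷ β) ≟ᵉ (x ∷ u)) (β ≟ᵉ u)

coeff-∷-≢ : ∀ {n x y} (p : Polynomial n) u → x ≢ y → coeff (mapExponents (x ∷_) p) (y ∷ u) ≡ 0ℤ
coeff-∷-≢ []            u x≢y = refl
coeff-∷-≢ {x = x} {y} ((c , β) ∷ p) u x≢y = cong₂ ℤ._+_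
  (cong (if_then c else 0ℤ) (dec-false ((x ∷ β) ≟ᵉ (y ∷ u)) (x≢y ∘ Vecₚ.∷-injectiveˡ)))
  (coeff-∷-≢ p u x≢y)

coeff-bind-singleton : ∀ {k n} c (α : Vec ℕ k) (f : Vec ℕ k → Polynomial n) u →
                       coeff (bind ((c , α) ∷ []) f) u ≡ c ℤ.* coeff (f α) u
coeff-bind-singleton c α f u =
  trans (cong (λ p → coeff p u) (Listₚ.++-identityʳ (c •ₚ f α))) (coeff-• c (f α) u)

walk-increasing : ∀ {r n lo m} {v u : Vec ℕ n} → Walk r 0 v m u →
                  IncreasingFrom lo v → IncreasingFrom lo u
walk-increasing done         []       = []
walk-increasing (stay ω)     (l ∷ is) = l ∷ walk-increasing ω is
walk-increasing (move _ j ω) (l ∷ _)  = walk-increasing ω (increasing-≤ (ℕₚ.m≤n⇒m≤1+n l) j)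

coeff-+-⊎ : ∀ {n} {W : Set} (p q : Polynomial n) u → coeff p u ≡ 0ℤ ⊎ W → coeff q u ≡ 0ℤ ⊎ W →
            coeff (p +ₚ q) u ≡ 0ℤ ⊎ W
coeff-+-⊎ p q u (inj₂ ω) _        = inj₂ ω
coeff-+-⊎ p q u (inj₁ _) (inj₂ ω) = inj₂ ω
coeff-+-⊎ p q u (inj₁ e) (inj₁ f) = inj₁ (trans (coeff-++ p q u) (cong₂ ℤ._+_ e f))

module _ {r} (0<r : 0 < r) where

  -- Follows the recursion of `beadMoves`: a contribution is zero when the head does not match or
  -- the landing position is occupied, and otherwise extends to a walk. `coeff-walk` evaluates the
  -- second alternative.
  findWalk : ∀ {n lo} {v : Vec ℕ n} m u → IncreasingFrom lo v →
             coeff (beadMoves r v m) u ≡ 0ℤ ⊎ Walk r 0 v m u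
  findStay : ∀ {n} {v : Vec ℕ n} {x} m y u → IncreasingFrom (suc x) v →
             coeff (mapExponents (x ∷_) (beadMoves r v m)) (y ∷ u) ≡ 0ℤ ⊎ Walk r 0 (x ∷ v) m (y ∷ u)
  findMove : ∀ {n} {v : Vec ℕ n} {x} m u → IncreasingFrom (suc x) v →
             coeff (bind (sortHead (x + r) v) (λ w → beadMoves r w m)) u ≡ 0ℤ ⊎ Walk r 0 (x ∷ v) (suc m) u

  findWalk zero    [] []       = inj₂ done
  findWalk (suc m) [] []       = inj₁ refl
  findWalk zero    (y ∷ u) (l ∷ is) = findStay zero y u is
  findWalk {v = x ∷ v} (suc m) (y ∷ u) (l ∷ is) =
    coeff-+-⊎ (mapExponents (x ∷_) (beadMoves r v (suc m))) (bind (sortHead (x + r) v) (λ w → beadMoves r w m))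
              (y ∷ u) (findStay (suc m) y u is) (findMove m (y ∷ u) is)

  findStay {v = v} {x} m y u is with x ℕ.≟ y
  ... | no x≢y   = inj₁ (coeff-∷-≢ (beadMoves r v m) u x≢y)
  ... | yes refl with findWalk m u is
  ...   | inj₁ e = inj₁ (trans (coeff-∷-≡ x (beadMoves r v m) u) e)
  ...   | inj₂ ω = inj₂ (stay ω)

  findMove {v = v} {x} m u is with insert-increasing (ℕₚ.m<m+n x 0<r) is
  ... | inj₁ e = inj₁ (cong (λ p → coeff (bind p (λ w → beadMoves r w m)) u) e)
  ... | inj₂ (q , w , i , is′ , e) with findWalk m u is′
  ...   | inj₂ ω = inj₂ (move i is′ ω)
  ...   | inj₁ f = inj₁ (trans (cong (λ p → coeff (bind p (λ w → beadMoves r w m)) u) e)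
                  (trans (coeff-bind-singleton (-1ℤ ℤ.^ q) w (λ w → beadMoves r w m) u)
                  (trans (cong ((-1ℤ ℤ.^ q) ℤ.*_) f) (ℤₚ.*-zeroʳ (-1ℤ ℤ.^ q)))))

  coeff-below : ∀ {n x} {v : Vec ℕ (suc n)} m u → IncreasingFrom (suc x) v →
                coeff (beadMoves r v m) (x ∷ u) ≡ 0ℤ
  coeff-below m u is with findWalk m (_ ∷ u) is
  ... | inj₁ e = e
  ... | inj₂ ω with walk-increasing ω is
  ...   | x<x ∷ _ = contradiction x<x (ℕₚ.<-irrefl refl)

  -- The two summands of `beadMoves` never meet: if the lowest bead stays, the target begins with
  -- `x`; once it has moved, all entries of the target exceed `x`. So the branch that `ω` does not
  -- take contributes zero, and all walks with the same ends have the same sign.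
  coeff-walk : ∀ {n lo m} {v u : Vec ℕ n} (ω : Walk r 0 v m u) → IncreasingFrom lo v →
               coeff (beadMoves r v m) u ≡ walkSign ω
  coeff-walk done     [] = refl
  coeff-walk (stay {x = x} {zero} {v} {u} ω) (_ ∷ is) =
    trans (coeff-∷-≡ x (beadMoves r v zero) u) (coeff-walk ω is)
  coeff-walk (stay {x = x} {suc m} {v} {u} ω) (_ ∷ is) = begin
    coeff (mapExponents (x ∷_) (beadMoves r v (suc m)) +ₚ bind (sortHead (x + r) v) f) (x ∷ u)
      ≡⟨ coeff-++ (mapExponents (x ∷_) (beadMoves r v (suc m))) _ (x ∷ u) ⟩
    coeff (mapExponents (x ∷_) (beadMoves r v (suc m))) (x ∷ u) ℤ.+ coeff (bind (sortHead (x + r) v) f) (x ∷ u)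
      ≡⟨ cong₂ ℤ._+_ (trans (coeff-∷-≡ x (beadMoves r v (suc m)) u) (coeff-walk ω is)) unmoved ⟩
    walkSign ω ℤ.+ 0ℤ
      ≡⟨ ℤₚ.+-identityʳ _ ⟩
    walkSign ω ∎
    where
    open ≡-Reasoning
    f : Vec ℕ _ → Polynomial _
    f w = beadMoves r w m
    unmoved : coeff (bind (sortHead (x + r) v) f) (x ∷ u) ≡ 0ℤ
    unmoved with insert-increasing (ℕₚ.m<m+n x 0<r) is
    ... | inj₁ e = cong (λ p → coeff (bind p f) (x ∷ u)) e
    ... | inj₂ (q , w , _ , is′ , e) = trans (cong (λ p → coeff (bind p f) (x ∷ u)) e)
      (trans (coeff-bind-singleton (-1ℤ ℤ.^ q) w f (x ∷ u))
      (trans (cong ((-1ℤ ℤ.^ q) ℤ.*_) (coeff-below m u is′)) (ℤₚ.*-zeroʳ (-1ℤ ℤ.^ q))))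
  coeff-walk (move {x = x} {m} {q} {v} {w} {y ∷ u} i is ω) _ = begin
    coeff (mapExponents (x ∷_) (beadMoves r v (suc m)) +ₚ bind (sortHead (x + r) v) f) (y ∷ u)
      ≡⟨ coeff-++ (mapExponents (x ∷_) (beadMoves r v (suc m))) _ (y ∷ u) ⟩
    coeff (mapExponents (x ∷_) (beadMoves r v (suc m))) (y ∷ u) ℤ.+ coeff (bind (sortHead (x + r) v) f) (y ∷ u)
      ≡⟨ cong₂ ℤ._+_ (coeff-∷-≢ (beadMoves r v (suc m)) u (ℕₚ.<⇒≢ (x<y (walk-increasing ω is))))
                     (cong (λ p → coeff (bind p f) (y ∷ u)) (sortHead-insert i is)) ⟩
    0ℤ ℤ.+ coeff (bind ((-1ℤ ℤ.^ q , w) ∷ []) f) (y ∷ u)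
      ≡⟨ ℤₚ.+-identityˡ _ ⟩
    coeff (bind ((-1ℤ ℤ.^ q , w) ∷ []) f) (y ∷ u)
      ≡⟨ coeff-bind-singleton (-1ℤ ℤ.^ q) w f (y ∷ u) ⟩
    -1ℤ ℤ.^ q ℤ.* coeff (beadMoves r w m) (y ∷ u)
      ≡⟨ cong ((-1ℤ ℤ.^ q) ℤ.*_) (coeff-walk ω is) ⟩
    -1ℤ ℤ.^ q ℤ.* walkSign ω ∎
    where
    open ≡-Reasoning
    f : Vec ℕ _ → Polynomial _
    f w = beadMoves r w m
    x<y : IncreasingFrom (suc x) (y ∷ u) → x < y
    x<y (l ∷ _) = l

-- Composing walks from moves and taking them apart.

move-increasing : ∀ {r n lo p q} {v w : Vec ℕ n} → Move r v w p q → IncreasingFrom lo v → IncreasingFrom lo w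
move-increasing (here _ is)    (l ∷ _)  = increasing-≤ (ℕₚ.m≤n⇒m≤1+n l) is
move-increasing (there refl a) (l ∷ is) = l ∷ move-increasing a is

walk-refl : ∀ {r} p {n} (v : Vec ℕ n) → Σ (Walk r p v 0 v) λ ω → walkSign ω ≡ 1ℤ
walk-refl p       []      = done , refl
walk-refl zero    (x ∷ v) = let ω′ , e = walk-refl zero v in stay ω′ , e
walk-refl (suc p) (x ∷ v) = let ω′ , e = walk-refl p v in keep ω′ , e

walk-weaken : ∀ {r p p′ n m} {v u : Vec ℕ n} → p ≤ p′ → (ω : Walk r p′ v m u) →
              Σ (Walk r p v m u) λ ω′ → walkSign ω′ ≡ walkSign ω
walk-weaken z≤n      done         = done , refl
walk-weaken z≤n      (keep ω)     = let ω′ , e = walk-weaken z≤n ω in stay ω′ , e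
walk-weaken z≤n      (stay ω)     = stay ω , refl
walk-weaken z≤n      (move i j ω) = move i j ω , refl
walk-weaken (s≤s le) done         = done , refl
walk-weaken (s≤s le) (keep ω)     = let ω′ , e = walk-weaken le ω in keep ω′ , e

-- A bead going from index `p` to index `q` passes `q ∸ p` others, whence the exponent. The bound
-- `p` on `ω` fixes all beads below the moved one, so they can be skipped by `keep`.
_◅ʷ_ : ∀ {r p q n m} {v w u : Vec ℕ n} → Move r v w p q → (ω : Walk r p w m u) →
       Σ (Walk r p v (suc m) u) λ ω′ → walkSign ω′ ≡ -1ℤ ℤ.^ (q ∸ p) ℤ.* walkSign ω
here i is    ◅ʷ ω        = move i is ω , refl
there refl a ◅ʷ (keep ω) = let ω′ , e = a ◅ʷ ω in keep ω′ , e

-- Beads that stay below the first moved one are frozen: each `stay` becomes a `keep`, which records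
-- that later moves start at `p′` or higher.
firstMove : ∀ {r p n m} {v u : Vec ℕ n} (ω : Walk r p v (suc m) u) →
  ∃ λ w → ∃ λ p′ → ∃ λ q → Move r v w p′ q × p ≤ p′ ×
  Σ (Walk r p′ w m u) λ ω′ → walkSign ω ≡ -1ℤ ℤ.^ (q ∸ p′) ℤ.* walkSign ω′
firstMove (keep ω) with firstMove ω
... | w , p′ , q , a , le , ω′ , e = _ , suc p′ , suc q , there refl a , s≤s le , keep ω′ , e
firstMove (stay ω) with firstMove ω
... | w , p′ , q , a , le , ω′ , e = _ , suc p′ , suc q , there refl a , z≤n , keep ω′ , e
firstMove (move {q = q} {w = w} i is ω) = w , 0 , q , here i is , z≤n , ω , refl

walk-0 : ∀ {r p n} {v u : Vec ℕ n} (ω : Walk r p v 0 u) → v ≡ u × walkSign ω ≡ 1ℤ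
walk-0 done     = refl , refl
walk-0 (keep ω) = map₁ (cong (_ ∷_)) (walk-0 ω)
walk-0 (stay ω) = map₁ (cong (_ ∷_)) (walk-0 ω)

-- Start and end indices of consecutive moves.

insert-insert-< : ∀ {y y′ n lo q q′} {v : Vec ℕ n} {w z} → Insert y v w q → Insert y′ w z q′ →
                  y < y′ → IncreasingFrom lo z → q < q′
insert-insert-< i              (here refl refl) y<y′ (_ ∷ is) = contradiction y<y′ (ℕₚ.<⇒≯ (insert-≥ i is))
insert-insert-< (here _ _)     (there refl j)   y<y′ is       = z<s
insert-insert-< (there refl i) (there refl j)   y<y′ (_ ∷ is) = s≤s (insert-insert-< i j y<y′ is)

insert-insert-≥ : ∀ {y y′ n lo q q′} {v : Vec ℕ n} {w z} → Insert y′ v w q → Insert y w z q′ →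
                  y < y′ → IncreasingFrom lo z → q′ ≤ q
insert-insert-≥ i                (here _ _)     y<y′ is       = z≤n
insert-insert-≥ (here refl refl) (there refl j) y<y′ (_ ∷ is) = contradiction y<y′ (ℕₚ.<⇒≯ (insert-≥ j is))
insert-insert-≥ (there refl i)   (there refl j) y<y′ (_ ∷ is) = s≤s (insert-insert-≥ i j y<y′ is)

-- All entries of `w` are at least `k`, so a bead moved in `w` lands at `k + r` or above, beyond
-- `y`, and cannot end at a lower index. `move-insert-≤` uses the same bound with the two operations
-- in the other order.
insert-move-≤ : ∀ {r y n k lo q p′ q′} {v : Vec ℕ n} {w z} → Insert y v w q → Move r w z p′ q′ →
                IncreasingFrom k w → y < k + r → IncreasingFrom lo z → q ≤ q′
insert-move-≤ (here _ _)         b              is       y< js       = z≤n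
insert-move-≤ {r} (there refl i) (here j _)     (l ∷ _)  y< js       =
  insert-insert-< i j (ℕₚ.<-≤-trans y< (ℕₚ.+-monoˡ-≤ r l)) js
insert-move-≤ {r} (there refl i) (there refl b) (l ∷ is) y< (_ ∷ js) =
  s≤s (insert-move-≤ i b is (ℕₚ.<-≤-trans y< (ℕₚ.+-monoˡ-≤ r (ℕₚ.m≤n⇒m≤1+n l))) js)

move-insert-≤ : ∀ {r y n k lo p q q′} {v w : Vec ℕ n} {z} → Move r v w p q → Insert y w z q′ →
                IncreasingFrom k v → y < k + r → IncreasingFrom lo z → q′ ≤ q
move-insert-≤ {r} (here i _)     j              (l ∷ _)  y< js       =
  insert-insert-≥ i j (ℕₚ.<-≤-trans y< (ℕₚ.+-monoˡ-≤ r l)) js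
move-insert-≤     (there refl a) (here _ _)     is       y< js       = z≤n
move-insert-≤ {r} (there refl a) (there refl j) (l ∷ is) y< (_ ∷ js) =
  s≤s (move-insert-≤ a j is (ℕₚ.<-≤-trans y< (ℕₚ.+-monoˡ-≤ r (ℕₚ.m≤n⇒m≤1+n l))) js)

-- With move-move-≥: the tops along a chain of border strips weakly decrease exactly when the
-- bottoms do, since bottoms and tops are start and end indices counted from the other side.
move-move-≤ : ∀ {r n lo p q p′ q′} {v w z : Vec ℕ n} → Move r v w p q → Move r w z p′ q′ →
              IncreasingFrom lo z → p ≤ p′ → q ≤ q′
move-move-≤ (here i is)    b              js       le       = insert-move-≤ i b is ℕₚ.≤-refl js
move-move-≤ (there refl a) (there refl b) (_ ∷ js) (s≤s le) = s≤s (move-move-≤ a b js le)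

move-move-≥ : ∀ {r n lo p q p′ q′} {v w z : Vec ℕ n} → Move r v w p q → Move r w z p′ q′ →
              IncreasingFrom lo v → IncreasingFrom lo z → q ≤ q′ → p ≤ p′
move-move-≥ (here _ _)     b              is       js       le       = z≤n
-- Here the second move takes a bead lying below the first one; it lands lower and so ends at a
-- smaller index, against `le`.
move-move-≥ (there refl a) (here j _)     (_ ∷ is) js       le       =
  contradiction (move-insert-≤ a j is ℕₚ.≤-refl js) (ℕₚ.<⇒≱ le)
move-move-≥ (there refl a) (there refl b) (l ∷ is) (_ ∷ js) (s≤s le) =
  s≤s (move-move-≥ a b is (js) le)

-- Partitions and their beads.

-- Lists rows n, ..., 1, so that the lowest row is the head and a weakly decreasing `f` gives
-- increasing entries. `s` is the offset of row n; for `s` = 0 these are the entries of λ + δ in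
-- reverse.
beads : (ℕ → ℕ) → ℕ → ∀ n → Vec ℕ n
beads f s zero    = []
beads f s (suc n) = f (suc n) + s ∷ beads f (suc s) n

beads-cong : ∀ {f g} s n → (∀ i → 1 ≤ i → i ≤ n → f i ≡ g i) → beads f s n ≡ beads g s n
beads-cong s zero    e = refl
beads-cong s (suc n) e = cong₂ _∷_ (cong (_+ s) (e (suc n) z<s ℕₚ.≤-refl))
  (beads-cong (suc s) n (λ i 1≤i i≤n → e i 1≤i (ℕₚ.m≤n⇒m≤1+n i≤n)))

beads-injective : ∀ {f g} s n → beads f s n ≡ beads g s n → ∀ i → 1 ≤ i → i ≤ n → f i ≡ g i
beads-injective s zero    e i 1≤i i≤0 = contradiction (ℕₚ.≤-trans 1≤i i≤0) (λ ())
beads-injective {f} {g} s (suc n) e i 1≤i i≤1+n with ℕₚ.m≤n⇒m<n∨m≡n i≤1+n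
... | inj₁ (s≤s i≤n) = beads-injective (suc s) n (Vecₚ.∷-injectiveʳ e) i 1≤i i≤n
... | inj₂ refl      = ℕₚ.+-cancelʳ-≡ s (f i) (g i) (Vecₚ.∷-injectiveˡ e)

entry-antitone : ∀ {xs} → Linked _≥_ xs → ∀ i → entry xs (suc i) ≤ entry xs i
entry-antitone []       i       = z≤n
entry-antitone [-]      i       = z≤n
entry-antitone (x≥y ∷ l) zero    = x≥y
entry-antitone (x≥y ∷ l) (suc i) = entry-antitone l i

part-antitone : ∀ lam i → part lam (suc (suc i)) ≤ part lam (suc i)
part-antitone lam = entry-antitone (nonIncreasing lam)

entry-beyond : ∀ xs {i} → length xs ≤ i → entry xs i ≡ 0
entry-beyond []       le       = refl
entry-beyond (x ∷ xs) (s≤s le) = entry-beyond xs le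

part-beyond : ∀ lam {i} → ℓ lam < i → part lam i ≡ 0
part-beyond lam (s≤s le) = entry-beyond (parts lam) le

part>0⇒≤ℓ : ∀ lam {i} → 0 < part lam i → i ≤ ℓ lam
part>0⇒≤ℓ lam {i} 0<p = ℕₚ.≮⇒≥ (λ ℓ<i → ℕₚ.<⇒≢ 0<p (sym (part-beyond lam ℓ<i)))

entry-positive : ∀ {xs i} → All (0 <_) xs → i < length xs → 0 < entry xs i
entry-positive {i = zero}  (0<x ∷ _) _        = 0<x
entry-positive {i = suc i} (_ ∷ ps)  (s≤s lt) = entry-positive ps lt

beads-above : ∀ lam s n → IncreasingFrom (suc (part lam (suc n) + s)) (beads (part lam) (suc s) n)
beads-above lam s zero    = []
beads-above lam s (suc n) =
  ℕₚ.≤-trans (ℕₚ.≤-reflexive (sym (ℕₚ.+-suc _ s))) (ℕₚ.+-monoˡ-≤ (suc s) (part-antitone lam n)) ∷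
  beads-above lam (suc s) n

beads-increasing : ∀ lam {lo} s n → lo ≤ s → IncreasingFrom lo (beads (part lam) s n)
beads-increasing lam s zero    le = []
beads-increasing lam s (suc n) le = ℕₚ.≤-trans le (ℕₚ.m≤n+m s _) ∷ beads-above lam s n

rowSum : (ℕ → ℕ) → ℕ → ℕ
rowSum f zero    = 0
rowSum f (suc n) = f (suc n) + rowSum f n

rowSum-front : ∀ f n → rowSum f (suc n) ≡ f 1 + rowSum (f ∘ suc) n
rowSum-front f zero    = refl
rowSum-front f (suc n) = trans (cong (f (2 + n) +_) (rowSum-front f n))
  (exchange (f (2 + n)) (f 1) (rowSum (f ∘ suc) n))
  where
  exchange : ∀ a b c → a + (b + c) ≡ b + (a + c)
  exchange a b c = trans (sym (ℕₚ.+-assoc a b c)) (trans (cong (_+ c) (ℕₚ.+-comm a b)) (ℕₚ.+-assoc b a c))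

rowSum-zero : ∀ f n → (∀ i → f i ≡ 0) → rowSum f n ≡ 0
rowSum-zero f zero    e = refl
rowSum-zero f (suc n) e = cong₂ _+_ (e (suc n)) (rowSum-zero f n e)

sum-rowSum : ∀ xs {n} (f : ℕ → ℕ) → (∀ i → f (suc i) ≡ entry xs i) → length xs ≤ n → sum xs ≡ rowSum f n
sum-rowSum []       {zero}  f e le       = refl
sum-rowSum []       {suc n} f e le       = cong₂ _+_ (sym (e n)) (sum-rowSum [] {n} f e z≤n)
sum-rowSum (x ∷ xs) {suc n} f e (s≤s le) =
  trans (cong₂ _+_ (sym (e 0)) (sum-rowSum xs (f ∘ suc) (e ∘ suc) le)) (sym (rowSum-front f n))

size-rowSum : ∀ lam {n} → ℓ lam ≤ n → size lam ≡ rowSum (part lam) n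
size-rowSum lam = sum-rowSum (parts lam) (part lam) (λ i → refl)

-- The total of the offsets. It is the same for all partitions, so it cancels when sizes are
-- compared through sums of beads.
triangle : ℕ → ℕ → ℕ
triangle s zero    = 0
triangle s (suc n) = s + triangle (suc s) n

sum-beads : ∀ f s n → Vec.sum (beads f s n) ≡ rowSum f n + triangle s n
sum-beads f s zero    = refl
sum-beads f s (suc n) = trans (cong (f (suc n) + s +_) (sum-beads f (suc s) n))
  (interchange (f (suc n)) s (rowSum f n) (triangle (suc s) n))
  where
  interchange : ∀ a b c d → a + b + (c + d) ≡ a + c + (b + d)
  interchange a b c d = trans (ℕₚ.+-assoc a b (c + d)) (trans (cong (a +_)
    (trans (sym (ℕₚ.+-assoc b c d)) (trans (cong (_+ d) (ℕₚ.+-comm b c)) (ℕₚ.+-assoc c b d))))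
    (sym (ℕₚ.+-assoc a c (b + d))))

entry-ext : ∀ {xs ys} → All (0 <_) xs → All (0 <_) ys → (∀ i → entry xs i ≡ entry ys i) → xs ≡ ys
entry-ext []       []       e = refl
entry-ext []       (p ∷ _)  e = contradiction (e 0) (ℕₚ.<⇒≢ p)
entry-ext (p ∷ _)  []       e = contradiction (sym (e 0)) (ℕₚ.<⇒≢ p)
entry-ext (_ ∷ ps) (_ ∷ qs) e = cong₂ _∷_ (e 0) (entry-ext ps qs (e ∘ suc))

partition-ext : ∀ {lam μ} → (∀ i → part lam (suc i) ≡ part μ (suc i)) → lam ≡ μ
partition-ext {lam} {μ} e = parts-injective (entry-ext (positive lam) (positive μ) e)

beads-partition : ∀ {lam μ N} → ℓ lam ≤ N → ℓ μ ≤ N → beads (part lam) 0 N ≡ beads (part μ) 0 N → lam ≡ μ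
beads-partition {lam} {μ} {N} ℓ≤ ℓ≤′ e = partition-ext λ i → same i (suc i ℕ.≤? N)
  where
  same : ∀ i → Dec (suc i ≤ N) → part lam (suc i) ≡ part μ (suc i)
  same i (yes i<N) = beads-injective 0 N e (suc i) z<s i<N
  same i (no i≮N)  = trans (part-beyond lam (ℕₚ.≤-<-trans ℓ≤ (ℕₚ.≰⇒> i≮N)))
                           (sym (part-beyond μ (ℕₚ.≤-<-trans ℓ≤′ (ℕₚ.≰⇒> i≮N))))

-- The rows of a partition are recovered from its beads from the lowest row upwards; xs holds the
-- rows below those of v.
rows : ∀ {n} s (v : Vec ℕ n) xs → All (0 <_) xs → Linked _≥_ xs → IncreasingFrom (entry xs 0 + s) v →
  ∃ λ γ → ℓ γ ≤ n + length xs × beads (part γ) s n ≡ v × (∀ i → part γ (suc (n + i)) ≡ entry xs i)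
rows s [] xs ps ls [] = mkPartition xs ps ls , ℕₚ.≤-refl , refl , λ i → refl
rows {suc n} s (x ∷ v) xs ps ls (le ∷ is) with ℕₚ.m≤n⇒∃[o]m+o≡n (ℕₚ.≤-trans (ℕₚ.m≤n+m s (entry xs 0)) le)
-- `a` is the length of the row: the position `x` of its bead less the offset `s`. An empty row adds
-- no part.
... | a , refl = row a xs ps ls le is
  where
  row : ∀ a xs → All (0 <_) xs → Linked _≥_ xs → entry xs 0 + s ≤ s + a → IncreasingFrom (suc (s + a)) v →
    ∃ λ γ → ℓ γ ≤ suc n + length xs × beads (part γ) s (suc n) ≡ s + a ∷ v ×
            (∀ i → part γ (suc (suc n + i)) ≡ entry xs i)
  row zero (y ∷ ys) (0<y ∷ _) ls le is =
    contradiction (ℕₚ.+-cancelʳ-≤ s y 0 (ℕₚ.≤-trans le (ℕₚ.≤-reflexive (ℕₚ.+-identityʳ s)))) (ℕₚ.<⇒≱ 0<y)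
  row zero [] ps ls le is
    with rows (suc s) v [] [] [] (subst (λ k → IncreasingFrom k v) (cong suc (ℕₚ.+-identityʳ s)) is)
  ... | γ , ℓ≤ , e , below = γ , ℕₚ.m≤n⇒m≤1+n ℓ≤ ,
    cong₂ _∷_ (trans (cong (_+ s) (trans (cong (part γ ∘ suc) (sym (ℕₚ.+-identityʳ n))) (below 0))) (sym (ℕₚ.+-identityʳ s))) e ,
    λ i → trans (cong (part γ ∘ suc) (sym (ℕₚ.+-suc n i))) (below (suc i))
  row (suc a) xs ps ls le is
    with rows (suc s) v (suc a ∷ xs) (z<s ∷ ps) (link xs ls le)
              (subst (λ k → IncreasingFrom k v) (trans (cong suc (ℕₚ.+-comm s (suc a))) (sym (ℕₚ.+-suc (suc a) s))) is)
    where
    link : ∀ xs → Linked _≥_ xs → entry xs 0 + s ≤ s + suc a → Linked _≥_ (suc a ∷ xs)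
    link []       ls le = [-]
    link (y ∷ ys) ls le =
      ℕₚ.+-cancelʳ-≤ s y (suc a) (ℕₚ.≤-trans le (ℕₚ.≤-reflexive (ℕₚ.+-comm s (suc a)))) ∷ ls
  ... | γ , ℓ≤ , e , below = γ , ℕₚ.≤-trans ℓ≤ (ℕₚ.≤-reflexive (ℕₚ.+-suc n (length xs))) ,
    cong₂ _∷_ (trans (cong (_+ s) (trans (cong (part γ ∘ suc) (sym (ℕₚ.+-identityʳ n))) (below 0))) (ℕₚ.+-comm (suc a) s)) e ,
    λ i → trans (cong (part γ ∘ suc) (sym (ℕₚ.+-suc n i))) (below (suc i))

beads-surjective : ∀ {N} {v : Vec ℕ N} → IncreasingFrom 0 v → ∃ λ γ → ℓ γ ≤ N × beads (part γ) 0 N ≡ v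
beads-surjective {N} {v} is with rows 0 v [] [] [] is
... | γ , ℓ≤ , e , _ = γ , ℕₚ.≤-trans ℓ≤ (ℕₚ.≤-reflexive (ℕₚ.+-identityʳ N)) , e

-- Border strips described by their rows.

-- The rows of lam / μ when it is a border strip with top t and bottom b: along the strip, each row
-- of lam is one longer than the preceding row of μ.
record RowStrip (lam μ : Partition) (t b : ℕ) : Set where
  field
    1≤t     : 1 ≤ t
    t≤b     : t ≤ b
    above   : ∀ i → i < t → part lam i ≡ part μ i
    below   : ∀ i → b < i → part lam i ≡ part μ i
    shifted : ∀ i → t ≤ i → i < b → part lam (suc i) ≡ suc (part μ i)
    grows   : part μ b < part lam b

module _ {lam μ : Partition} where

  skew⁻ : ∀ {i j} → Y[ lam / μ ] (i , j) → 1 ≤ i × part μ i < j × j ≤ part lam i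
  skew⁻ {i} {j} (((1≤i , _) , (1≤j , j≤)) , ∉μ) =
    1≤i , ℕₚ.≰⇒> (λ j≤μ → ∉μ ((1≤i , part>0⇒≤ℓ μ (ℕₚ.≤-trans 1≤j j≤μ)) , (1≤j , j≤μ))) , j≤

  skew⁺ : ∀ {i j} → 1 ≤ i → part μ i < j → j ≤ part lam i → Y[ lam / μ ] (i , j)
  skew⁺ 1≤i μ<j j≤ = ((1≤i , part>0⇒≤ℓ lam (ℕₚ.≤-trans 0<j j≤)) , (0<j , j≤)) , λ { (_ , (_ , j≤μ)) → ℕₚ.<⇒≱ μ<j j≤μ }
    where 0<j = ℕₚ.≤-<-trans z≤n μ<j

  -- A step changes the row by at most one, so a path that gets beyond row `i` contains a vertical
  -- step from row `i` to row `suc i`, within a single column.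
  crossing : ∀ {x y i} → Star (Step Y[ lam / μ ]) x y → proj₁ x ≤ i → i < proj₁ y →
             ∃ λ j → Y[ lam / μ ] (i , j) × Y[ lam / μ ] (suc i , j)
  crossing ε x≤i i<y = contradiction x≤i (ℕₚ.<⇒≱ i<y)
  crossing {a , j} {i = i} (_◅_ {j = a′ , j′} ((p , p′) , adj) path) a≤i i<y with a′ ℕ.≤? i
  ... | yes a′≤i = crossing path a′≤i i<y
  ... | no a′≰i  = j , subst (λ k → Y[ lam / μ ] (k , j)) a≡i p ,
                       subst₂ (λ k l → Y[ lam / μ ] (k , l)) a′≡1+i (sym j≡j′) p′
    where
    i<a′ = ℕₚ.≰⇒> a′≰i
    gap : a′ ∸ a + ∣ j - j′ ∣ ≡ 1
    gap = trans (cong (_+ ∣ j - j′ ∣) (sym (ℕₚ.m≤n⇒∣m-n∣≡n∸m (ℕₚ.<⇒≤ (ℕₚ.≤-<-trans a≤i i<a′))))) adj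
    0<gap : 0 < a′ ∸ a
    0<gap = ℕₚ.m<n⇒0<n∸m (ℕₚ.≤-<-trans a≤i i<a′)
    column : ∀ x y → x + y ≡ 1 → 0 < x → x ≡ 1 × y ≡ 0
    column (suc zero) zero e lt = refl , refl
    a′∸a≡1 = proj₁ (column (a′ ∸ a) ∣ j - j′ ∣ gap 0<gap)
    a′≡1+a : a′ ≡ suc a
    a′≡1+a = trans (sym (ℕₚ.m∸n+n≡m (ℕₚ.<⇒≤ (ℕₚ.≤-<-trans a≤i i<a′)))) (cong (_+ a) a′∸a≡1)
    j≡j′ : j ≡ j′
    j≡j′ = ℕₚ.∣m-n∣≡0⇒m≡n (proj₂ (column (a′ ∸ a) ∣ j - j′ ∣ gap 0<gap))
    a≡i : a ≡ i
    a≡i = ℕₚ.≤-antisym a≤i (ℕₚ.≤-pred (ℕₚ.≤-trans i<a′ (ℕₚ.≤-reflexive a′≡1+a)))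
    a′≡1+i : a′ ≡ suc i
    a′≡1+i = trans a′≡1+a (cong suc a≡i)

part-⊆ : ∀ {lam μ} → μ ⊆ lam → ∀ i → part μ i ≤ part lam i
part-⊆ μ⊆lam zero = z≤n
part-⊆ {lam} {μ} μ⊆lam (suc i) with part μ (suc i) in e
... | zero  = z≤n
... | suc k = proj₂ (proj₂ (μ⊆lam {suc i , suc k}
  ((z<s , part>0⇒≤ℓ μ (ℕₚ.≤-trans z<s (ℕₚ.≤-reflexive (sym e)))) , (z<s , ℕₚ.≤-reflexive (sym e)))))

⊆-part : ∀ {lam μ} → (∀ i → part μ i ≤ part lam i) → μ ⊆ lam
⊆-part {lam} le {i , j} ((1≤i , _) , (1≤j , j≤μ)) =
  (1≤i , part>0⇒≤ℓ lam (ℕₚ.≤-trans 1≤j j≤lam)) , (1≤j , j≤lam)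
  where j≤lam = ℕₚ.≤-trans j≤μ (le i)

least : ∀ {P : U.Pred ℕ 0ℓ} → U.Decidable P → ∀ n →
        (∀ i → i < n → P i) ⊎ ∃ λ k → ¬ P k × (∀ i → i < k → P i)
least P? zero = inj₁ λ i ()
least P? (suc n) with least P? n
... | inj₂ found = inj₂ found
... | inj₁ all with P? n
...   | no ¬p = inj₂ (n , ¬p , all)
...   | yes p = inj₁ λ i i<1+n → below i (ℕₚ.m≤n⇒m<n∨m≡n (ℕₚ.≤-pred i<1+n))
  where
  below : ∀ i → i < n ⊎ i ≡ n → _
  below i (inj₁ i<n)  = all i i<n
  below i (inj₂ refl) = p

greatest : ∀ {P : U.Pred ℕ 0ℓ} → U.Decidable P → ∀ n → (∀ i → n ≤ i → P i) →
           (∀ i → P i) ⊎ ∃ λ k → ¬ P k × (∀ i → k < i → P i)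
greatest P? zero    all = inj₁ λ i → all i z≤n
greatest P? (suc n) all with P? n
... | no ¬p = inj₂ (n , ¬p , all)
... | yes p = greatest P? n λ i n≤i → above i (ℕₚ.m≤n⇒m<n∨m≡n n≤i)
  where
  above : ∀ i → n < i ⊎ n ≡ i → _
  above i (inj₁ n<i)  = all i n<i
  above i (inj₂ refl) = p

-- Consecutive rows of the strip share a column because the diagram is connected (`lower`). They
-- share only one, since a second would produce two diagonally adjacent boxes (`upper`).
borderStrip⇒rowStrip : ∀ {r lam μ} → 0 < r → BorderStrip r lam μ → ∃ λ t → ∃ λ b → RowStrip lam μ t b
borderStrip⇒rowStrip {r} {lam} {μ} 0<r S
  with greatest same? (suc (ℓ lam ℕ.⊔ ℓ μ)) (λ i le → trans (part-beyond lam (ℕₚ.≤-<-trans (ℕₚ.m≤m⊔n (ℓ lam) (ℓ μ)) le))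
                                                     (sym (part-beyond μ (ℕₚ.≤-<-trans (ℕₚ.m≤n⊔m (ℓ lam) (ℓ μ)) le))))
  where
  same? : U.Decidable (λ i → part lam i ≡ part μ i)
  same? i = part lam i ℕ.≟ part μ i
... | inj₁ equal = contradiction (trans (sym (cong size (partition-ext {lam} {μ} (equal ∘ suc)))) (BorderStrip.boxes S))
                                 (ℕₚ.<⇒≢ (ℕₚ.m<n+m (size μ) 0<r))
... | inj₂ (b , b≠ , below) with least (λ i → part lam i ℕ.≟ part μ i) (suc b)
...   | inj₁ equal = contradiction (equal b ℕₚ.≤-refl) b≠
...   | inj₂ (t , t≠ , above) = t , b , record
  { 1≤t = 1≤ t≠ ; t≤b = t≤b ; above = above ; below = below ; grows = grow {b} b≠
  ; shifted = λ i t≤i i<b → ℕₚ.≤-antisym (upper i (ℕₚ.≤-trans (1≤ {t} t≠) t≤i)) (lower i t≤i i<b) }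
  where
  open BorderStrip S
  t≤b : t ≤ b
  t≤b = ℕₚ.≮⇒≥ (λ b<t → b≠ (above b b<t))
  1≤ : ∀ {i} → part lam i ≢ part μ i → 1 ≤ i
  1≤ {zero}  ≠ = contradiction refl ≠
  1≤ {suc i} ≠ = z<s
  grow : ∀ {i} → part lam i ≢ part μ i → part μ i < part lam i
  grow {i} ≠ = ℕₚ.≤∧≢⇒< (part-⊆ {lam} {μ} (λ {x} → contained {x}) i) (≠ ∘ sym)
  box : ∀ {i} → part lam i ≢ part μ i → Y[ lam / μ ] (i , part lam i)
  box {i} ≠ = skew⁺ {lam} {μ} (1≤ {i} ≠) (grow {i} ≠) ℕₚ.≤-refl
  lower : ∀ i → t ≤ i → i < b → suc (part μ i) ≤ part lam (suc i)
  lower i t≤i i<b with crossing {lam} {μ} (connected (box {t} t≠) (box {b} b≠)) t≤i i<b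
  ... | j , p , q = ℕₚ.≤-trans (proj₁ (proj₂ (skew⁻ {lam} {μ} p))) (proj₂ (proj₂ (skew⁻ {lam} {μ} q)))
  upper : ∀ i → 1 ≤ i → part lam (suc i) ≤ suc (part μ i)
  upper (suc i) 1≤i = ℕₚ.≮⇒≥ λ long → noSquare
    (skew⁺ {lam} {μ} z<s ℕₚ.≤-refl (ℕₚ.≤-trans (ℕₚ.<⇒≤ long) (part-antitone lam i)))
    (skew⁺ {lam} {μ} z<s (s≤s (ℕₚ.m≤n⇒m≤1+n (part-antitone μ i))) long)

module _ {lam μ t b} (S : RowStrip lam μ t b) where
  open RowStrip S

  rowStrip-≤ : ∀ i → part μ i ≤ part lam i
  rowStrip-≤ i with i ℕ.<? t | ℕₚ.<-cmp i b
  ... | yes i<t | _            = ℕₚ.≤-reflexive (sym (above i i<t))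
  ... | no _    | tri≈ _ refl _ = ℕₚ.<⇒≤ grows
  ... | no _    | tri> _ _ b<i = ℕₚ.≤-reflexive (sym (below i b<i))
  rowStrip-≤ zero    | no _   | tri< _ _ _   = z≤n
  rowStrip-≤ (suc i) | no i≮t | tri< i<b _ _ = ℕₚ.≤-trans (ℕₚ.n≤1+n _)
    (ℕₚ.≤-trans (ℕₚ.≤-reflexive (sym (shifted (suc i) (ℕₚ.≮⇒≥ i≮t) i<b))) (part-antitone lam i))

  rowStrip-≢ : ∀ {i} → part lam i ≢ part μ i → t ≤ i × i ≤ b
  rowStrip-≢ {i} ≠ = ℕₚ.≮⇒≥ (≠ ∘ above i) , ℕₚ.≮⇒≥ (≠ ∘ below i)

  -- Every box is joined to the first box of the bottom row.
  private
    start : Box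
    start = b , suc (part μ b)

    Path : Box → Box → Set
    Path = Star (Step Y[ lam / μ ])

    leftwards : ∀ {i} k → 1 ≤ i → suc (part μ i) + k ≤ part lam i → Path (i , suc (part μ i) + k) (i , suc (part μ i))
    leftwards {i} zero    1≤i le = subst (λ j → Path (i , j) (i , suc (part μ i))) (sym (ℕₚ.+-identityʳ _)) ε
    leftwards {i} (suc k) 1≤i le =
      ((skew⁺ {lam} {μ} 1≤i (ℕₚ.m≤m+n _ _) le , skew⁺ {lam} {μ} 1≤i (ℕₚ.m≤m+n _ k) le′) , adjacent) ◅ leftwards k 1≤i le′
      where
      le′ : suc (part μ i) + k ≤ part lam i
      le′ = ℕₚ.≤-trans (ℕₚ.+-monoʳ-≤ (suc (part μ i)) (ℕₚ.n≤1+n k)) le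
      adjacent : ∣ i - i ∣ + ∣ suc (part μ i) + suc k - suc (part μ i) + k ∣ ≡ 1
      adjacent = cong₂ _+_ (ℕₚ.∣n-n∣≡0 i) (trans (ℕₚ.∣m+n-m+o∣≡∣n-o∣ (suc (part μ i)) (suc k) k) (∣1+k-k∣ k))
        where
        ∣1+k-k∣ : ∀ k → ∣ suc k - k ∣ ≡ 1
        ∣1+k-k∣ zero    = refl
        ∣1+k-k∣ (suc k) = ∣1+k-k∣ k

    rowStart : ∀ {i j} → 1 ≤ i → part μ i < j → j ≤ part lam i → Path (i , j) (i , suc (part μ i))
    rowStart {i} {j} 1≤i μ<j j≤ = subst (λ k → Path (i , k) (i , suc (part μ i))) (ℕₚ.m+[n∸m]≡n μ<j)
      (leftwards (j ∸ suc (part μ i)) 1≤i (ℕₚ.≤-trans (ℕₚ.≤-reflexive (ℕₚ.m+[n∸m]≡n μ<j)) j≤))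

    downwards : ∀ {i} d → d + i ≡ b → t ≤ i → Path (i , suc (part μ i)) start
    downwards {i} zero    refl t≤i = ε
    downwards {i} (suc d) e    t≤i =
      ((skew⁺ {lam} {μ} 1≤i ℕₚ.≤-refl i-grows , next) , adjacent) ◅
      rowStart z<s next-row (ℕₚ.≤-reflexive (sym longer)) ◅◅
      downwards d (trans (ℕₚ.+-suc d i) e) (ℕₚ.m≤n⇒m≤1+n t≤i)
      where
      1≤i = ℕₚ.≤-trans 1≤t t≤i
      i<b : i < b
      i<b = ℕₚ.≤-trans (s≤s (ℕₚ.m≤n+m i d)) (ℕₚ.≤-reflexive e)
      longer : part lam (suc i) ≡ suc (part μ i)
      longer = shifted i t≤i i<b
      antitone : ∀ ν {i} → 1 ≤ i → part ν (suc i) ≤ part ν i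
      antitone ν {suc i} _ = part-antitone ν i
      i-grows : part μ i < part lam i
      i-grows = ℕₚ.≤-trans (ℕₚ.≤-reflexive (sym longer)) (antitone lam 1≤i)
      next-row : suc (part μ (suc i)) ≤ suc (part μ i)
      next-row = s≤s (antitone μ 1≤i)
      next : Y[ lam / μ ] (suc i , suc (part μ i))
      next = skew⁺ {lam} {μ} z<s next-row (ℕₚ.≤-reflexive (sym longer))
      adjacent : ∣ i - suc i ∣ + ∣ suc (part μ i) - suc (part μ i) ∣ ≡ 1
      adjacent = cong₂ _+_ (∣i-1+i∣ i) (ℕₚ.∣n-n∣≡0 (part μ i))
        where
        ∣i-1+i∣ : ∀ i → ∣ i - suc i ∣ ≡ 1
        ∣i-1+i∣ zero    = refl
        ∣i-1+i∣ (suc i) = ∣i-1+i∣ i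

    toStart : ∀ {x} → Y[ lam / μ ] x → Path x start
    toStart {i , j} p with skew⁻ {lam} {μ} p
    ... | 1≤i , μ<j , j≤ with rowStrip-≢ {i} (ℕₚ.<⇒≢ (ℕₚ.<-≤-trans μ<j j≤) ∘ sym)
    ...   | t≤i , i≤b = rowStart 1≤i μ<j j≤ ◅◅ downwards (b ∸ i) (ℕₚ.m∸n+n≡m i≤b) t≤i

    step-sym : ∀ {x y} → Step Y[ lam / μ ] x y → Step Y[ lam / μ ] y x
    step-sym {i , j} {i′ , j′} ((p , q) , adj) =
      (q , p) , trans (cong₂ _+_ (ℕₚ.∣-∣-comm i′ i) (ℕₚ.∣-∣-comm j′ j)) adj

  rowStrip⇒borderStrip : ∀ {r} → size lam ≡ r + size μ → BorderStrip r lam μ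
  rowStrip⇒borderStrip e = record
    { contained = λ {x} → ⊆-part {lam} {μ} rowStrip-≤ {x}
    ; boxes     = e
    ; connected = λ p q → toStart p ◅◅ reverse step-sym (toStart q)
    ; noSquare  = square
    }
    where
    square : ∀ {i j} → Y[ lam / μ ] (i , j) → ¬ Y[ lam / μ ] (suc i , suc j)
    square p q with skew⁻ {lam} {μ} p | skew⁻ {lam} {μ} q
    ... | 1≤i , μ<j , j≤ | _ , μ<1+j , 1+j≤ = ℕₚ.<⇒≱ μ<j (ℕₚ.≤-pred (ℕₚ.≤-trans 1+j≤ (ℕₚ.≤-reflexive
      (shifted _ (proj₁ (rowStrip-≢ (ℕₚ.<⇒≢ (ℕₚ.<-≤-trans μ<j j≤) ∘ sym)))
                 (proj₂ (rowStrip-≢ (ℕₚ.<⇒≢ (ℕₚ.<-≤-trans μ<1+j 1+j≤) ∘ sym)))))))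

-- Border strips as bead moves.

insert-sum : ∀ {y n q} {v : Vec ℕ n} {w} → Insert y v w q → Vec.sum w ≡ y + Vec.sum v
insert-sum (here refl refl) = refl
insert-sum {y} (there {z = z} {v = v} refl i) = trans (cong (z +_) (insert-sum i)) (exchange z y (Vec.sum v))
  where
  exchange : ∀ a b c → a + (b + c) ≡ b + (a + c)
  exchange = ℕ-Solver.solve-∀

move-sum : ∀ {r n p q} {v w : Vec ℕ n} → Move r v w p q → Vec.sum w ≡ r + Vec.sum v
move-sum {r} (here {x = x} {v = v} i _) = trans (insert-sum i) (exchange x r (Vec.sum v))
  where
  exchange : ∀ a b c → a + b + c ≡ b + (a + c)
  exchange = ℕ-Solver.solve-∀
move-sum {r} (there {x = x} {v = v} refl a) = trans (cong (x +_) (move-sum a)) (exchange x r (Vec.sum v))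
  where
  exchange : ∀ a b c → a + (b + c) ≡ b + (a + c)
  exchange = ℕ-Solver.solve-∀

walk-sum : ∀ {r p n m} {v u : Vec ℕ n} → Walk r p v m u → Vec.sum u ≡ m * r + Vec.sum v
walk-sum {m = zero}      ω = cong Vec.sum (sym (proj₁ (walk-0 ω)))
walk-sum {r} {m = suc m} {v} ω with firstMove ω
... | w , _ , _ , a , _ , ω′ , _ =
  trans (walk-sum ω′) (trans (cong (m * r +_) (move-sum a)) (exchange (m * r) r (Vec.sum v)))
  where
  exchange : ∀ a b c → a + (b + c) ≡ b + a + c
  exchange = ℕ-Solver.solve-∀

size-beads : ∀ lam {N} → ℓ lam ≤ N → Vec.sum (beads (part lam) 0 N) ≡ size lam + triangle 0 N
size-beads lam {N} ℓ≤ = trans (sum-beads (part lam) 0 N) (cong (_+ triangle 0 N) (sym (size-rowSum lam ℓ≤)))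

module _ {lam μ t b} (S : RowStrip lam μ t b) where
  open RowStrip S

  private
    rowSum-bottom : ∀ {r} p → rowSum (part lam) (p + b) ≡ r + rowSum (part μ) (p + b) →
                    rowSum (part lam) b ≡ r + rowSum (part μ) b
    rowSum-bottom zero        e = e
    rowSum-bottom {r} (suc p) e = rowSum-bottom p (ℕₚ.+-cancelˡ-≡ (part lam (suc (p + b))) _ _
      (trans e (trans (exchange r (part μ (suc (p + b))) _)
                      (cong (_+ (r + rowSum (part μ) (p + b))) (sym (below (suc (p + b)) (s≤s (ℕₚ.m≤n+m b p))))))))
      where
      exchange : ∀ a b c → a + (b + c) ≡ b + (a + c)
      exchange = ℕ-Solver.solve-∀

    -- In terms of beads, `shifted` says that row i + 1 of `lam` and row i of `μ` have the same
    -- bead. Above the bottom of the strip the two lists therefore differ only by the bead of the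
    -- top row of `lam`, inserted after `d` others.
    insertion : ∀ d s t′ → suc t′ ≡ t → suc (d + t′) ≤ b →
                Insert (part lam t + (d + s)) (beads (part μ) (suc s) (d + t′)) (beads (part lam) s (suc (d + t′))) d
    insertion zero    s t′ refl le = here refl (beads-cong (suc s) t′ (λ i _ i≤t′ → above i (s≤s i≤t′)))
    insertion (suc d) s t′ refl le = there
      (trans (cong (_+ s) (shifted (suc (d + t′)) (s≤s (ℕₚ.m≤n+m t′ d)) le)) (sym (ℕₚ.+-suc (part μ (suc (d + t′))) s)))
      (subst (λ y → Insert y (beads (part μ) (suc (suc s)) (d + t′)) (beads (part lam) (suc s) (suc (d + t′))) d)
        (cong (part lam t +_) (ℕₚ.+-suc d s)) (insertion d (suc s) t′ refl (ℕₚ.≤-trans (ℕₚ.n≤1+n _) le)))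

    move-bottom : ∀ {r} s d t′ → suc t′ ≡ t → suc (d + t′) ≡ b → rowSum (part lam) b ≡ r + rowSum (part μ) b →
                  Move r (beads (part μ) s b) (beads (part lam) s b) 0 d
    move-bottom {r} s d t′ refl refl e =
      here (subst (λ y → Insert y μ-beads (beads (part lam) s b) d) raised ins) (ℕₚ.+-monoˡ-≤ s grows ∷ beads-above lam s (d + t′))
      where
      open ≡-Reasoning
      μ-beads = beads (part μ) (suc s) (d + t′)
      ins : Insert (part lam t + (d + s)) μ-beads (beads (part lam) s b) d
      ins = insertion d s t′ refl ℕₚ.≤-refl
      exchange : ∀ a b c → a + (b + c) ≡ b + a + c
      exchange = ℕ-Solver.solve-∀
      -- All other beads are shared and the row sums differ by `r`, so comparing totals forces the
      -- new bead to lie exactly `r` above the removed one.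
      raised : part lam t + (d + s) ≡ part μ b + s + r
      raised = ℕₚ.+-cancelʳ-≡ (Vec.sum μ-beads) _ _ (begin
        part lam t + (d + s) + Vec.sum μ-beads          ≡⟨ insert-sum ins ⟨
        Vec.sum (beads (part lam) s b)                  ≡⟨ sum-beads (part lam) s b ⟩
        rowSum (part lam) b + triangle s b              ≡⟨ cong (_+ triangle s b) e ⟩
        r + rowSum (part μ) b + triangle s b            ≡⟨ ℕₚ.+-assoc r (rowSum (part μ) b) (triangle s b) ⟩
        r + (rowSum (part μ) b + triangle s b)          ≡⟨ cong (r +_) (sum-beads (part μ) s b) ⟨
        r + (part μ b + s + Vec.sum μ-beads)            ≡⟨ exchange r (part μ b + s) (Vec.sum μ-beads) ⟩
        part μ b + s + r + Vec.sum μ-beads              ∎)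

    move-up : ∀ {r} p s → rowSum (part lam) b ≡ r + rowSum (part μ) b →
              Move r (beads (part μ) s (p + b)) (beads (part lam) s (p + b)) p (p + (b ∸ t))
    move-up zero    s e = move-bottom s (b ∸ t) (ℕ.pred t) suc-pred
      (trans (sym (ℕₚ.+-suc (b ∸ t) (ℕ.pred t))) (trans (cong (b ∸ t +_) suc-pred) (ℕₚ.m∸n+n≡m t≤b))) e
      where suc-pred = ℕₚ.suc-pred t {{ℕ.>-nonZero 1≤t}}
    move-up (suc p) s e = there (cong (_+ s) (below (suc (p + b)) (s≤s (ℕₚ.m≤n+m b p)))) (move-up p (suc s) e)

  rowStrip⇒move : ∀ {r N} → size lam ≡ r + size μ → ℓ lam ≤ N → ℓ μ ≤ N → ∃ λ p → ∃ λ q →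
    Move r (beads (part μ) 0 N) (beads (part lam) 0 N) p q × p + b ≡ N × q + t ≡ N
  -- Row i has index `N ∸ i`, so the bead goes from `N ∸ b` to `N ∸ t`; the latter is written with
  -- `b ∸ t`, the number of beads passed.
  rowStrip⇒move {r} {N} e ℓlam≤ ℓμ≤ = N ∸ b , N ∸ b + (b ∸ t) ,
    subst (λ n → Move r (beads (part μ) 0 n) (beads (part lam) 0 n) (N ∸ b) (N ∸ b + (b ∸ t))) N≡
      (move-up (N ∸ b) 0 (rowSum-bottom (N ∸ b) (subst (λ n → rowSum (part lam) n ≡ r + rowSum (part μ) n) (sym N≡)
        (trans (sym (size-rowSum lam ℓlam≤)) (trans e (cong (r +_) (size-rowSum μ ℓμ≤))))))) ,
    N≡ , trans (ℕₚ.+-assoc (N ∸ b) (b ∸ t) t) (trans (cong (N ∸ b +_) (ℕₚ.m∸n+n≡m t≤b)) N≡)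
    where
    N≡ : N ∸ b + b ≡ N
    N≡ = ℕₚ.m∸n+n≡m (ℕₚ.≤-trans (part>0⇒≤ℓ lam {b} (ℕₚ.≤-<-trans z≤n grows)) ℓlam≤)

module _ (lam μ : Partition) where

  -- Entries passed by the insertion give `shifted`, and the common tail behind it gives equal rows.
  -- `t′` is the last row above the strip: its top is `suc t′` and its bottom `suc n`.
  insert⇒rows : ∀ {y q} s n → Insert y (beads (part μ) (suc s) n) (beads (part lam) s (suc n)) q →
    ∃ λ t′ → q + t′ ≡ n × (∀ i → i ≤ t′ → part lam i ≡ part μ i) ×
             (∀ i → t′ < i → i < suc n → part lam (suc i) ≡ suc (part μ i))
  insert⇒rows s n (here _ e) = n , refl , equal , λ i n<i i≤n → contradiction n<i (ℕₚ.≤⇒≯ (ℕₚ.≤-pred i≤n))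
    where
    equal : ∀ i → i ≤ n → part lam i ≡ part μ i
    equal zero    _   = refl
    equal (suc i) i≤n = beads-injective (suc s) n e (suc i) z<s i≤n
  insert⇒rows s (suc n) (there e i) with insert⇒rows (suc s) n i
  ... | t′ , q+t′≡n , above , shifted = t′ , cong suc q+t′≡n , above , λ i t′<i i≤1+n → from i t′<i (ℕₚ.m≤n⇒m<n∨m≡n (ℕₚ.≤-pred i≤1+n))
    where
    from : ∀ i → t′ < i → i < suc n ⊎ i ≡ suc n → part lam (suc i) ≡ suc (part μ i)
    from i t′<i (inj₁ i<1+n) = shifted i t′<i i<1+n
    from i t′<i (inj₂ refl)  = ℕₚ.+-cancelʳ-≡ s _ _ (trans e (ℕₚ.+-suc (part μ (suc n)) s))

  move⇒rows : ∀ {r p q} s n → (∀ i → n < i → part lam i ≡ part μ i) →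
    Move r (beads (part μ) s n) (beads (part lam) s n) p q →
    ∃ λ t → ∃ λ b → RowStrip lam μ t b × p + b ≡ n × q + t ≡ n
  move⇒rows s (suc n) equal (here {q = q} i (grows ∷ _)) with insert⇒rows s n i
  ... | t′ , q+t′≡n , above , shifted = suc t′ , suc n , record
    { 1≤t = z<s ; t≤b = s≤s (ℕₚ.≤-trans (ℕₚ.m≤n+m t′ q) (ℕₚ.≤-reflexive q+t′≡n))
    ; above = λ i i<t → above i (ℕₚ.≤-pred i<t) ; below = equal ; shifted = shifted
    ; grows = ℕₚ.+-cancelʳ-< s _ _ grows }
    , refl , trans (ℕₚ.+-suc q t′) (cong suc q+t′≡n)
  move⇒rows s (suc n) equal (there e a)
    with move⇒rows (suc s) n (λ i n<i → from i (ℕₚ.m≤n⇒m<n∨m≡n n<i)) a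
    where
    from : ∀ i → suc n < i ⊎ suc n ≡ i → part lam i ≡ part μ i
    from i (inj₁ 1+n<i) = equal i 1+n<i
    from i (inj₂ refl)  = ℕₚ.+-cancelʳ-≡ s _ _ e
  ... | t , b , S , pb , qt = t , b , S , cong suc pb , cong suc qt

  move⇒rowStrip : ∀ {r p q N} → ℓ lam ≤ N → ℓ μ ≤ N → Move r (beads (part μ) 0 N) (beads (part lam) 0 N) p q →
    ∃ λ t → ∃ λ b → RowStrip lam μ t b × p + b ≡ N × q + t ≡ N
  move⇒rowStrip {N = N} ℓlam≤ ℓμ≤ = move⇒rows 0 N λ i N<i →
    trans (part-beyond lam (ℕₚ.≤-<-trans ℓlam≤ N<i)) (sym (part-beyond μ (ℕₚ.≤-<-trans ℓμ≤ N<i)))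

  move⇒size : ∀ {r p q N} → ℓ lam ≤ N → ℓ μ ≤ N → Move r (beads (part μ) 0 N) (beads (part lam) 0 N) p q →
    size lam ≡ r + size μ
  move⇒size {r} {N = N} ℓlam≤ ℓμ≤ a = ℕₚ.+-cancelʳ-≡ (triangle 0 N) _ _ (begin
    size lam + triangle 0 N                  ≡⟨ size-beads lam ℓlam≤ ⟨
    Vec.sum (beads (part lam) 0 N)           ≡⟨ move-sum a ⟩
    r + Vec.sum (beads (part μ) 0 N)         ≡⟨ cong (r +_) (size-beads μ ℓμ≤) ⟩
    r + (size μ + triangle 0 N)              ≡⟨ ℕₚ.+-assoc r (size μ) (triangle 0 N) ⟨
    r + size μ + triangle 0 N                ∎)
    where open ≡-Reasoning

-- Top and bottom of a strip.

head-filter : ∀ {P : U.Pred ℕ 0ℓ} (P? : U.Decidable P) (f : ℕ → ℕ) n {k} → k < n → P (f k) →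
              (∀ i → i < k → ¬ P (f i)) → head (filter P? (applyUpTo f n)) ≡ just (f k)
head-filter P? f (suc n) {zero}  lt pk before = cong head (Listₚ.filter-accept P? pk)
head-filter P? f (suc n) {suc k} (s≤s lt) pk before =
  trans (cong head (Listₚ.filter-reject P? (before 0 z<s)))
        (head-filter P? (f ∘ suc) n lt pk (λ i i<k → before (suc i) (s≤s i<k)))

last-filter : ∀ {P : U.Pred ℕ 0ℓ} (P? : U.Decidable P) (f : ℕ → ℕ) n {k} → k < n → P (f k) →
              (∀ i → k < i → ¬ P (f i)) → last (filter P? (applyUpTo f n)) ≡ just (f k)
last-filter P? f (suc n) {zero}  lt pk after =
  cong last (trans (Listₚ.filter-accept P? pk) (cong (f 0 ∷_) (Listₚ.filter-none P? (none (f ∘ suc) n (λ i → after (suc i) z<s)))))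
  where
  none : ∀ {P : U.Pred ℕ 0ℓ} (f : ℕ → ℕ) n → (∀ i → ¬ P (f i)) → All (¬_ ∘ P) (applyUpTo f n)
  none f zero    ¬p = []
  none f (suc n) ¬p = ¬p 0 ∷ none (f ∘ suc) n (¬p ∘ suc)
last-filter {P} P? f (suc n) {suc k} (s≤s lt) pk after with P? (f 0)
... | yes _ = trans (last-∷ (f 0) (filter P? (applyUpTo (f ∘ suc) n)) rest) rest
  where
  rest = last-filter P? (f ∘ suc) n lt pk (λ i k<i → after (suc i) (s≤s k<i))
  last-∷ : ∀ x {y} (xs : List ℕ) → last xs ≡ just y → last (x ∷ xs) ≡ last xs
  last-∷ x (_ ∷ _) e = refl
... | no _  = last-filter P? (f ∘ suc) n lt pk (λ i k<i → after (suc i) (s≤s k<i))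

module _ {lam μ t b} (S : RowStrip lam μ t b) where
  open RowStrip S

  private
    differ? : U.Decidable (λ i → ¬ (part lam i ≡ part μ i))
    differ? i = ¬? (part lam i ℕ.≟ part μ i)
    pred< : ∀ {k} → 1 ≤ k → part μ k < part lam k → ℕ.pred k < ℓ lam
    pred< {suc k} _ gr = part>0⇒≤ℓ lam (ℕₚ.≤-<-trans z≤n gr)
    suc-pred : ∀ {k} → 1 ≤ k → suc (ℕ.pred k) ≡ k
    suc-pred {suc k} _ = refl
    rows≡ : differingRows lam μ ≡ filter differ? (applyUpTo suc (ℓ lam))
    rows≡ = cong (filter differ?) (Listₚ.map-upTo suc (ℓ lam))
    top-grows : part μ t < part lam t
    top-grows with ℕₚ.m≤n⇒m<n∨m≡n t≤b
    ... | inj₂ refl = grows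
    ... | inj₁ t<b  = ℕₚ.≤-trans (ℕₚ.≤-reflexive (sym (shifted t ℕₚ.≤-refl t<b))) (antitone 1≤t)
      where
      antitone : ∀ {i} → 1 ≤ i → part lam (suc i) ≤ part lam i
      antitone {suc i} _ = part-antitone lam i

  rowStrip-top : top lam μ ≡ t
  rowStrip-top = cong (fromMaybe 0) (trans (cong head rows≡) (trans
    (head-filter differ? suc (ℓ lam) (pred< 1≤t top-grows)
      (subst (λ i → part lam i ≢ part μ i) (sym (suc-pred 1≤t)) (ℕₚ.<⇒≢ top-grows ∘ sym))
      (λ i i<k ≠ → ≠ (above (suc i) (ℕₚ.≤-trans (s≤s i<k) (ℕₚ.≤-reflexive (suc-pred 1≤t))))))
    (cong just (suc-pred 1≤t))))

  rowStrip-bottom : bottom lam μ ≡ b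
  rowStrip-bottom = cong (fromMaybe 0) (trans (cong last rows≡) (trans
    (last-filter differ? suc (ℓ lam) (pred< 1≤b grows)
      (subst (λ i → part lam i ≢ part μ i) (sym (suc-pred 1≤b)) (ℕₚ.<⇒≢ grows ∘ sym))
      (λ i k<i ≠ → ≠ (below (suc i) (ℕₚ.≤-trans (s≤s (ℕₚ.≤-reflexive (sym (suc-pred 1≤b)))) (s≤s k<i)))))
    (cong just (suc-pred 1≤b))))
    where 1≤b = ℕₚ.≤-trans 1≤t t≤b

-- Chains of border strips and walks.

ℓ-⊆ : ∀ {lam μ} → μ ⊆ lam → ℓ μ ≤ ℓ lam
ℓ-⊆ {lam} {μ} μ⊆lam = bound (ℓ μ) ℕₚ.≤-refl
  where
  bound : ∀ k → k ≤ ℓ μ → k ≤ ℓ lam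
  bound zero    _   = z≤n
  bound (suc k) k<ℓ = part>0⇒≤ℓ lam {suc k}
    (ℕₚ.<-≤-trans (entry-positive (positive μ) k<ℓ) (part-⊆ {lam} {μ} (λ {x} → μ⊆lam {x}) (suc k)))

chain-≤ : ∀ {r μ lam} → Chain r μ lam → ∀ i → part μ i ≤ part lam i
chain-≤ ε i = ℕₚ.≤-refl
chain-≤ {μ = μ} (_◅_ {j = γ} strip c) i =
  ℕₚ.≤-trans (part-⊆ {γ} {μ} (λ {x} → BorderStrip.contained strip {x}) i) (chain-≤ c i)

chain-⊆ : ∀ {r μ lam} → Chain r μ lam → μ ⊆ lam
chain-⊆ {μ = μ} {lam} c {x} = ⊆-part {lam} {μ} (chain-≤ c) {x}

steps : ∀ {r μ lam} → Chain r μ lam → ℕ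
steps ε       = 0
steps (_ ◅ c) = suc (steps c)

module _ {r} (0<r : 0 < r) (N : ℕ) where

  private
    bs : Partition → Vec ℕ N
    bs lam = beads (part lam) 0 N

    bs-increasing : ∀ lam → IncreasingFrom 0 (bs lam)
    bs-increasing lam = beads-increasing lam 0 N z≤n

  rowStrip-sgn : ∀ {lam μ t b p q} → RowStrip lam μ t b → p + b ≡ N → q + t ≡ N →
                 sgn lam μ ≡ -1ℤ ℤ.^ (q ∸ p)
  rowStrip-sgn {lam} {μ} {t} {b} {p} {q} S pb qt = cong (-1ℤ ℤ.^_) (begin
    bottom lam μ ∸ top lam μ   ≡⟨ cong₂ _∸_ (rowStrip-bottom S) (rowStrip-top S) ⟩
    b ∸ t                      ≡⟨ ℕₚ.m+n∸m≡n p (b ∸ t) ⟨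
    p + (b ∸ t) ∸ p            ≡⟨ cong (_∸ p) (ℕₚ.+-cancelʳ-≡ t (p + (b ∸ t)) q (begin
      p + (b ∸ t) + t    ≡⟨ ℕₚ.+-assoc p (b ∸ t) t ⟩
      p + (b ∸ t + t)    ≡⟨ cong (p +_) (ℕₚ.m∸n+n≡m (RowStrip.t≤b S)) ⟩
      p + b              ≡⟨ trans pb (sym qt) ⟩
      q + t              ∎)) ⟩
    q ∸ p                      ∎)
    where open ≡-Reasoning

  strip⇒move : ∀ {lam μ} → BorderStrip r lam μ → ℓ lam ≤ N →
    ∃ λ p → ∃ λ q → Move r (bs μ) (bs lam) p q × q + top lam μ ≡ N × sgn lam μ ≡ -1ℤ ℤ.^ (q ∸ p)
  strip⇒move {lam} {μ} strip ℓ≤ with borderStrip⇒rowStrip 0<r strip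
  ... | t , b , S with rowStrip⇒move S (BorderStrip.boxes strip) ℓ≤
                         (ℕₚ.≤-trans (ℓ-⊆ {lam} {μ} (λ {x} → BorderStrip.contained strip {x})) ℓ≤)
  ...   | p , q , a , pb , qt = p , q , a , trans (cong (q +_) (rowStrip-top S)) qt , rowStrip-sgn S pb qt

  move⇒strip : ∀ {lam μ p q} → ℓ lam ≤ N → ℓ μ ≤ N → Move r (bs μ) (bs lam) p q →
    BorderStrip r lam μ × q + top lam μ ≡ N × sgn lam μ ≡ -1ℤ ℤ.^ (q ∸ p)
  move⇒strip {lam} {μ} {q = q} ℓlam≤ ℓμ≤ a with move⇒rowStrip lam μ ℓlam≤ ℓμ≤ a
  ... | t , b , S , pb , qt = rowStrip⇒borderStrip S (move⇒size lam μ ℓlam≤ ℓμ≤ a) ,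
                              trans (cong (q +_) (rowStrip-top S)) qt , rowStrip-sgn S pb qt

  -- A strip in a chain does not carry the indices of its move, so the bound is required of every
  -- move between the two bead vectors.
  FirstIndex≥ : ∀ {μ lam} → ℕ → Chain r μ lam → Set
  FirstIndex≥ p ε = ⊤
  FirstIndex≥ p (_◅_ {γ} {γ′} _ _) = ∀ p′ q → Move r (bs γ) (bs γ′) p′ q → p ≤ p′

  complement-≤ : ∀ {q q′ t t′} → q + t ≡ N → q′ + t′ ≡ N → t′ ≤ t → q ≤ q′
  complement-≤ {q} {q′} {t} {t′} e e′ le = ℕₚ.+-cancelʳ-≤ t q q′
    (ℕₚ.≤-trans (ℕₚ.≤-reflexive (trans e (sym e′))) (ℕₚ.+-monoʳ-≤ q′ le))

  complement-≥ : ∀ {q q′ t t′} → q + t ≡ N → q′ + t′ ≡ N → q ≤ q′ → t′ ≤ t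
  complement-≥ {q} {q′} {t} {t′} e e′ le = ℕₚ.+-cancelˡ-≤ q t′ t
    (ℕₚ.≤-trans (ℕₚ.+-monoˡ-≤ t′ le) (ℕₚ.≤-reflexive (trans e′ (sym e))))

  chain⇒walk : ∀ {μ lam} p (c : Chain r μ lam) → Linked _≥_ (tops c) → ℓ lam ≤ N → FirstIndex≥ p c →
               Σ (Walk r p (bs μ) (steps c) (bs lam)) λ ω → walkSign ω ≡ chainSign c
  chain⇒walk {μ} p ε l ℓ≤ first = walk-refl p (bs μ)
  chain⇒walk {μ} {lam} p (_◅_ {j = γ} strip c) l ℓ≤ first
    with strip⇒move strip (ℕₚ.≤-trans (ℓ-⊆ {lam} {γ} (λ {x} → chain-⊆ c {x})) ℓ≤)
  ... | p₁ , q₁ , a , qt , sg =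
    let ω , e   = chain⇒walk p₁ c (Linked.tail l) ℓ≤ (next c l ℓ≤)
        ω₁ , e₁ = a ◅ʷ ω
        ω₂ , e₂ = walk-weaken (first p₁ q₁ a) ω₁
    in  ω₂ , trans e₂ (trans e₁ (cong₂ ℤ._*_ (sym sg) e))
    where
    -- A smaller top is a larger end index, so the decreasing tops order the end indices of two
    -- consecutive moves, and `move-move-≥` carries this over to the start indices.
    next : ∀ {lam} (c : Chain r γ lam) → Linked _≥_ (top γ μ ∷ tops c) → ℓ lam ≤ N → FirstIndex≥ p₁ c
    next ε l ℓ≤ = tt
    next {lam} (_◅_ {j = γ′} strip′ c) (top≥ ∷ _) ℓ≤ p′ q′ a′ =
      move-move-≥ a a′ (bs-increasing μ) (bs-increasing γ′)
        (complement-≤ qt (proj₁ (proj₂ (move⇒strip {γ′} {γ} ℓγ′ (ℕₚ.≤-trans (ℓ-⊆ {γ′} {γ} (λ {x} → BorderStrip.contained strip′ {x})) ℓγ′) a′))) top≥)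
      where ℓγ′ = ℕₚ.≤-trans (ℓ-⊆ {lam} {γ′} (λ {x} → chain-⊆ c {x})) ℓ≤

  -- The last component strengthens the induction: the first top of the resulting chain is bounded
  -- by anything that bounds the tops of all moves starting at `p` or later. The preceding strip
  -- supplies its own top as such a bound.
  walk⇒chain : ∀ m {γ lam p} (ω : Walk r p (bs γ) m (bs lam)) → ℓ γ ≤ N → ℓ lam ≤ N →
    Σ (Chain r γ lam) λ c → Linked _≥_ (tops c) ×
    (∀ t → (∀ γ′ p′ q′ → ℓ γ′ ≤ N → p ≤ p′ → Move r (bs γ) (bs γ′) p′ q′ → top γ′ γ ≤ t) →
     Connected.Connected _≥_ (just t) (head (tops c)))
  walk⇒chain zero {γ} {lam} ω ℓγ≤ ℓlam≤ with beads-partition {γ} {lam} ℓγ≤ ℓlam≤ (proj₁ (walk-0 ω))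
  ... | refl = ε , [] , λ t bound → Connected.just-nothing
  walk⇒chain (suc m) {γ} {lam} ω ℓγ≤ ℓlam≤ with firstMove ω
  ... | w , p′ , q , a , p≤p′ , ω′ , _ with beads-surjective (move-increasing a (bs-increasing γ))
  ...   | γ′ , ℓγ′≤ , refl with move⇒strip ℓγ′≤ ℓγ≤ a | walk⇒chain m ω′ ℓγ′≤ ℓlam≤
  ...     | strip , qt , _ | c , l , connected =
    strip ◅ c ,
    connected (top γ′ γ) (λ γ″ p″ q″ ℓγ″≤ p′≤p″ a″ →
      complement-≥ qt (proj₁ (proj₂ (move⇒strip ℓγ″≤ ℓγ′≤ a″))) (move-move-≤ a a″ (bs-increasing γ″) p′≤p″)) Linked.∷′ l ,
    λ t bound → Connected.just (bound γ′ p′ q ℓγ′≤ p≤p′ a)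

  walk-size : ∀ {μ lam m p} → ℓ μ ≤ N → ℓ lam ≤ N → Walk r p (bs μ) m (bs lam) → size lam ≡ m * r + size μ
  walk-size {μ} {lam} {m} ℓμ≤ ℓlam≤ ω = ℕₚ.+-cancelʳ-≡ (triangle 0 N) _ _ (begin
    size lam + triangle 0 N              ≡⟨ size-beads lam ℓlam≤ ⟨
    Vec.sum (bs lam)                     ≡⟨ walk-sum ω ⟩
    m * r + Vec.sum (bs μ)               ≡⟨ cong (m * r +_) (size-beads μ ℓμ≤) ⟩
    m * r + (size μ + triangle 0 N)      ≡⟨ ℕₚ.+-assoc (m * r) (size μ) (triangle 0 N) ⟨
    m * r + size μ + triangle 0 N        ∎)
    where open ≡-Reasoning

-- Whichever decomposition the search returns, it becomes a walk, and the sign of any walk is the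
-- coefficient. If there is none, a walk found by `findWalk` would yield one, so the coefficient is
-- zero.
sgnᵣ-coeff : ∀ r .{{_ : NonZero r}} N {μ lam} m → ℓ μ ≤ N → ℓ lam ≤ N → size lam ≡ size μ + r * m →
  sgnᵣ r lam μ ≡ coeff (beadMoves r (beads (part μ) 0 N) m) (beads (part lam) 0 N)
sgnᵣ-coeff r N {μ} {lam} m ℓμ≤ ℓlam≤ size≡ with decomposition? r lam μ
... | yes (c , l) = walked (steps c) (chain⇒walk (ℕ.>-nonZero⁻¹ r) N 0 c l ℓlam≤ (first c))
  where
  first : ∀ {γ} (c : Chain r γ lam) → FirstIndex≥ (ℕ.>-nonZero⁻¹ r) N 0 c
  first ε       = tt
  first (_ ◅ _) = λ p′ q a → z≤n
  walked : ∀ k → (Σ (Walk r 0 (beads (part μ) 0 N) k (beads (part lam) 0 N)) λ ω → walkSign ω ≡ chainSign c) →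
           chainSign c ≡ coeff (beadMoves r (beads (part μ) 0 N) m) (beads (part lam) 0 N)
  -- The sizes determine the number of strips, since each adds `r` > 0 boxes.
  walked k (ω , e) with k≡m
    where
    k≡m : k ≡ m
    k≡m = ℕₚ.*-cancelʳ-≡ k m r (ℕₚ.+-cancelʳ-≡ (size μ) (k * r) (m * r)
      (trans (sym (walk-size (ℕ.>-nonZero⁻¹ r) N {μ} {lam} ℓμ≤ ℓlam≤ ω))
      (trans size≡ (trans (ℕₚ.+-comm (size μ) (r * m)) (cong (_+ size μ) (ℕₚ.*-comm r m))))))
  ... | refl = trans (sym e) (sym (coeff-walk (ℕ.>-nonZero⁻¹ r) ω (beads-increasing μ 0 N z≤n)))
... | no ¬dec with findWalk (ℕ.>-nonZero⁻¹ r) m (beads (part lam) 0 N) (beads-increasing μ 0 N z≤n)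
...   | inj₁ e = sym e
...   | inj₂ ω = let c , l , _ = walk⇒chain (ℕ.>-nonZero⁻¹ r) N m ω ℓμ≤ ℓlam≤ in contradiction (c , l) ¬dec

-- Enumerating partitions without repetition.

-- `g` recovers x from every element of `f x`, so the lists of distinct x are disjoint.
concatMap-unique : ∀ {A B : Set} (f : A → List B) (g : B → A) {xs} →
  All (λ x → Unique (f x) × All (λ y → g y ≡ x) (f x)) xs → Unique xs → Unique (concatMap f xs)
concatMap-unique f g [] [] = []
concatMap-unique f g {x ∷ xs} ((u , gs) ∷ us) (x∉ ∷ uxs) = Uniqueₚ.++⁺ u (concatMap-unique f g us uxs) disjoint
  where
  disjoint : ∀ {y} → ¬ (y ∈ f x × y ∈ concatMap f xs)
  disjoint {y} (y∈ , y∈′) with find (∈-concatMap⁻ f {xs = xs} y∈′)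
  ... | x′ , x′∈ , y∈fx′ = All.lookup x∉ x′∈ (trans (sym (All.lookup gs y∈)) (All.lookup (proj₂ (All.lookup us x′∈)) y∈fx′))

IsComposition : ℕ → List ℕ → Set
IsComposition n xs = All (0 <_) xs × sum xs ≡ n

-- Undoes one extension step: drops a leading 1 or lowers the first part. The value at a leading
-- zero is a default, the parts of compositions being positive.
shrink : List ℕ → List ℕ
shrink []                 = []
shrink (zero ∷ ks)        = ks
shrink (suc zero ∷ ks)    = ks
shrink (suc (suc k) ∷ ks) = suc k ∷ ks

-- compositions extends its lists by a local function, here the variable ext.
module _ (ext : List ℕ → List (List ℕ)) (ext-[] : ext [] ≡ (1 ∷ []) ∷ [])
         (ext-∷ : ∀ k ks → ext (k ∷ ks) ≡ (1 ∷ k ∷ ks) ∷ (suc k ∷ ks) ∷ []) where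

  ext-composition : ∀ {n} xs → IsComposition n xs → All (IsComposition (suc n)) (ext xs)
  ext-composition []       (_ , refl) rewrite ext-[] = (z<s ∷ [] , refl) ∷ []
  ext-composition (k ∷ ks) (p ∷ ps , refl) rewrite ext-∷ k ks =
    (z<s ∷ p ∷ ps , refl) ∷ (z<s ∷ ps , refl) ∷ []

  ext-unique : ∀ {n} xs → IsComposition n xs → Unique (ext xs) × All (λ ys → shrink ys ≡ xs) (ext xs)
  ext-unique []           _ rewrite ext-[] = ([] ∷ []) , refl ∷ []
  ext-unique (suc k ∷ ks) _ rewrite ext-∷ (suc k) ks = ((λ ()) ∷ []) ∷ [] ∷ [] , refl ∷ refl ∷ []
  ext-unique (zero ∷ ks)  (() ∷ _ , _)

  ext-all : ∀ {n xss} → All (IsComposition n) xss → All (IsComposition (suc n)) (concatMap ext xss)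
  ext-all cs = Allₚ.concat⁺ (Allₚ.map⁺ (All.map (λ {xs} → ext-composition xs) cs))

  ext-all-unique : ∀ {n xss} → All (IsComposition n) xss → Unique xss → Unique (concatMap ext xss)
  ext-all-unique cs = concatMap-unique ext shrink (All.map (λ {xs} → ext-unique xs) cs)

compositions-sound : ∀ n → All (IsComposition n) (compositions n)
compositions-sound zero    = ([] , refl) ∷ []
compositions-sound (suc n) = ext-all _ refl (λ _ _ → refl) (compositions-sound n)

compositions-unique : ∀ n → Unique (compositions n)
compositions-unique zero    = [] ∷ []
compositions-unique (suc n) = ext-all-unique _ refl (λ _ _ → refl) (compositions-sound n) (compositions-unique n)

mapMaybe-all : ∀ {A B : Set} {P : A → Set} {Q : B → Set} (f : A → Maybe B) →
  (∀ {x y} → P x → f x ≡ just y → Q y) → ∀ {xs} → All P xs → All Q (mapMaybe f xs)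
mapMaybe-all f P⇒Q [] = []
mapMaybe-all f P⇒Q (_∷_ {x} p ps) with f x in e
... | just y  = P⇒Q p e ∷ mapMaybe-all f P⇒Q ps
... | nothing = mapMaybe-all f P⇒Q ps

mapMaybe-unique : ∀ {A B : Set} (f : A → Maybe B) → (∀ {x x′ y} → f x ≡ just y → f x′ ≡ just y → x ≡ x′) →
  ∀ {xs} → Unique xs → Unique (mapMaybe f xs)
mapMaybe-unique f inj [] = []
mapMaybe-unique f inj (_∷_ {x} x∉ u) with f x in e
... | just y  = mapMaybe-all f (λ { x≢x′ e′ refl → x≢x′ (inj e e′) }) x∉ ∷ mapMaybe-unique f inj u
... | nothing = mapMaybe-unique f inj u

asPartition⁻ : ∀ xs {lam} → asPartition xs ≡ just lam → xs ≡ parts lam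
asPartition⁻ xs e with All.all? (0 ℕ.<?_) xs | Linked.linked? ℕ._≥?_ xs
asPartition⁻ xs refl | yes p | yes q = refl

Par-size : ∀ n → All (λ lam → size lam ≡ n) (Par n)
Par-size n = mapMaybe-all asPartition (λ {xs} c e → trans (cong sum (sym (asPartition⁻ xs e))) (proj₂ c)) (compositions-sound n)

-- Ensures that the sum over λ takes each partition once; a repetition would multiply its
-- coefficient in `signedBeads`.
Par-unique : ∀ n → Unique (Par n)
Par-unique n = mapMaybe-unique asPartition (λ {xs} {ys} e e′ → trans (asPartition⁻ xs e) (sym (asPartition⁻ ys e′)))
                 (compositions-unique n)

ℓ≤size : ∀ lam → ℓ lam ≤ size lam
ℓ≤size lam = length≤sum (positive lam)
  where
  length≤sum : ∀ {xs} → All (0 <_) xs → length xs ≤ sum xs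
  length≤sum []       = z≤n
  length≤sum (p ∷ ps) = ℕₚ.+-mono-≤ p (length≤sum ps)

-- The signed sum over λ in terms of beads.

module _ (c : Partition → ℤ) (N : ℕ) where

  signedBeads : List Partition → Polynomial N
  signedBeads = map λ lam → c lam , beads (part lam) 0 N

  -- Covers both ways for the coefficient at `u` to vanish: no listed partition has these beads, or
  -- one does but has coefficient zero.
  coeff-absent : ∀ {u xs} → All (λ lam → beads (part lam) 0 N ≡ u → c lam ≡ 0ℤ) xs → coeff (signedBeads xs) u ≡ 0ℤ
  coeff-absent [] = refl
  coeff-absent {u} (_∷_ {lam} absent as) with beads (part lam) 0 N ≟ᵉ u
  ... | yes e = cong₂ ℤ._+_ (absent e) (coeff-absent as)
  ... | no _  = trans (ℤₚ.+-identityˡ _) (coeff-absent as)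

  coeff-present : ∀ {lam xs} → All (λ ν → ℓ ν ≤ N) xs → Unique xs → lam ∈ xs →
                  coeff (signedBeads xs) (beads (part lam) 0 N) ≡ c lam
  coeff-present {lam} {_ ∷ xs} (ℓ≤ ∷ ℓs) (lam∉ ∷ u) (here refl)
    rewrite dec-true (beads (part lam) 0 N ≟ᵉ beads (part lam) 0 N) refl =
    trans (cong (λ z → c lam ℤ.+ z) (coeff-absent (All.zipWith (λ {ν} → λ { (lam≢ν , ℓν≤) e →
      contradiction (sym (beads-partition {ν} {lam} ℓν≤ ℓ≤ e)) lam≢ν }) (lam∉ , ℓs)))) (ℤₚ.+-identityʳ (c lam))
  coeff-present {lam} {ν ∷ xs} (ℓ≤ ∷ ℓs) (ν∉ ∷ u) (there lam∈)
    rewrite dec-false (beads (part ν) 0 N ≟ᵉ beads (part lam) 0 N)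
                      (λ e → All.lookup ν∉ lam∈ (beads-partition {ν} {lam} ℓ≤ (All.lookup ℓs lam∈) e)) =
    trans (ℤₚ.+-identityˡ _) (coeff-present ℓs u lam∈)

module _ (r : ℕ) .{{_ : NonZero r}} (μ : Partition) (m N : ℕ) (large : size μ + r * m ≤ N) where

  private
    0<r = ℕ.>-nonZero⁻¹ r
    candidates = filter (μ ⊆?_) (Par (size μ + r * m))
    ℓμ≤ : ℓ μ ≤ N
    ℓμ≤ = ℕₚ.≤-trans (ℓ≤size μ) (ℕₚ.≤-trans (ℕₚ.m≤m+n (size μ) (r * m)) large)
    sizes : All (λ lam → size lam ≡ size μ + r * m) candidates
    sizes = Allₚ.filter⁺ (μ ⊆?_) (Par-size (size μ + r * m))

  candidates-ℓ : All (λ lam → ℓ lam ≤ N) candidates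
  candidates-ℓ = All.map (λ {lam} e → ℕₚ.≤-trans (ℓ≤size lam) (ℕₚ.≤-trans (ℕₚ.≤-reflexive e) large)) sizes

  -- The combinatorial core, compared at each `u`. A walk to `u` shows that `u` is increasing, hence
  -- the beads of some λ, and the chain obtained from the walk puts λ among the candidates by
  -- containment. Without a walk, any candidate with beads `u` has sign zero.
  signedBeads-beadMoves : signedBeads (λ lam → sgnᵣ r lam μ) N candidates ≈ₚ beadMoves r (beads (part μ) 0 N) m
  signedBeads-beadMoves = coeffs λ u → compare u (findWalk 0<r m u increasing)
    where
    increasing : IncreasingFrom 0 (beads (part μ) 0 N)
    increasing = beads-increasing μ 0 N z≤n
    compare : ∀ u → coeff (beadMoves r (beads (part μ) 0 N) m) u ≡ 0ℤ ⊎ Walk r 0 (beads (part μ) 0 N) m u →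
              coeff (signedBeads (λ lam → sgnᵣ r lam μ) N candidates) u ≡ coeff (beadMoves r (beads (part μ) 0 N) m) u
    compare u (inj₁ zero-coeff) = trans (coeff-absent _ N (All.zipWith (λ {lam} → λ { (size≡ , ℓ≤) refl →
      trans (sgnᵣ-coeff r N {μ} {lam} m ℓμ≤ ℓ≤ size≡) zero-coeff }) (sizes , candidates-ℓ))) (sym zero-coeff)
    compare u (inj₂ ω) with beads-surjective (walk-increasing ω increasing)
    ... | lam , ℓ≤ , refl = trans (coeff-present _ N candidates-ℓ (Uniqueₚ.filter⁺ (μ ⊆?_) (Par-unique (size μ + r * m))) lam∈)
                                  (sgnᵣ-coeff r N {μ} {lam} m ℓμ≤ ℓ≤ size≡)
      where
      size≡ : size lam ≡ size μ + r * m
      size≡ = trans (walk-size 0<r N {μ} {lam} ℓμ≤ ℓ≤ ω)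
                    (trans (ℕₚ.+-comm (m * r) (size μ)) (cong (size μ +_) (ℕₚ.*-comm m r)))
      lam∈ : lam ∈ candidates
      lam∈ = ∈-filter⁺ (μ ⊆?_) (subst (λ n → lam ∈ Par n) size≡ (∈-Par lam))
                       (λ {x} → chain-⊆ (proj₁ (walk⇒chain 0<r N m ω ℓμ≤ ℓ≤)) {x})

-- The identity in many variables.

tabulate-∷ʳ : ∀ n (f : Fin (suc n) → ℕ) → tabulate f ≡ tabulate (f ∘ inject₁) ∷ʳ f (fromℕ n)
tabulate-∷ʳ zero    f = refl
tabulate-∷ʳ (suc n) f = cong (f Fin.zero ∷_) (tabulate-∷ʳ n (f ∘ Fin.suc))

reverse-beads : ∀ f s n → Vec.reverse (beads f s n) ≡ tabulate (λ (j : Fin n) → f (suc (toℕ j)) + (s + n ∸ suc (toℕ j)))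
reverse-beads f s zero    = refl
reverse-beads f s (suc n) = begin
  Vec.reverse (f (suc n) + s ∷ beads f (suc s) n)
    ≡⟨ Vecₚ.reverse-∷ (f (suc n) + s) (beads f (suc s) n) ⟩
  Vec.reverse (beads f (suc s) n) ∷ʳ (f (suc n) + s)
    ≡⟨ cong₂ _∷ʳ_ (trans (reverse-beads f (suc s) n) (Vecₚ.tabulate-cong earlier)) latest ⟩
  tabulate (g ∘ inject₁) ∷ʳ g (fromℕ n)
    ≡⟨ tabulate-∷ʳ n g ⟨
  tabulate g ∎
  where
  open ≡-Reasoning
  g : Fin (suc n) → ℕ
  g j = f (suc (toℕ j)) + (s + suc n ∸ suc (toℕ j))
  earlier : ∀ j → f (suc (toℕ j)) + (suc s + n ∸ suc (toℕ j)) ≡ g (inject₁ j)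
  earlier j rewrite Finₚ.toℕ-inject₁ j | ℕₚ.+-suc s n = refl
  latest : f (suc n) + s ≡ g (fromℕ n)
  latest rewrite Finₚ.toℕ-fromℕ n = cong (f (suc n) +_) (sym (ℕₚ.m+n∸n≡m s (suc n)))

-- The exponents of a_{λ+δ} decrease, so its columns are those of beads in reverse.
eval-alternant-beads : ∀ {N} (F : Functional N) f →
  eval F (alternant (λ j → f (suc (toℕ j)) + δ N j)) ≡ reversalSign N ℤ.* asym F (beads f 0 N)
eval-alternant-beads {N} F f = begin
  eval F (alternant (λ j → f (suc (toℕ j)) + δ N j))    ≡⟨ eval-alternant F _ ⟩
  asym F (tabulate (λ j → f (suc (toℕ j)) + δ N j))     ≡⟨ cong (asym F) (reverse-beads f 0 N) ⟨
  asym F (Vec.reverse (beads f 0 N))                    ≡⟨ alternating-reverse (asym-alternating F) (beads f 0 N) ⟩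
  reversalSign N ℤ.* asym F (beads f 0 N)               ∎
  where open ≡-Reasoning

δ-cancel : ∀ {N} (p q : Polynomial N) →
           (∀ F → eval F (p *ₚ alternant (δ N)) ≡ eval F (q *ₚ alternant (δ N))) → p ≈ₚ q
δ-cancel {N} p q e = coeffs λ α → ℤₚ.i-j≡0⇒i≡j (coeff p α) (coeff q α) (begin
  coeff p α ℤ.- coeff q α              ≡⟨ cong (λ z → coeff p α ℤ.+ z) (ℤₚ.-1*i≡-i (coeff q α)) ⟨
  coeff p α ℤ.+ -1ℤ ℤ.* coeff q α      ≡⟨ cong (λ z → coeff p α ℤ.+ z) (coeff-• -1ℤ q α) ⟨
  coeff p α ℤ.+ coeff (-1ℤ •ₚ q) α     ≡⟨ coeff-++ p (-1ℤ •ₚ q) α ⟨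
  coeff (p +ₚ -1ℤ •ₚ q) α              ≡⟨ coeff-≡ (asym-nonZeroDivisor increasing (p +ₚ -1ℤ •ₚ q) annihilated) α ⟩
  0ℤ                                   ∎)
  where
  open ≡-Reasoning
  ρ : Vec ℕ N
  -- The beads of the empty partition, that is, the entries of δ in increasing order.
  ρ = beads (λ _ → 0) 0 N
  increasing : IncreasingFrom 0 ρ
  increasing = subst (IncreasingFrom 0) (beads-cong 0 N λ { zero _ _ → refl ; (suc i) _ _ → refl })
                     (beads-increasing (mkPartition [] [] []) 0 N z≤n)
  σ = reversalSign N
  product : ∀ F p → eval (λ γ → asym (λ α → F (γ +ᵛ α)) ρ) p ≡ σ ℤ.* eval F (p *ₚ alternant (δ N))
  product F p = begin
    eval (λ γ → asym (λ α → F (γ +ᵛ α)) ρ) p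
      ≡⟨ eval-ext (λ γ → trans (sym (ℤₚ.*-identityˡ _)) (trans (cong (ℤ._* asym (λ α → F (γ +ᵛ α)) ρ) (sym (reversalSign² N)))
           (trans (ℤₚ.*-assoc σ σ (asym (λ α → F (γ +ᵛ α)) ρ)) (cong (σ ℤ.*_) (sym (eval-alternant-beads (λ α → F (γ +ᵛ α)) (λ _ → 0))))))) p ⟩
    eval (λ γ → σ ℤ.* eval (λ α → F (γ +ᵛ α)) (alternant (δ N))) p
      ≡⟨ eval-scale σ _ p ⟩
    σ ℤ.* eval (λ γ → eval (λ α → F (γ +ᵛ α)) (alternant (δ N))) p
      ≡⟨ cong (σ ℤ.*_) (eval-* F p (alternant (δ N))) ⟨
    σ ℤ.* eval F (p *ₚ alternant (δ N)) ∎
    where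
    eval-scale : ∀ c (G : Functional N) p → eval (λ γ → c ℤ.* G γ) p ≡ c ℤ.* eval G p
    eval-scale c G p = trans (eval-ext (λ γ → sym (ℤₚ.+-identityʳ (c ℤ.* G γ))) p)
      (trans (eval-linear c G (λ _ → 0ℤ) p) (trans (cong (λ z → c ℤ.* eval G p ℤ.+ z) (eval-0 p)) (ℤₚ.+-identityʳ _)))
  annihilated : ∀ F → eval (λ γ → asym (λ α → F (γ +ᵛ α)) ρ) (p +ₚ -1ℤ •ₚ q) ≡ 0ℤ
  annihilated F = begin
    eval K (p +ₚ -1ℤ •ₚ q)              ≡⟨ eval-++ K p (-1ℤ •ₚ q) ⟩
    eval K p ℤ.+ eval K (-1ℤ •ₚ q)      ≡⟨ cong (λ z → eval K p ℤ.+ z) (eval-• K -1ℤ q) ⟩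
    eval K p ℤ.+ -1ℤ ℤ.* eval K q       ≡⟨ cong (λ z → z ℤ.+ -1ℤ ℤ.* eval K q)
                                             (trans (product F p) (trans (cong (σ ℤ.*_) (e F)) (sym (product F q)))) ⟩
    eval K q ℤ.+ -1ℤ ℤ.* eval K q       ≡⟨ cancel (eval K q) ⟩
    0ℤ                                  ∎
    where
    K : Functional N
    K γ = asym (λ α → F (γ +ᵛ α)) ρ
    cancel : ∀ a → a ℤ.+ -1ℤ ℤ.* a ≡ 0ℤ
    cancel = ℤ-Solver.solve-∀

-- For each fixed monomial of the complete factor, `p *ₚ a` can be replaced by its alternant once
-- the factors are reordered. The sum over γ then moves inside the antisymmetrisation, becomes
-- `shiftSum`, and moves out again by `shiftSum-asym`.
eval-product-complete : ∀ r {N} m (p a : Polynomial N) β (F : Functional N) → p *ₚ a ≈ₚ alternant β →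
  eval F ((p *ₚ mapExponents (Vec.map (r *_)) (complete N m)) *ₚ a) ≡ shiftSum r m (asym F) (tabulate β)
eval-product-complete r {N} m p a β F e = begin
  eval F ((p *ₚ H) *ₚ a)
    ≡⟨ eval-* F (p *ₚ H) a ⟩
  eval (λ ξ → eval (λ α → F (ξ +ᵛ α)) a) (p *ₚ H)
    ≡⟨ eval-* _ p H ⟩
  eval (λ π → eval (λ η → eval (λ α → F ((π +ᵛ η) +ᵛ α)) a) H) p
    ≡⟨ eval-swap (λ π η → eval (λ α → F ((π +ᵛ η) +ᵛ α)) a) p H ⟩
  eval (λ η → eval (λ π → eval (λ α → F ((π +ᵛ η) +ᵛ α)) a) p) H
    ≡⟨ eval-ext (λ η → eval-ext (λ π → eval-ext (λ α → cong F (trans (cong (_+ᵛ α) (+ᵛ-comm π η)) (+ᵛ-assoc η π α))) a) p) H ⟩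
  eval (λ η → eval (λ π → eval (λ α → F (η +ᵛ (π +ᵛ α))) a) p) H
    ≡⟨ eval-ext (λ η → trans (sym (eval-* (λ α → F (η +ᵛ α)) p a))
                      (trans (eval-cong (λ α → F (η +ᵛ α)) e) (eval-alternant (λ α → F (η +ᵛ α)) β))) H ⟩
  eval (λ η → asym (λ α → F (η +ᵛ α)) (tabulate β)) H
    ≡⟨ asym-eval (λ η α → F (η +ᵛ α)) H (tabulate β) ⟩
  asym (λ α → eval (λ η → F (η +ᵛ α)) H) (tabulate β)
    ≡⟨ asym-cong (λ α → trans (eval-mapExponents (λ η → F (η +ᵛ α)) (Vec.map (r *_)) (complete N m))
                       (trans (eval-ext (λ γ → cong F (+ᵛ-comm (Vec.map (r *_) γ) α)) (complete N m))
                              (eval-complete r m F α))) (tabulate β) ⟩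
  asym (shiftSum r m F) (tabulate β)
    ≡⟨ shiftSum-asym r m F (tabulate β) ⟨
  shiftSum r m (asym F) (tabulate β) ∎
  where
  open ≡-Reasoning
  H = mapExponents (Vec.map (r *_)) (complete N m)

module _ (s : Partition → Λ) (schur : ∀ lam → IsSchur lam (s lam)) where

  eval-schur-sum : ∀ N (c : Partition → ℤ) xs (F : Functional N) → All (λ lam → ℓ lam ≤ N) xs →
    eval F (at (∑ xs (λ lam → c lam • s lam)) N *ₚ alternant (δ N)) ≡
    reversalSign N ℤ.* eval (asym F) (signedBeads c N xs)
  eval-schur-sum N c []         F []         = sym (ℤₚ.*-zeroʳ (reversalSign N))
  eval-schur-sum N c (lam ∷ xs) F (ℓ≤ ∷ ℓs) = begin
    eval F ((c lam •ₚ at (s lam) N +ₚ rest) *ₚ a)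
      ≡⟨ eval-* F (c lam •ₚ at (s lam) N +ₚ rest) a ⟩
    eval K (c lam •ₚ at (s lam) N +ₚ rest)
      ≡⟨ eval-++ K (c lam •ₚ at (s lam) N) rest ⟩
    eval K (c lam •ₚ at (s lam) N) ℤ.+ eval K rest
      ≡⟨ cong₂ ℤ._+_ (eval-• K (c lam) (at (s lam) N)) (sym (eval-* F rest a)) ⟩
    c lam ℤ.* eval K (at (s lam) N) ℤ.+ eval F (rest *ₚ a)
      ≡⟨ cong₂ (λ x y → c lam ℤ.* x ℤ.+ y)
           (trans (sym (eval-* F (at (s lam) N) a))
           (trans (eval-cong F (schur lam N ℓ≤)) (eval-alternant-beads F (part lam))))
           (eval-schur-sum N c xs F ℓs) ⟩
    c lam ℤ.* (σ ℤ.* asym F (beads (part lam) 0 N)) ℤ.+ σ ℤ.* eval (asym F) (signedBeads c N xs)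
      ≡⟨ rearrange (c lam) σ (asym F (beads (part lam) 0 N)) (eval (asym F) (signedBeads c N xs)) ⟩
    σ ℤ.* (c lam ℤ.* asym F (beads (part lam) 0 N) ℤ.+ eval (asym F) (signedBeads c N xs)) ∎
    where
    open ≡-Reasoning
    σ = reversalSign N
    a = alternant (δ N)
    rest = at (∑ xs (λ lam → c lam • s lam)) N
    K : Functional N
    K α = eval (λ β → F (α +ᵛ β)) a
    rearrange : ∀ c e x y → c ℤ.* (e ℤ.* x) ℤ.+ e ℤ.* y ≡ e ℤ.* (c ℤ.* x ℤ.+ y)
    rearrange = ℤ-Solver.solve-∀

  -- Length is at most size, so with this many variables μ and every λ in the sum satisfy the length
  -- bound of `IsSchur`, and multiplication by a_δ turns each Schur polynomial into an alternant.
  -- The common factor `reversalSign N` appears on both sides.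
  manyVariables : ∀ μ r m .{{_ : NonZero r}} N → size μ + r * m ≤ N →
    at (s μ ⊛ (p[ r ]∘ h m)) N ≈ₚ
    at (∑ (filter (μ ⊆?_) (Par (size μ + r * m))) (λ lam → sgnᵣ r lam μ • s lam)) N
  manyVariables μ r m N large = δ-cancel _ (at (∑ candidates (λ lam → sgnᵣ r lam μ • s lam)) N) λ F → begin
    eval F ((at (s μ) N *ₚ mapExponents (Vec.map (r *_)) (complete N m)) *ₚ alternant (δ N))
      ≡⟨ eval-product-complete r m (at (s μ) N) (alternant (δ N)) _ F (schur μ N ℓμ≤) ⟩
    shiftSum r m (asym F) (tabulate (λ j → part μ (suc (toℕ j)) + δ N j))
      ≡⟨ cong (shiftSum r m (asym F)) (reverse-beads (part μ) 0 N) ⟨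
    shiftSum r m (asym F) (Vec.reverse μ-beads)
      ≡⟨ alternating-reverse (shiftSum-alternating r m (asym-alternating F)) μ-beads ⟩
    reversalSign N ℤ.* shiftSum r m (asym F) μ-beads
      ≡⟨ cong (reversalSign N ℤ.*_) (eval-beadMoves r (asym-alternating F) μ-beads m) ⟨
    reversalSign N ℤ.* eval (asym F) (beadMoves r μ-beads m)
      ≡⟨ cong (reversalSign N ℤ.*_) (eval-cong (asym F) (signedBeads-beadMoves r μ m N large)) ⟨
    reversalSign N ℤ.* eval (asym F) (signedBeads (λ lam → sgnᵣ r lam μ) N candidates)
      ≡⟨ eval-schur-sum N (λ lam → sgnᵣ r lam μ) candidates F (candidates-ℓ r μ m N large) ⟨
    eval F (at (∑ candidates (λ lam → sgnᵣ r lam μ • s lam)) N *ₚ alternant (δ N)) ∎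
    where
    open ≡-Reasoning
    candidates = filter (μ ⊆?_) (Par (size μ + r * m))
    μ-beads = beads (part μ) 0 N
    ℓμ≤ : ℓ μ ≤ N
    ℓμ≤ = ℕₚ.≤-trans (ℓ≤size μ) (ℕₚ.≤-trans (ℕₚ.m≤m+n (size μ) (r * m)) large)

-- Descent to few variables.

restrict-cong : ∀ {N} {p q : Polynomial (suc N)} → p ≈ₚ q → restrict p ≈ₚ restrict q
restrict-cong {p = p} {q} e = coeffs λ α →
  trans (coeff-restrict p α) (trans (coeff-≡ e (0 ∷ α)) (sym (coeff-restrict q α)))

≈-fromLarge : ∀ f g K → (∀ N → K ≤ N → at f N ≈ₚ at g N) → f ≈ g
-- `K + N` variables are enough for `large` and lie exactly `K` restrictions above `N`.
≈-fromLarge f g K large N = descend K N (large (K + N) (ℕₚ.m≤m+n K N))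
  where
  descend : ∀ k N → at f (k + N) ≈ₚ at g (k + N) → at f N ≈ₚ at g N
  descend zero    N e = e
  descend (suc k) N e = descend k N (coeffs λ α →
    trans (sym (coeff-≡ (stable f (k + N)) α))
    (trans (coeff-≡ (restrict-cong e) α) (coeff-≡ (stable g (k + N)) α)))

theorem1p1 : (s : Partition → Λ) → (∀ lam → IsSchur lam (s lam)) →
    (μ : Partition) (r m : ℕ) .{{_ : NonZero r}} .{{_ : NonZero m}} →
    s μ ⊛ (p[ r ]∘ h m)
    ≈ ∑ (filter (μ ⊆?_) (Par (size μ + r * m))) (λ lam → sgnᵣ r lam μ • s lam)
theorem1p1 s schur μ r m =
  ≈-fromLarge (s μ ⊛ (p[ r ]∘ h m)) (∑ (filter (μ ⊆?_) (Par (size μ + r * m))) (λ lam → sgnᵣ r lam μ • s lam))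
    (size μ + r * m) (manyVariables s schur μ r m)
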